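{- Let $\Omega^{(2)}_n$ denote the polytope of all $n\times n\times n$ arrays of nonnegative real numbers in which every line sums to $1$, and let $L_n$ denote the number of Latin squares of order $n$. Then the number of vertices of $\Omega^{(2)}_n$ is at least $L_n^{\frac{3}{2}-o(1)}$, where $o(1)$ denotes a quantity tending to $0$ as $n\to\infty$.
   Context: A line in an $n\times n\times n$ array $A$ is a set of $n$ entries obtained by fixing two of the three indices and letting the third range over $\{1,\dots,n\}$ (i.e. $A(\cdot,j,k)$, $A(i,\cdot,k)$ or $A(i,j,\cdot)$). Arrays in $\Omega^{(2)}_n$ are called tristochastic. A Latin square of order $n$ is an $n\times n$ matrix with entries in $\{1,\dots,n\}$ in which each symbol appears exactly once in every row and every column.
   Formalization: The arrays have rational instead of real entries, and a vertex is a point that is extreme among rational arrays with rational convex combinations; as the polytope is defined by rational constraints, its vertices are the same. -}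

module Defs where

open import Data.Nat using (ℕ; zero; suc)
import Data.Nat as ℕ
open import Data.Nat.Properties using () renaming (_≟_ to _≟ℕ_)
open import Data.Bool using (Bool; true; false)
open import Data.Fin using (Fin; zero; suc)
open import Data.Fin.Properties using (all?) renaming (_≟_ to _≟F_)
open import Data.List using (List; []; _∷_; length; filter; concatMap; map)
open import Data.Fin.Base using () 
open import Data.Rational using (ℚ; 0ℚ; 1ℚ; _+_; _*_; _-_; _≤_; _<_)
open import Data.Product using (_×_; Σ)
open import Relation.Binary.PropositionalEquality using (_≡_)
open import Relation.Nullary using (¬_; Dec)
open import Relation.Nullary.Decidable using (⌊_⌋; _×-dec_)
open import Data.List.Base using (allFin)

sumℚ : ∀ {n} → (Fin n → ℚ) → ℚ
sumℚ {zero}  f = 0ℚ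
sumℚ {suc n} f = f zero + sumℚ (λ i → f (suc i))

countFin : ∀ {n} → (Fin n → Bool) → ℕ
countFin {zero}  f = 0
countFin {suc n} f with f zero
... | true  = suc (countFin (λ i → f (suc i)))
... | false = countFin (λ i → f (suc i))

Array : ℕ → Set
Array n = Fin n → Fin n → Fin n → ℚ

_≋_ : ∀ {n} → Array n → Array n → Set
A ≋ B = ∀ i j k → A i j k ≡ B i j k

Tristochastic : ∀ {n} → Array n → Set
Tristochastic A =
  (∀ i j k → 0ℚ ≤ A i j k) ×
  (∀ j k → sumℚ (λ i → A i j k) ≡ 1ℚ) ×
  (∀ i k → sumℚ (λ j → A i j k) ≡ 1ℚ) ×
  (∀ i j → sumℚ (λ k → A i j k) ≡ 1ℚ)

convex : ∀ {n} → ℚ → Array n → Array n → Array n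
convex t B C i j k = t * B i j k + (1ℚ - t) * C i j k

IsVertex : ∀ {n} → Array n → Set
IsVertex {n} A = Tristochastic A ×
  (∀ (B C : Array n) (t : ℚ) → Tristochastic B → Tristochastic C →
     0ℚ < t → t < 1ℚ → A ≋ convex t B C → B ≋ C)

HasDistinctVertices : ℕ → ℕ → Set
HasDistinctVertices n k =
  Σ (Fin k → Array n) λ V →
    (∀ a → IsVertex (V a)) × (∀ a b → V a ≋ V b → a ≡ b)

Square : ℕ → Set
Square n = Fin n → Fin n → Fin n

IsLatin : ∀ {n} → Square n → Set
IsLatin M =
  (∀ i s → countFin (λ j → ⌊ M i j ≟F s ⌋) ≡ 1) ×
  (∀ j s → countFin (λ i → ⌊ M i j ≟F s ⌋) ≡ 1)

isLatin? : ∀ {n} (M : Square n) → Dec (IsLatin M)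
isLatin? M =
  all? (λ i → all? (λ s → countFin (λ j → ⌊ M i j ≟F s ⌋) ≟ℕ 1)) ×-dec
  all? (λ j → all? (λ s → countFin (λ i → ⌊ M i j ≟F s ⌋) ≟ℕ 1))

allFunctions : ∀ {a} {A : Set a} → List A → (n : ℕ) → List (Fin n → A)
allFunctions xs zero    = (λ ()) ∷ []
allFunctions xs (suc n) =
  concatMap (λ x → map (λ f → λ { zero → x ; (suc i) → f i })
                       (allFunctions xs n)) xs

allSquares : (n : ℕ) → List (Square n)
allSquares n = allFunctions (allFunctions (allFin n) n) n

L : ℕ → ℕ
L n = length (filter isLatin? (allSquares n))

{-# OPTIONS --safe #-}

-- A half-integral point is assembled from two structures that each put every cell of the n × n
-- square into one layer.  The first is given by a proper colouring α of the circulant bipartite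
-- graph with edges (i , i + 2m + 1), m < h = ⌊n/2⌋: layer d holds the cells (i , j) and (i + 1 , j)
-- for the edges (i , j) of colour d, and these form a Hamiltonian cycle whatever α is.  The second is
-- a Latin square with two symbols per layer.  A tristochastic array with the same support is thus
-- described by one parameter per colour; column 0 of the suitably normalised Latin square makes
-- the parameters equal, and one pair of symbols in row 0 forces the common value 1/2.  So the point
-- is a vertex.
--
-- Normalising and pairing symbols costs a factor n^(2n) 2^(n²), so it remains to find n^(n²/2 - o(n²))
-- colourings α.  A 2d-regular bipartite graph on n + n vertices splits into two d-regular graphs in
-- at least ((2d-1)!!/d!)^(2n) ways: pair the edges at every vertex, 2-colour the resulting even
-- cycles, and note that a splitting arises from at most (d!)^(2n) pairings.  Iterating this on
-- 2^a-regular blocks gives the colourings, and Lₙ ≤ n^(n²) finishes the comparison.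

module Submission where

open import Defs
open import Data.Nat using (ℕ; zero; suc; NonZero)
import Data.Nat as ℕ
import Data.Nat.Properties as ℕ
open import Data.Bool using (Bool; true; false; T; not; if_then_else_; _∧_; _xor_)
open import Data.Bool.Properties using (T?; T-≡; ∧-comm; not-involutive)
open import Data.Bool.ListAction using (all)
open import Data.Fin using (Fin; zero; suc; toℕ; inject₁; splitAt; combine; remQuot; _↑ˡ_; _↑ʳ_)
open import Data.Product using (Σ; _×_; _,_; proj₁; proj₂)
open import Data.Unit using (⊤; tt)
open import Data.Sum using (_⊎_; inj₁; inj₂)
open import Data.Empty using (⊥; ⊥-elim)
open import Data.List using (List; []; _∷_; _++_; length; lookup; filterᵇ; map; concat; concatMap; cartesianProduct; cartesianProductWith; allFin; take; drop)
open import Data.List.Properties using (length-++; length-map; length-filter; length-take; length-drop; length-tabulate; length-removeAt′; take++drop≡id; filter-++)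
open import Data.List.Membership.Propositional using (_∈_)
open import Data.List.Membership.Propositional.Properties using (∈-filter⁺; ∈-filter⁻; ∈-++⁺ˡ; ∈-++⁺ʳ; ∈-++⁻; ∈-allFin; ∈-lookup; ∈-cartesianProductWith⁺; ∈-cartesianProductWith⁻)
open import Data.List.Relation.Unary.Any as Any using (Any; here; there; _─_)
import Data.List.Relation.Unary.Any.Properties as AnyP
open import Data.List.Relation.Unary.All as All using (All; []; _∷_)
import Data.List.Relation.Unary.All.Properties as AllP
open import Data.List.Relation.Unary.AllPairs as AllPairs using (AllPairs; []; _∷_)
import Data.List.Relation.Unary.AllPairs.Properties as AllPairsP
open import Data.List.Relation.Unary.Unique.Propositional using (Unique)
import Data.List.Relation.Unary.Unique.Propositional.Properties as UniqueP
open import Function using (_∘_; id)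
open import Function.Bundles using (Equivalence)
open import Relation.Binary.Definitions using (DecidableEquality)
open import Relation.Binary.PropositionalEquality using (_≡_; _≢_; refl; sym; trans; cong; cong₂; subst; subst₂; setoid)
open import Relation.Nullary using (¬_; Dec; yes; no; does)
open import Relation.Nullary.Decidable using (⌊_⌋; toWitness; fromWitness; dec-true; dec-false)

-- The obstacle is connectedness. Two symbols of an arbitrary Latin square form a union of cycles,
-- and each cycle would bring its own free parameter. In the first structure connectedness is built
-- in: a colour has one edge at every row, and the two cells of that edge lead from row `i` to row
-- `i + 1` inside one column. The cycle therefore visits the rows in cyclic order, whichever columns
-- `α` selects. The symbol layers need no such control, because in a cell of an edge the value of
-- the symbol slot is 1 minus the value of the colour slot.
--
-- The exponent 3/2 is 1 + 1/2: the Latin square contributes almost L_n, and `α`, with only about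
-- n/2 colours, contributes about the square root of n^(n²).
--
-- Splitting a graph of degree 2^(a+1) loses 2n(a+1) bits. Over a whole block of degree 2^a the loss
-- stays below 4n 2^a bits, against a main term of n a 2^a bits. So `a` has to grow like log n,
-- while the blocks must stay small compared with n, since the shifts left outside them are not
-- counted. Blocks of size 2^l / 2^(m+5), with 2^l between n and 2n, meet both demands.

private variable
  A B C : Set

-- Two-colouring the union of two perfect matchings.

module Counting where
  open import Data.Nat using (_+_; _*_; _∸_; _^_; _⊓_; _≤_; _<_; z≤n; s≤s; _!; >-nonZero)
  open import Data.Nat.Properties hiding (_≟_)
  open import Data.Nat.Solver using (module +-*-Solver)
  import Data.Fin.Properties as Fin
  open import Data.Product.Properties using (≡-dec)
  import Data.List.Membership.DecPropositional as DecMembership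
  open import Data.List.Relation.Binary.Permutation.Propositional using (_↭_; prep; swap; ↭-refl; ↭-sym; ↭-trans; ↭-reflexive; ↭⇒↭ₛ)
  open import Data.List.Relation.Binary.Permutation.Propositional.Properties using (∈-resp-↭; drop-∷; ↭-length; filter-↭; ++⁺; ++⁺ˡ; shift)
  import Data.List.Relation.Binary.Permutation.Setoid.Properties as PermS

  module Colouring {E : Set} (_≟_ : DecidableEquality E) where

    flat : List (E × E) → List E
    flat []            = []
    flat ((x , y) ∷ p) = x ∷ y ∷ flat p

    Bi : (E → Bool) → E × E → Set
    Bi c (x , y) = c x ≡ not (c y)

    Bi-sym : ∀ c {x y} → Bi c (x , y) → Bi c (y , x)
    Bi-sym c {x} {y} e = trans (sym (not-involutive (c y))) (cong not (sym e))

    AllBi-cong : ∀ {c c'} p → (∀ {x} → x ∈ flat p → c x ≡ c' x) → All (Bi c') p → All (Bi c) p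
    AllBi-cong []            h []         = []
    AllBi-cong ((x , y) ∷ p) h (e ∷ es) =
      trans (h (here refl)) (trans e (cong not (sym (h (there (here refl))))))
      ∷ AllBi-cong p (h ∘ there ∘ there) es

    -- Matchings are lists of pairs, so the pair of `a` is brought to the front. The last component
    -- carries bichromaticity back from the rearranged pairs to `q`.
    partner : ∀ {a} q → a ∈ flat q → Σ E λ a' → Σ (List (E × E)) λ q' →
              (flat q ↭ a ∷ a' ∷ flat q') × (∀ c → Bi c (a , a') → All (Bi c) q' → All (Bi c) q)
    partner ((x , y) ∷ q) (here refl)         = y , q , ↭-refl , λ _ e es → e ∷ es
    partner ((x , y) ∷ q) (there (here refl)) = x , q , swap x y ↭-refl , λ c e es → Bi-sym c e ∷ es
    partner {a} ((x , y) ∷ q) (there (there i)) with partner q i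
    ... | a' , q' , eq , k = a' , (x , y) ∷ q' ,
          ↭-trans (prep x (prep y eq)) (↭-trans (prep x (swap y a ↭-refl)) (↭-trans (swap x a ↭-refl)
            (prep a (↭-trans (prep x (swap y a' ↭-refl)) (swap x a' ↭-refl))))) ,
          λ { c e (f ∷ es) → f ∷ k c e es }

    _[_↦_] : (E → Bool) → E → Bool → E → Bool
    (c [ a ↦ b ]) x with x ≟ a
    ... | yes _ = b
    ... | no  _ = c x

    update-same : ∀ c a b → (c [ a ↦ b ]) a ≡ b
    update-same c a b with a ≟ a
    ... | yes _ = refl
    ... | no  n = ⊥-elim (n refl)

    update-other : ∀ c a b {x} → a ≢ x → (c [ a ↦ b ]) x ≡ c x
    update-other c a b {x} n with x ≟ a
    ... | yes e = ⊥-elim (n (sym e))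
    ... | no  _ = refl

    -- Two perfect matchings on the same set form even cycles.  The colouring is found by
    -- removing the edge (a , b) of the first matching and joining the partners of a and b
    -- in the second one.
    euler : ∀ p q → Unique (flat p) → flat p ↭ flat q →
            Σ (E → Bool) λ c → All (Bi c) p × All (Bi c) q
    euler [] []      u e = (λ _ → true) , [] , []
    euler [] (_ ∷ _) u e with () ← ∈-resp-↭ (↭-sym e) (here refl)
    euler ((a , b) ∷ p) q ((a≢b ∷ a∉p) ∷ b∉p ∷ u) e
      with partner q (∈-resp-↭ e (here refl))
    ... | a' , q₁ , e₁ , k₁ with drop-∷ (↭-trans e e₁)
    ... | e₂ with ∈-resp-↭ e₂ (here refl)
    -- Here `a` and `b` are also paired in `q`. They form a closed cycle of length two, whose
    -- colours may be chosen freely.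
    ... | here refl = c , trans ca (cong not (sym cb)) ∷ on-p , k₁ c (trans ca (cong not (sym cb))) on-q
      where
      e₃ : flat p ↭ flat q₁
      e₃ = drop-∷ e₂
      ih : _
      ih = euler p q₁ u e₃
      c : E → Bool
      c = (proj₁ ih [ b ↦ false ]) [ a ↦ true ]
      ca : c a ≡ true
      ca = update-same _ a true
      cb : c b ≡ false
      cb = trans (update-other _ a true a≢b) (update-same _ b false)
      agree : ∀ {x} → x ∈ flat p → c x ≡ proj₁ ih x
      agree i = trans (update-other _ a true (All.lookup a∉p i)) (update-other _ b false (All.lookup b∉p i))
      on-p : All (Bi c) p
      on-p = AllBi-cong p agree (proj₁ (proj₂ ih))
      on-q : All (Bi c) q₁
      on-q = AllBi-cong q₁ (agree ∘ ∈-resp-↭ (↭-sym e₃)) (proj₂ (proj₂ ih))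
    ... | there i with partner q₁ i
    ... | b' , q₂ , e₃ , k₂ =
          -- `a` and `b` receive the colours opposite to `a'` and `b'`. The recursive colouring
          -- separates `a'` from `b'`, so `a` and `b` are separated as well.
          c , trans ca (trans (cong not (All.head (proj₂ (proj₂ ih)))) (cong not (sym cb))) ∷ on-p ,
          k₁ c (trans ca (cong not (sym (agree a'∈p))))
               (k₂ c (trans cb (cong not (sym (agree b'∈p)))) on-q)
      where
      e₄ : flat p ↭ flat ((a' , b') ∷ q₂)
      e₄ = drop-∷ (↭-trans e₂ (↭-trans (prep a' e₃) (swap a' b ↭-refl)))
      ih : _
      ih = euler p ((a' , b') ∷ q₂) u e₄
      c' : E → Bool
      c' = proj₁ ih
      c : E → Bool
      c = (c' [ b ↦ not (c' b') ]) [ a ↦ not (c' a') ]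
      ca : c a ≡ not (c' a')
      ca = update-same _ a _
      cb : c b ≡ not (c' b')
      cb = trans (update-other _ a _ a≢b) (update-same _ b _)
      agree : ∀ {x} → x ∈ flat p → c x ≡ c' x
      agree j = trans (update-other _ a _ (All.lookup a∉p j)) (update-other _ b _ (All.lookup b∉p j))
      a'∈p : a' ∈ flat p
      a'∈p = ∈-resp-↭ (↭-sym e₄) (here refl)
      b'∈p : b' ∈ flat p
      b'∈p = ∈-resp-↭ (↭-sym e₄) (there (here refl))
      on-p : All (Bi c) p
      on-p = AllBi-cong p agree (proj₁ (proj₂ ih))
      on-q : All (Bi c) q₂
      on-q = AllBi-cong q₂ (λ j → agree (∈-resp-↭ (↭-sym e₄) (there (there j)))) (All.tail (proj₂ (proj₂ ih)))

  -- Counting in lists and choosing representatives.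

  count : (A → Bool) → List A → ℕ
  count p xs = length (filterᵇ p xs)

  count-++ : (p : A → Bool) → ∀ xs ys → count p (xs ++ ys) ≡ count p xs + count p ys
  count-++ p xs ys = trans (cong length (filter-++ (T? ∘ p) xs ys)) (length-++ (filterᵇ p xs))

  count-map : (p : B → Bool) (f : A → B) → ∀ xs → count p (map f xs) ≡ count (p ∘ f) xs
  count-map p f []       = refl
  count-map p f (x ∷ xs) with p (f x)
  ... | true  = cong suc (count-map p f xs)
  ... | false = count-map p f xs

  count-↭ : (p : A → Bool) → ∀ {xs ys} → xs ↭ ys → count p xs ≡ count p ys
  count-↭ p e = ↭-length (filter-↭ (T? ∘ p) e)

  count-cong : {p q : A → Bool} → (∀ x → p x ≡ q x) → ∀ xs → count p xs ≡ count q xs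
  count-cong         h []       = refl
  count-cong {p = p} h (x ∷ xs) rewrite sym (h x) with p x
  ... | true  = cong suc (count-cong h xs)
  ... | false = count-cong h xs

  count-none : (xs : List A) → count (λ _ → false) xs ≡ 0
  count-none []       = refl
  count-none (_ ∷ xs) = count-none xs

  count-accept : (p : A → Bool) → ∀ {x} xs → p x ≡ true → count p (x ∷ xs) ≡ suc (count p xs)
  count-accept p {x} xs e rewrite e = refl

  count-filter : (p q : A → Bool) → ∀ xs → count p (filterᵇ q xs) ≡ count (λ x → q x ∧ p x) xs
  count-filter p q []       = refl
  count-filter p q (x ∷ xs) with q x
  ... | false = count-filter p q xs
  ... | true  with p x
  ... | true  = cong suc (count-filter p q xs)
  ... | false = count-filter p q xs

  count-filter-≤ : (p q : A → Bool) → ∀ xs → count p (filterᵇ q xs) ≤ count p xs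
  count-filter-≤ p q []       = z≤n
  count-filter-≤ p q (x ∷ xs) with q x
  count-filter-≤ p q (x ∷ xs) | true with p x
  ... | true  = s≤s (count-filter-≤ p q xs)
  ... | false = count-filter-≤ p q xs
  count-filter-≤ p q (x ∷ xs) | false with p x
  ... | true  = m≤n⇒m≤1+n (count-filter-≤ p q xs)
  ... | false = count-filter-≤ p q xs

  count-not : (p : A → Bool) → ∀ xs → count p xs + count (not ∘ p) xs ≡ length xs
  count-not p []       = refl
  count-not p (x ∷ xs) with p x
  ... | true  = cong suc (count-not p xs)
  ... | false = trans (+-suc (count p xs) _) (cong suc (count-not p xs))

  count-concatMap-≤ : (p : B → Bool) (q : A → Bool) (f : A → List B) (m : ℕ) → ∀ {xs} →
    All (λ x → count p (f x) ≤ (if q x then m else 0)) xs → count p (concatMap f xs) ≤ count q xs * m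
  count-concatMap-≤ p q f m []                 = z≤n
  count-concatMap-≤ p q f m {x ∷ xs} (h ∷ hs) rewrite count-++ p (f x) (concatMap f xs) with q x
  ... | true  = +-mono-≤ h (count-concatMap-≤ p q f m hs)
  ... | false = +-mono-≤ h (count-concatMap-≤ p q f m hs)

  length-concatMap : (f : A → List B) (m : ℕ) → ∀ {xs} →
    All (λ x → length (f x) ≡ m) xs → length (concatMap f xs) ≡ length xs * m
  length-concatMap f m []                = refl
  length-concatMap f m {x ∷ xs} (h ∷ hs) =
    trans (length-++ (f x)) (cong₂ _+_ h (length-concatMap f m hs))

  count-cart : (f : A → B → C) (p : C → Bool) (q : A → Bool) (r : B → Bool) →
    (∀ x y → p (f x y) ≡ q x ∧ r y) → ∀ xs ys →
    count p (cartesianProductWith f xs ys) ≡ count q xs * count r ys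
  count-cart f p q r h []       ys = refl
  count-cart f p q r h (x ∷ xs) ys
    rewrite count-++ p (map (f x) ys) (cartesianProductWith f xs ys)
          | count-cart f p q r h xs ys
          | count-map p (f x) ys
          | count-cong (h x) ys with q x
  ... | true  = refl
  ... | false = cong (_+ count q xs * count r ys) (count-none ys)

  length-cart : (f : A → B → C) → ∀ xs ys → length (cartesianProductWith f xs ys) ≡ length xs * length ys
  length-cart f []       ys = refl
  length-cart f (x ∷ xs) ys = trans (length-++ (map (f x) ys)) (cong₂ _+_ (length-map (f x) ys) (length-cart f xs ys))

  All-cart : {P : A → Set} {Q : B → Set} {R : C → Set} (f : A → B → C) → (∀ {x y} → P x → Q y → R (f x y)) →
    ∀ {xs ys} → All P xs → All Q ys → All R (cartesianProductWith f xs ys)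
  All-cart f h []       qs = []
  All-cart f h (p ∷ ps) qs = AllP.++⁺ (AllP.map⁺ (All.map (h p) qs)) (All-cart f h ps qs)

  AllPairs-cart : {R : A → A → Set} {S : B → B → Set} {U : C → C → Set} (f : A → B → C) →
    (∀ {x x' y y'} → R x x' → U (f x y) (f x' y')) → (∀ {x y y'} → S y y' → U (f x y) (f x y')) →
    ∀ {xs ys} → AllPairs R xs → AllPairs S ys → AllPairs U (cartesianProductWith f xs ys)
  AllPairs-cart f g h []                  ss = []
  AllPairs-cart f g h {x ∷ xs} {ys} (r ∷ rs) ss =
    AllPairsP.++⁺ (AllPairsP.map⁺ (AllPairs.map h ss)) (AllPairs-cart f g h rs ss)
      (AllP.map⁺ (All.universal (λ y → All-cart {Q = λ _ → ⊤} f (λ r _ → g r) r (All.universal (λ _ → tt) ys)) ys))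

  -- Representatives are chosen greedily: each one removes the at most m elements compatible with it.
  greedy : (R : A → A → Bool) (m : ℕ) → (∀ x → R x x ≡ true) → ∀ xs → All (λ x → count (R x) xs ≤ m) xs →
    Σ (List A) λ ys → AllPairs (λ y y' → R y y' ≡ false) ys × length xs ≤ m * length ys
  greedy {A = A} R m R-refl xs h = proj₁ reps , proj₁ (proj₂ reps)
    where
    -- `k` is fuel, since the recursion runs on a filtered list. The last component expresses that
    -- `ys` is drawn from `xs`: whatever holds for all elements of `xs` holds for all of `ys`.
    go : ∀ k xs → length xs ≤ k → All (λ x → count (R x) xs ≤ m) xs →
      Σ (List A) λ ys → (AllPairs (λ y y' → R y y' ≡ false) ys × length xs ≤ m * length ys) ×
        (∀ {P : A → Set} → All P xs → All P ys)
    go k       []       _       _        = [] , ([] , z≤n) , λ _ → []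
    go (suc k) (x ∷ xs) (s≤s l) (b ∷ bs) =
      x ∷ ys , (apart ∷ pairs , bound) , λ { (p ∷ ps) → p ∷ sub (AllP.filter⁺ (T? ∘ (not ∘ R x)) ps) }
      where
      rest : List A
      rest = filterᵇ (not ∘ R x) xs
      shrink : length rest ≤ length xs
      shrink = ≤-trans (m≤n+m _ (count (R x) xs)) (≤-reflexive (count-not (R x) xs))
      drop-head : ∀ {y} → count (R y) (x ∷ xs) ≤ m → count (R y) xs ≤ m
      drop-head {y} h with R y x
      ... | true  = ≤-trans (n≤1+n _) h
      ... | false = h
      ih : _
      ih = go k rest (≤-trans shrink l)
             (AllP.filter⁺ (T? ∘ (not ∘ R x))
               (All.map (λ {y} h → ≤-trans (count-filter-≤ (R y) (not ∘ R x) xs) (drop-head {y} h)) bs))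
      ys : List A
      ys = proj₁ ih
      pairs = proj₁ (proj₁ (proj₂ ih))
      sub : ∀ {P : A → Set} → All P rest → All P ys
      sub = proj₂ (proj₂ ih)
      T-not : ∀ {c} → T (not c) → c ≡ false
      T-not {false} _ = refl
      apart : All (λ y → R x y ≡ false) ys
      apart = sub (All.map T-not (AllP.all-filter (T? ∘ (not ∘ R x)) xs))
      -- Reflexivity puts `x` among the elements compatible with it, so `x` and all that it removes
      -- number at most `m`.
      here-bound : suc (count (R x) xs) ≤ m
      here-bound = subst (_≤ m) (count-accept (R x) xs (R-refl x)) b
      bound : suc (length xs) ≤ m * suc (length ys)
      bound = begin
        suc (length xs)                           ≡⟨ cong suc (sym (count-not (R x) xs)) ⟩
        suc (count (R x) xs) + length rest        ≤⟨ +-mono-≤ here-bound (proj₂ (proj₁ (proj₂ ih))) ⟩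
        m + m * length ys                         ≡⟨ sym (*-suc m (length ys)) ⟩
        m * suc (length ys)                       ∎
        where open ≤-Reasoning
    reps : _
    reps = go (length xs) xs ≤-refl h

  -- Pairings of the edges at a vertex.

  picks : List A → List (A × List A)
  picks []       = []
  picks (x ∷ xs) = (x , xs) ∷ map (λ { (y , ys) → y , x ∷ ys }) (picks xs)

  pairings : ℕ → List A → List (List (A × A))
  pairings zero    _        = [] ∷ []
  pairings (suc d) []       = []
  pairings (suc d) (x ∷ xs) = concatMap (λ { (y , ys) → map ((x , y) ∷_) (pairings d ys) }) (picks xs)

  picks-↭ : ∀ (xs : List A) → All (λ { (y , ys) → y ∷ ys ↭ xs }) (picks xs)
  picks-↭ []       = []
  picks-↭ (x ∷ xs) = ↭-refl ∷ AllP.map⁺ (All.map (λ { {y , ys} e → ↭-trans (swap y x ↭-refl) (prep x e) }) (picks-↭ xs))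

  length-picks : ∀ (xs : List A) → length (picks xs) ≡ length xs
  length-picks []       = refl
  length-picks (x ∷ xs) = cong suc (trans (length-map _ (picks xs)) (length-picks xs))

  count-picks : (q : A → Bool) → ∀ xs → count (q ∘ proj₁) (picks xs) ≡ count q xs
  count-picks q []       = refl
  count-picks q (x ∷ xs) with q x
  ... | true  = cong suc (trans (count-map (q ∘ proj₁) _ (picks xs)) (count-picks q xs))
  ... | false = trans (count-map (q ∘ proj₁) _ (picks xs)) (count-picks q xs)

  -- The odd double factorial (2d - 1)!!: the first of 2d points has 2d - 1 possible partners, and
  -- 2d - 2 points remain.
  double-! : ℕ → ℕ
  double-! zero    = 1
  double-! (suc d) = suc (d + d) * double-! d

  pred-even : ∀ {k} d → suc k ≡ suc d + suc d → k ≡ suc (d + d)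
  pred-even d e = trans (suc-injective e) (+-suc d d)

  length-pairings : ∀ d (xs : List A) → length xs ≡ d + d → length (pairings d xs) ≡ double-! d
  length-pairings zero    xs       e = refl
  length-pairings (suc d) (x ∷ xs) e =
    trans (length-concatMap _ (double-! d) (All.map (λ { {y , ys} p →
             trans (length-map _ (pairings d ys))
               (length-pairings d ys (suc-injective (trans (↭-length p) (pred-even d e)))) }) (picks-↭ xs)))
          (cong (_* double-! d) (trans (length-picks xs) (pred-even d e)))

  module Splitting {E : Set} (_≟_ : DecidableEquality E) where
    open Colouring _≟_

    flat-pairings : ∀ d xs → length xs ≡ d + d → All (λ p → flat p ↭ xs × length p ≡ d) (pairings d xs)
    flat-pairings zero    []       e = (↭-refl , refl) ∷ []
    flat-pairings (suc d) (x ∷ xs) e =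
      AllP.concat⁺ (AllP.map⁺ (All.map (λ { {y , ys} p → AllP.map⁺ (All.map
         (λ { (f , l) → prep x (↭-trans (prep y f) p) , cong suc l })
         (flat-pairings d ys (suc-injective (trans (↭-length p) (pred-even d e))))) }) (picks-↭ xs)))

    bi : (E → Bool) → E × E → Bool
    bi c (x , y) = c x xor c y

    bi⇒Bi : ∀ c z → bi c z ≡ true → Bi c z
    bi⇒Bi c (x , y) e with c x | c y
    ... | true  | false = refl
    ... | false | true  = refl

    Bi⇒bi : ∀ c z → Bi c z → bi c z ≡ true
    Bi⇒bi c (x , y) e rewrite e with c y
    ... | true  = refl
    ... | false = refl

    all⇒All : ∀ c p → all (bi c) p ≡ true → All (Bi c) p
    all⇒All c []      _ = []
    all⇒All c (z ∷ p) e with bi c z in eq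
    ... | true = bi⇒Bi c z eq ∷ all⇒All c p e

    All⇒all : ∀ c p → All (Bi c) p → all (bi c) p ≡ true
    All⇒all c []      []       = refl
    All⇒all c (z ∷ p) (h ∷ hs) rewrite Bi⇒bi c z h = All⇒all c p hs

    all-++ : ∀ (q : E × E → Bool) p p' → all q (p ++ p') ≡ all q p ∧ all q p'
    all-++ q []      p' = refl
    all-++ q (z ∷ p) p' with q z
    ... | true  = all-++ q p p'
    ... | false = refl

    Balanced : ℕ → (E → Bool) → List E → Set
    Balanced d c xs = count c xs ≡ d × count (not ∘ c) xs ≡ d

    balanced-flat : ∀ c p → All (Bi c) p → Balanced (length p) c (flat p)
    balanced-flat c []            []       = refl , refl
    balanced-flat c ((x , y) ∷ p) (h ∷ hs) with balanced-flat c p hs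
    ... | e , e' with c x | h
    ... | true  | h' with c y
    ... | false = cong suc e , cong suc e'
    balanced-flat c ((x , y) ∷ p) (h ∷ hs) | e , e' | false | h' with c y
    ... | true  = cong suc e , cong suc e'

    balanced-↭ : ∀ {d c xs ys} → xs ↭ ys → Balanced d c xs → Balanced d c ys
    balanced-↭ e (h , h') = trans (sym (count-↭ _ e)) h , trans (sym (count-↭ _ e)) h'

    private
      -- The induction step of `count-pairings` for a head of either colour `b`. That removing the
      -- head and an opposite element keeps the balance is passed in as `rest`, because the counts
      -- reduce only once both colours are known.
      tails : ∀ d c b (x : E) xs → All (λ { (y , ys) → y ∷ ys ↭ xs }) (picks xs) →
        (∀ ys → Balanced d c ys → count (all (bi c)) (pairings d ys) ≤ d !) →
        c x ≡ b → (∀ {y} ys → c y ≡ not b → Balanced (suc d) c (x ∷ y ∷ ys) → Balanced d c ys) →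
        Balanced (suc d) c (x ∷ xs) →
        count (all (bi c)) (pairings (suc d) (x ∷ xs)) ≤ count (λ y → bi c (x , y)) xs * d !
      tails d c b x xs perms ih cx rest bal =
        ≤-trans (count-concatMap-≤ (all (bi c)) (λ { (y , ys) → bi c (x , y) }) _ (d !)
          (All.map (λ { {y , ys} e → step y ys e }) perms))
          (≤-reflexive (cong (_* d !) (count-picks (λ y → bi c (x , y)) xs)))
        where
        step : ∀ y ys → y ∷ ys ↭ xs →
          count (all (bi c)) (map ((x , y) ∷_) (pairings d ys)) ≤ (if bi c (x , y) then d ! else 0)
        step y ys e rewrite count-map (all (bi c)) ((x , y) ∷_) (pairings d ys) with bi c (x , y) in eq
        ... | true  = ih ys (rest ys (opp (bi⇒Bi c (x , y) eq)) (balanced-↭ {c = c} (prep x (↭-sym e)) bal))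
          where
          opp : c x ≡ not (c y) → c y ≡ not b
          opp h = trans (sym (not-involutive (c y))) (cong not (trans (sym h) cx))
        ... | false = ≤-reflexive (count-none (pairings d ys))

    -- A bichromatic pairing is a bijection between the two colour classes. In the recursion the
    -- head can only be joined to an element of the other colour, and deleting both leaves a
    -- balanced list.
    count-pairings : ∀ d c xs → Balanced d c xs → count (all (bi c)) (pairings d xs) ≤ d !
    count-pairings zero    c xs       _  = s≤s z≤n
    count-pairings (suc d) c []       (() , _)
    count-pairings (suc d) c (x ∷ xs) bal with c x in cx
    ... | true  = ≤-trans (tails d c true x xs (picks-↭ xs) (count-pairings d c) cx rest bal')
                    (*-monoˡ-≤ (d !) (≤-reflexive opp))
      where
      bal' : Balanced (suc d) c (x ∷ xs)
      bal' rewrite cx = bal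
      rest : ∀ {y} ys → c y ≡ false → Balanced (suc d) c (x ∷ y ∷ ys) → Balanced d c ys
      rest {y} ys cy (h , h') rewrite cx | cy = suc-injective h , suc-injective h'
      opp : count (λ y → bi c (x , y)) xs ≡ suc d
      opp = trans (count-cong (λ y → cong (_xor c y) cx) xs) (proj₂ bal)
    ... | false = ≤-trans (tails d c false x xs (picks-↭ xs) (count-pairings d c) cx rest bal')
                    (*-monoˡ-≤ (d !) (≤-reflexive opp))
      where
      bal' : Balanced (suc d) c (x ∷ xs)
      bal' rewrite cx = bal
      rest : ∀ {y} ys → c y ≡ true → Balanced (suc d) c (x ∷ y ∷ ys) → Balanced d c ys
      rest {y} ys cy (h , h') rewrite cx | cy = suc-injective h , suc-injective h'
      opp : count (λ y → bi c (x , y)) xs ≡ suc d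
      opp = trans (count-cong (λ y → cong (_xor c y) cx) xs) (proj₁ bal)

    allPairings : ℕ → List (List E) → List (List (E × E))
    allPairings d []         = [] ∷ []
    allPairings d (st ∷ sts) = cartesianProductWith _++_ (pairings d st) (allPairings d sts)

    flat-++ : ∀ p p' → flat (p ++ p') ≡ flat p ++ flat p'
    flat-++ []            p' = refl
    flat-++ ((x , y) ∷ p) p' = cong (λ l → x ∷ y ∷ l) (flat-++ p p')

    -- The second component is what makes the halves regular: a colouring that is bichromatic on the
    -- pairs at a vertex uses each colour on half of the edges there.
    OfStars : ℕ → List (List E) → List (E × E) → Set
    OfStars d sts p = flat p ↭ concat sts × (∀ c → All (Bi c) p → All (Balanced d c) sts)

    allPairings-stars : ∀ d {sts} → All (λ st → length st ≡ d + d) sts → All (OfStars d sts) (allPairings d sts)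
    allPairings-stars d []                  = (↭-refl , λ _ _ → []) ∷ []
    allPairings-stars d {st ∷ sts} (l ∷ ls) =
      All-cart _++_ (λ {p} {p'} (f , k) (f' , bal) →
          subst (_↭ concat (st ∷ sts)) (sym (flat-++ p p')) (++⁺ f f') ,
          λ c h → subst (λ m → Balanced m c st) k (balanced-↭ {c = c} f (balanced-flat c p (AllP.++⁻ˡ p h)))
                  ∷ bal c (AllP.++⁻ʳ p h))
        (flat-pairings d st l) (allPairings-stars d ls)

    length-allPairings : ∀ d {sts} → All (λ st → length st ≡ d + d) sts →
      length (allPairings d sts) ≡ double-! d ^ length sts
    length-allPairings d []                  = refl
    length-allPairings d {st ∷ sts} (l ∷ ls) =
      trans (length-cart _++_ (pairings d st) (allPairings d sts))
            (cong₂ _*_ (length-pairings d st l) (length-allPairings d ls))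

    count-allPairings : ∀ d c {sts} → All (Balanced d c) sts →
      count (all (bi c)) (allPairings d sts) ≤ (d !) ^ length sts
    count-allPairings d c []                   = ≤-refl
    count-allPairings d c {st ∷ sts} (b ∷ bs) =
      ≤-trans (≤-reflexive (count-cart _++_ (all (bi c)) (all (bi c)) (all (bi c)) (all-++ (bi c)) (pairings d st) _))
              (*-mono-≤ (count-pairings d c st b) (count-allPairings d c bs))

  filterᵇ-∈ : (p : A → Bool) → ∀ {x xs} → x ∈ xs → p x ≡ true → x ∈ filterᵇ p xs
  filterᵇ-∈ p i e = ∈-filter⁺ (T? ∘ p) i (Equivalence.from T-≡ e)

  ∈-filterᵇ : (p : A → Bool) → ∀ {x} xs → x ∈ filterᵇ p xs → x ∈ xs × p x ≡ true
  ∈-filterᵇ p xs i with ∈-filter⁻ (T? ∘ p) {xs = xs} i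
  ... | j , t = j , Equivalence.to T-≡ t

  not-true : ∀ {b} → not b ≡ true → b ≡ false
  not-true {false} _ = refl

  filterᵇ-partition : (p : A → Bool) → ∀ xs → xs ↭ filterᵇ p xs ++ filterᵇ (not ∘ p) xs
  filterᵇ-partition p []       = ↭-refl
  filterᵇ-partition p (x ∷ xs) with p x
  ... | true  = prep x (filterᵇ-partition p xs)
  ... | false = ↭-trans (prep x (filterᵇ-partition p xs)) (↭-sym (shift x (filterᵇ p xs) _))

  filterᵇ-filterᵇ : (p q : A → Bool) → ∀ xs → (∀ x → p x ≡ true → q x ≡ true) →
    filterᵇ p (filterᵇ q xs) ≡ filterᵇ p xs
  filterᵇ-filterᵇ p q []       h = refl
  filterᵇ-filterᵇ p q (x ∷ xs) h with q x in eq
  ... | true with p x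
  ...   | true  = cong (x ∷_) (filterᵇ-filterᵇ p q xs h)
  ...   | false = filterᵇ-filterᵇ p q xs h
  filterᵇ-filterᵇ p q (x ∷ xs) h | false with p x in eq'
  ...   | true  with () ← trans (sym eq) (h x eq')
  ...   | false = filterᵇ-filterᵇ p q xs h

  count-toList : {P : A → Set} (p : A → Bool) → ∀ {xs} (ps : All P xs) → count (p ∘ proj₁) (All.toList ps) ≡ count p xs
  count-toList p []                = refl
  count-toList p {x ∷ xs} (_ ∷ ps) with p x
  ... | true  = cong suc (count-toList p ps)
  ... | false = count-toList p ps

  length-toList : {P : A → Set} → ∀ {xs} (ps : All P xs) → length (All.toList ps) ≡ length xs
  length-toList []       = refl
  length-toList (_ ∷ ps) = cong suc (length-toList ps)

  AllPairs-toList : {P : A → Set} {R : A → A → Set} → ∀ {xs} (ps : All P xs) → AllPairs R xs →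
    AllPairs (λ x y → R (proj₁ x) (proj₁ y)) (All.toList ps)
  AllPairs-toList {P = P} {R} = go
    where
    lift : ∀ {Q : _ → Set} {xs} (ps : All P xs) → All Q xs → All (Q ∘ proj₁) (All.toList ps)
    lift []       []       = []
    lift (_ ∷ ps) (q ∷ qs) = q ∷ lift ps qs
    go : ∀ {xs} (ps : All P xs) → AllPairs R xs → AllPairs (λ x y → R (proj₁ x) (proj₁ y)) (All.toList ps)
    go []       []       = []
    go (_ ∷ ps) (r ∷ rs) = lift ps r ∷ go ps rs

  -- `P x y` certifies that `y` stems from `x`, so that the relation between two sources can be
  -- transferred to their descendants. The certificate is `Respects` for glued colourings and the
  -- value at `zero` for lists of functions.
  AllPairs-concatMap : {R : A → A → Set} {U : B → B → Set} {P : A → B → Set} (f : A → List B) →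
    (∀ {x x' y y'} → R x x' → P x y → P x' y' → U y y') → (∀ x → AllPairs U (f x)) → (∀ x → All (P x) (f x)) →
    ∀ {xs} → AllPairs R xs → AllPairs U (concatMap f xs)
  AllPairs-concatMap f h us ps []                = []
  AllPairs-concatMap f h us ps {x ∷ xs} (r ∷ rs) =
    AllPairsP.++⁺ (us x) (AllPairs-concatMap f h us ps rs)
      (All.map (λ p → AllP.concat⁺ (AllP.map⁺ (All.map (λ {x'} r' → All.map (h r' p) (ps x')) r))) (ps x))

  length-concatMap-≥ : (f : A → List B) (k m : ℕ) → (∀ x → m ≤ length (f x) * k) → ∀ xs →
    length xs * m ≤ length (concatMap f xs) * k
  length-concatMap-≥ f k m h []       = z≤n
  length-concatMap-≥ f k m h (x ∷ xs) = begin
    m + length xs * m                                  ≤⟨ +-mono-≤ (h x) (length-concatMap-≥ f k m h xs) ⟩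
    length (f x) * k + length (concatMap f xs) * k     ≡⟨ sym (*-distribʳ-+ k (length (f x)) _) ⟩
    (length (f x) + length (concatMap f xs)) * k       ≡⟨ cong (_* k) (sym (length-++ (f x))) ⟩
    length (concatMap f (x ∷ xs)) * k                  ∎
    where open ≤-Reasoning

  Unique-++⁻ : ∀ (xs : List A) {ys} → Unique (xs ++ ys) → ∀ {x y} → x ∈ xs → y ∈ ys → x ≢ y
  Unique-++⁻ (x ∷ xs) (u ∷ us) (here refl) j = All.lookup u (∈-++⁺ʳ xs j)
  Unique-++⁻ (x ∷ xs) (u ∷ us) (there i)   j = Unique-++⁻ xs us i j

  *-^ : ∀ k x y → (x * y) ^ k ≡ x ^ k * y ^ k
  *-^ zero    x y = refl
  *-^ (suc k) x y = trans (cong (x * y *_) (*-^ k x y))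
    (solve 4 (λ x y a b → x :* y :* (a :* b) := x :* a :* (y :* b)) refl x y (x ^ k) (y ^ k))
    where open +-*-Solver

  -- With D = d + 1 the left side is (2D)!!, and (2D)!! / (2D - 1)!! is at most 2D. Passing to D + 1
  -- amounts to 2D ≤ 2D + 1. Hence (2D - 1)!! / D! falls short of 2^D by a factor of at most 2D.
  central-bound : ∀ d → 2 ^ suc d * (suc d) ! ≤ (suc d + suc d) * double-! (suc d)
  central-bound zero    = ≤-refl
  central-bound (suc d) = *-cancelʳ-≤ _ _ (suc d) (begin
    2 ^ suc (suc d) * (suc (suc d)) ! * suc d                     ≡⟨ solve 3 (λ d p f → (con 2 :* p) :* ((con 2 :+ d) :* f) :* (con 1 :+ d)
                                                                        := (p :* f) :* ((con 2 :+ d) :* (con 2 :+ con 2 :* d))) refl d (2 ^ suc d) ((suc d) !) ⟩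
    2 ^ suc d * (suc d) ! * (suc (suc d) * (2 + 2 * d))           ≤⟨ *-mono-≤ (central-bound d) (*-monoʳ-≤ (suc (suc d)) (n≤1+n (2 + 2 * d))) ⟩
    (suc d + suc d) * double-! (suc d) * (suc (suc d) * (3 + 2 * d)) ≡⟨ solve 2 (λ d q → ((con 1 :+ d) :+ (con 1 :+ d)) :* q :* ((con 2 :+ d) :* (con 3 :+ con 2 :* d))
                                                                        := ((con 2 :+ d) :+ (con 2 :+ d)) :* ((con 1 :+ ((con 1 :+ d) :+ (con 1 :+ d))) :* q) :* (con 1 :+ d)) refl d (double-! (suc d)) ⟩
    (suc (suc d) + suc (suc d)) * double-! (suc (suc d)) * suc d  ∎)
    where
    open ≤-Reasoning
    open +-*-Solver

  -- Splitting a regular bipartite graph into two halves.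

  module Regular {E : Set} (_≟_ : DecidableEquality E) {n : ℕ} (end : Bool → E → Fin n) where
    open Colouring _≟_
    open Splitting _≟_

    at : Bool → Fin n → E → Bool
    at s v e = ⌊ end s e Fin.≟ v ⌋

    at-true : ∀ {s v e} → at s v e ≡ true → end s e ≡ v
    at-true {s} {v} {e} h = toWitness (Equivalence.from T-≡ h)

    true-at : ∀ {s v e} → end s e ≡ v → at s v e ≡ true
    true-at {s} {v} {e} h = Equivalence.to T-≡ (fromWitness h)

    stars : Bool → List E → List (Fin n) → List (List E)
    stars s es = map (λ v → filterᵇ (at s v) es)

    -- Cutting off the star of `v` does not change the later stars, because an edge has only one end
    -- on side `s`.
    concat-stars : ∀ s vs es → Unique vs → (∀ {e} → e ∈ es → end s e ∈ vs) → concat (stars s es vs) ↭ es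
    concat-stars s []       []       u h = ↭-refl
    concat-stars s []       (e ∷ es) u h with () ← h (here refl)
    concat-stars s (v ∷ vs) es (v∉vs ∷ u) h =
      ↭-trans (++⁺ˡ (filterᵇ (at s v) es) (↭-trans (↭-reflexive (cong concat (same vs v∉vs)))
        (concat-stars s vs others u within)))
        (↭-sym (filterᵇ-partition (at s v) es))
      where
      others : List E
      others = filterᵇ (not ∘ at s v) es
      same : ∀ ws → All (v ≢_) ws → stars s es ws ≡ stars s others ws
      same []       []       = refl
      same (w ∷ ws) (n ∷ ns) = cong₂ _∷_ (sym (filterᵇ-filterᵇ (at s w) (not ∘ at s v) es apart)) (same ws ns)
        where
        apart : ∀ e → at s w e ≡ true → not (at s v e) ≡ true
        apart e h with end s e Fin.≟ v
        ... | no  _  = refl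
        ... | yes e' = ⊥-elim (n (trans (sym e') (at-true {s} h)))
      within : ∀ {e} → e ∈ others → end s e ∈ vs
      within {e} i with ∈-filterᵇ (not ∘ at s v) es i
      ... | j , f with h j
      ... | there k = k
      ... | here  k with () ← trans (sym f) (cong not (true-at {s} k))

    IsRegular : List E → ℕ → Set
    IsRegular es d = ∀ s v → length (filterᵇ (at s v) es) ≡ d

    Agree : {C : Set} → List E → (E → C) → (E → C) → Set
    Agree es c c' = ∀ {e} → e ∈ es → c e ≡ c' e

    Halves : ℕ → List E → (E → Bool) → Set
    Halves d es c = IsRegular (filterᵇ c es) d × IsRegular (filterᵇ (not ∘ c) es) d

    module _ (d : ℕ) (es : List E) (u : Unique es) (reg : IsRegular es (d + d)) where
      private
        star : Bool → List (List E)
        star s = stars s es (allFin n)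
        sizes : ∀ s → All (λ st → length st ≡ d + d) (star s)
        sizes s = AllP.map⁺ (All.universal (reg s) (allFin n))
        concat-star : ∀ s → concat (star s) ↭ es
        concat-star s = concat-stars s (allFin n) es (UniqueP.allFin⁺ n) (λ {e} _ → ∈-allFin (end s e))
        number : ∀ s → length (star s) ≡ n
        number s = trans (length-map _ (allFin n)) (length-tabulate id)
        Good : List (E × E) × List (E × E) → Set
        Good (p , q) = OfStars d (star false) p × OfStars d (star true) q
        raw : List (List (E × E) × List (E × E))
        raw = cartesianProductWith _,_ (allPairings d (star false)) (allPairings d (star true))
        good : All Good raw
        good = All-cart _,_ _,_ (allPairings-stars d (sizes false)) (allPairings-stars d (sizes true))
        colouring : (z : Σ _ Good) → Σ (E → Bool) λ c → All (Bi c) (proj₁ (proj₁ z)) × All (Bi c) (proj₂ (proj₁ z))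
        colouring ((p , q) , (f , _) , (g , _)) =
          euler p q (PermS.Unique-resp-↭ (setoid E) (↭⇒↭ₛ (↭-sym to-es)) u) (↭-trans to-es (↭-sym (↭-trans g (concat-star true))))
          where
          to-es : flat p ↭ es
          to-es = ↭-trans f (concat-star false)
        compatible : (E → Bool) → List (E × E) × List (E × E) → Bool
        compatible c (p , q) = all (bi c) p ∧ all (bi c) q
        -- An asymmetric test: the colouring found for `z` is checked against the pairings of `z'`.
        -- It is decided on finite lists, and its fibres are what `count-allPairings` bounds.
        R : Σ _ Good → Σ _ Good → Bool
        R z z' = compatible (proj₁ (colouring z)) (proj₁ z')
        compatible⁺ : ∀ c {p q} → All (Bi c) p → All (Bi c) q → compatible c (p , q) ≡ true
        compatible⁺ c {p} {q} hp hq rewrite All⇒all c p hp = All⇒all c q hq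
        R-refl : ∀ z → R z z ≡ true
        R-refl z = compatible⁺ _ (proj₁ (proj₂ (colouring z))) (proj₂ (proj₂ (colouring z)))
        balanced : ∀ z s → All (Balanced d (proj₁ (colouring z))) (star s)
        balanced z@(_ , (_ , b) , _) false = b _ (proj₁ (proj₂ (colouring z)))
        balanced z@(_ , _ , (_ , b)) true  = b _ (proj₂ (proj₂ (colouring z)))
        pow : ∀ (x : ℕ) s → x ^ length (star s) ≡ x ^ n
        pow x s = cong (x ^_) (number s)
        fibre : ∀ z → count (R z) (All.toList good) ≤ (d !) ^ n * (d !) ^ n
        fibre z = begin
          count (R z) (All.toList good)                  ≡⟨ count-toList (compatible c) good ⟩
          count (compatible c) raw                       ≡⟨ count-cart _,_ (compatible c) (all (bi c)) (all (bi c)) (λ _ _ → refl) (allPairings d (star false)) _ ⟩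
          count (all (bi c)) (allPairings d (star false)) * count (all (bi c)) (allPairings d (star true))
            ≤⟨ *-mono-≤ (count-allPairings d c (balanced z false)) (count-allPairings d c (balanced z true)) ⟩
          (d !) ^ length (star false) * (d !) ^ length (star true)   ≡⟨ cong₂ _*_ (pow (d !) false) (pow (d !) true) ⟩
          (d !) ^ n * (d !) ^ n                          ∎
          where
          open ≤-Reasoning
          c : E → Bool
          c = proj₁ (colouring z)
        reps : _
        reps = greedy R _ R-refl (All.toList good) (All.universal fibre (All.toList good))
        -- If the two colourings agreed on `es`, the colouring of `z` would be bichromatic on the
        -- pairings of `z'`, contrary to `R z z'` being false.
        apart : ∀ z z' → R z z' ≡ false → ¬ Agree es (proj₁ (colouring z)) (proj₁ (colouring z'))
        apart z z'@((p , q) , (f , _) , (g , _)) r agree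
          with () ← trans (sym r) (compatible⁺ _
            (AllBi-cong p (λ i → agree (∈-resp-↭ (↭-trans f (concat-star false)) i)) (proj₁ (proj₂ (colouring z'))))
            (AllBi-cong q (λ i → agree (∈-resp-↭ (↭-trans g (concat-star true)) i)) (proj₂ (proj₂ (colouring z')))))
        swap-count : ∀ c s v → length (filterᵇ (at s v) (filterᵇ c es)) ≡ count c (filterᵇ (at s v) es)
        swap-count c s v = trans (count-filter (at s v) c es)
          (trans (count-cong (λ e → ∧-comm (c e) (at s v e)) es) (sym (count-filter c (at s v) es)))
        halves : ∀ z → Halves d es (proj₁ (colouring z))
        halves z = (λ s v → trans (swap-count _ s v) (proj₁ (at-v s v))) ,
                   (λ s v → trans (swap-count _ s v) (proj₂ (at-v s v)))
          where
          at-v : ∀ s v → Balanced d (proj₁ (colouring z)) (filterᵇ (at s v) es)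
          at-v s v = All.lookup (AllP.map⁻ (balanced z s)) (∈-allFin v)

      -- The representatives are chosen among pairings, whose number is known exactly. Colourings
      -- enter only through them, and incompatibility of two representatives makes their colourings
      -- different on `es`.
      splittings : Σ (List (Σ (E → Bool) (Halves d es))) λ cs →
        AllPairs (λ c c' → ¬ Agree es (proj₁ c) (proj₁ c')) cs ×
        double-! d ^ n * double-! d ^ n ≤ (d !) ^ n * (d !) ^ n * length cs
      splittings = map (λ z → proj₁ (colouring z) , halves z) (proj₁ reps) ,
        AllPairsP.map⁺ (AllPairs.map (λ {z} {z'} → apart z z') (proj₁ (proj₂ reps))) , (begin
          double-! d ^ n * double-! d ^ n      ≡⟨ sym (cong₂ _*_ (pow (double-! d) false) (pow (double-! d) true)) ⟩
          double-! d ^ length (star false) * double-! d ^ length (star true)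
            ≡⟨ sym (cong₂ _*_ (length-allPairings d (sizes false)) (length-allPairings d (sizes true))) ⟩
          length (allPairings d (star false)) * length (allPairings d (star true))
            ≡⟨ sym (trans (length-toList good) (length-cart _,_ (allPairings d (star false)) _)) ⟩
          length (All.toList good)             ≤⟨ proj₂ (proj₂ reps) ⟩
          (d !) ^ n * (d !) ^ n * length (proj₁ reps)   ≡⟨ cong ((d !) ^ n * (d !) ^ n *_) (sym (length-map _ (proj₁ reps))) ⟩
          (d !) ^ n * (d !) ^ n * length (map (λ z → proj₁ (colouring z) , halves z) (proj₁ reps)) ∎)
        where open ≤-Reasoning

    -- Factorisations into perfect matchings and their gluing.

    module _ {C : Set} where

      -- Each colour class is a perfect matching within `es`. The map lives on all of `E`, so two
      -- factorisations are compared by `Agree`, that is on `es` alone.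
      record IsFactorisation (es : List E) (cs : List C) (κ : E → C) : Set where
        field
          colour : ∀ {e} → e ∈ es → κ e ∈ cs
          exists : ∀ s v {c} → c ∈ cs → Σ E λ e → e ∈ es × end s e ≡ v × κ e ≡ c
          unique : ∀ s {e e'} → e ∈ es → e' ∈ es → end s e ≡ end s e' → κ e ≡ κ e' → e ≡ e'
      open IsFactorisation

      Factorisations : List E → List C → Set
      Factorisations es cs = Σ (List (E → C)) λ κs →
        All (IsFactorisation es cs) κs × AllPairs (λ κ κ' → ¬ Agree es κ κ') κs

      -- Phrased by membership, so that the same gluing serves the two halves of a splitting and a
      -- block of shifts cut off from the remaining ones.
      record Partition (c : E → Bool) (es es₀ es₁ : List E) : Set where
        field
          left  : ∀ {e} → e ∈ es₀ → e ∈ es × c e ≡ true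
          right : ∀ {e} → e ∈ es₁ → e ∈ es × c e ≡ false
          cover : ∀ {e} → e ∈ es → (c e ≡ true → e ∈ es₀) × (c e ≡ false → e ∈ es₁)

      glue : (E → Bool) → (E → C) → (E → C) → E → C
      glue c κ₀ κ₁ e = if c e then κ₀ e else κ₁ e

      glue-true : ∀ {c κ₀ κ₁ e} → c e ≡ true → glue c κ₀ κ₁ e ≡ κ₀ e
      glue-true h rewrite h = refl

      glue-false : ∀ {c κ₀ κ₁ e} → c e ≡ false → glue c κ₀ κ₁ e ≡ κ₁ e
      glue-false h rewrite h = refl

      Respects : List E → (E → Bool) → List C → List C → (E → C) → Set
      Respects es c cs₀ cs₁ κ = ∀ {e} → e ∈ es → (c e ≡ true → κ e ∈ cs₀) × (c e ≡ false → κ e ∈ cs₁)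

      module _ {c : E → Bool} {es es₀ es₁ : List E} {cs₀ cs₁ : List C} (part : Partition c es es₀ es₁)
               (disjoint : ∀ {x y : C} → x ∈ cs₀ → y ∈ cs₁ → x ≢ y) where
        open Partition part

        glue-respects : ∀ {κ₀ κ₁} → IsFactorisation es₀ cs₀ κ₀ → IsFactorisation es₁ cs₁ κ₁ →
          Respects es c cs₀ cs₁ (glue c κ₀ κ₁)
        glue-respects {κ₀} {κ₁} f₀ f₁ i =
          (λ h → subst (_∈ cs₀) (sym (glue-true {c} {κ₀} {κ₁} h)) (colour f₀ (proj₁ (cover i) h))) ,
          (λ h → subst (_∈ cs₁) (sym (glue-false {c} {κ₀} {κ₁} h)) (colour f₁ (proj₂ (cover i) h)))

        glue-factorisation : ∀ {κ₀ κ₁} → IsFactorisation es₀ cs₀ κ₀ → IsFactorisation es₁ cs₁ κ₁ →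
          IsFactorisation es (cs₀ ++ cs₁) (glue c κ₀ κ₁)
        colour (glue-factorisation f₀ f₁) {e} i with c e in eq
        ... | true  = ∈-++⁺ˡ (colour f₀ (proj₁ (cover i) eq))
        ... | false = ∈-++⁺ʳ cs₀ (colour f₁ (proj₂ (cover i) eq))
        exists (glue-factorisation {κ₀} {κ₁} f₀ f₁) s v i with ∈-++⁻ cs₀ i
        ... | inj₁ j with exists f₀ s v j
        ... | e , k , h , h' = e , proj₁ (left k) , h , trans (glue-true {c} {κ₀} {κ₁} (proj₂ (left k))) h'
        exists (glue-factorisation {κ₀} {κ₁} f₀ f₁) s v i | inj₂ j with exists f₁ s v j
        ... | e , k , h , h' = e , proj₁ (right k) , h , trans (glue-false {c} {κ₀} {κ₁} (proj₂ (right k))) h'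
        unique (glue-factorisation f₀ f₁) s {e} {e'} i i' h h' with c e in eq | c e' in eq'
        ... | true  | true  = unique f₀ s (proj₁ (cover i) eq) (proj₁ (cover i') eq') h h'
        ... | false | false = unique f₁ s (proj₂ (cover i) eq) (proj₂ (cover i') eq') h h'
        ... | true  | false = ⊥-elim (disjoint (colour f₀ (proj₁ (cover i) eq)) (colour f₁ (proj₂ (cover i') eq')) h')
        ... | false | true  = ⊥-elim (disjoint (colour f₀ (proj₁ (cover i') eq')) (colour f₁ (proj₂ (cover i) eq)) (sym h'))

        glue-all : ((κs₀ , _) : Factorisations es₀ cs₀) ((κs₁ , _) : Factorisations es₁ cs₁) →
          Σ (Factorisations es (cs₀ ++ cs₁)) λ K →
            All (Respects es c cs₀ cs₁) (proj₁ K) × length (proj₁ K) ≡ length κs₀ * length κs₁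
        glue-all (κs₀ , f₀ , a₀) (κs₁ , f₁ , a₁) =
          (cartesianProductWith (glue c) κs₀ κs₁ , All-cart (glue c) glue-factorisation f₀ f₁ ,
           AllPairs-cart (glue c)
             (λ {κ} {κ'} {λ₁} {λ₁'} n a → n (λ i → trans (sym (glue-true {c} {κ} {λ₁} (proj₂ (left i))))
                (trans (a (proj₁ (left i))) (glue-true {c} {κ'} {λ₁'} (proj₂ (left i))))))
             (λ {κ} {λ₁} {λ₁'} n a → n (λ i → trans (sym (glue-false {c} {κ} {λ₁} (proj₂ (right i))))
                (trans (a (proj₁ (right i))) (glue-false {c} {κ} {λ₁'} (proj₂ (right i))))))
             a₀ a₁) ,
          All-cart (glue c) glue-respects f₀ f₁ , length-cart (glue c) κs₀ κs₁

      filterᵇ-Partition : ∀ c es → Partition c es (filterᵇ c es) (filterᵇ (not ∘ c) es)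
      filterᵇ-Partition c es = record
        { left  = ∈-filterᵇ c es
        ; right = λ i → proj₁ (∈-filterᵇ (not ∘ c) es i) , not-true (proj₂ (∈-filterᵇ (not ∘ c) es i))
        ; cover = λ i → filterᵇ-∈ c i , λ h → filterᵇ-∈ (not ∘ c) i (cong not h)
        }

      -- The colour sets are disjoint, so the colour of an edge reveals its half. A glued
      -- factorisation thus remembers its splitting, and different splittings never yield the same
      -- factorisation.
      respects-agree : ∀ {es cs₀ cs₁ c c' κ κ'} → (∀ {x y} → x ∈ cs₀ → y ∈ cs₁ → x ≢ y) →
        Respects es c cs₀ cs₁ κ → Respects es c' cs₀ cs₁ κ' → Agree es κ κ' → Agree es c c'
      respects-agree {c = c} {c'} d r r' a {e} i with c e in eq | c' e in eq'
      ... | true  | true  = refl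
      ... | false | false = refl
      ... | true  | false = ⊥-elim (d (proj₁ (r i) eq) (proj₂ (r' i) eq') (a i))
      ... | false | true  = ⊥-elim (d (proj₁ (r' i) eq') (proj₂ (r i) eq) (sym (a i)))

    -- For d = 2^a the factor 2d of `central-bound` is 2^(a+1). There are n vertices on either side,
    -- so it enters 2n times, and the number of splittings is at least 2^(2n(d - a - 1)).
    splitting-bound : ∀ a S → let d = 2 ^ a in
      double-! d ^ n * double-! d ^ n ≤ (d !) ^ n * (d !) ^ n * S →
      2 ^ (n * (d + d)) ≤ 2 ^ (n * (suc a + suc a)) * S
    splitting-bound a S h = *-cancelʳ-≤ _ _ ((d !) ^ n * (d !) ^ n) (begin
      2 ^ (n * (d + d)) * ((d !) ^ n * (d !) ^ n)          ≡⟨ cong (_* ((d !) ^ n * (d !) ^ n)) (twice d) ⟩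
      (2 ^ d) ^ n * (2 ^ d) ^ n * ((d !) ^ n * (d !) ^ n)  ≡⟨ regroup ((2 ^ d) ^ n) ((d !) ^ n) ⟩
      (2 ^ d) ^ n * (d !) ^ n * ((2 ^ d) ^ n * (d !) ^ n)  ≡⟨ square (2 ^ d) (d !) ⟩
      (2 ^ d * d !) ^ n * (2 ^ d * d !) ^ n                ≤⟨ *-mono-≤ (^-monoˡ-≤ n central) (^-monoˡ-≤ n central) ⟩
      (2 ^ suc a * double-! d) ^ n * (2 ^ suc a * double-! d) ^ n   ≡⟨ sym (square (2 ^ suc a) (double-! d)) ⟩
      (2 ^ suc a) ^ n * double-! d ^ n * ((2 ^ suc a) ^ n * double-! d ^ n)   ≡⟨ sym (regroup ((2 ^ suc a) ^ n) (double-! d ^ n)) ⟩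
      (2 ^ suc a) ^ n * (2 ^ suc a) ^ n * (double-! d ^ n * double-! d ^ n)   ≡⟨ cong (_* (double-! d ^ n * double-! d ^ n)) (sym (twice (suc a))) ⟩
      2 ^ (n * (suc a + suc a)) * (double-! d ^ n * double-! d ^ n)   ≤⟨ *-monoʳ-≤ (2 ^ (n * (suc a + suc a))) h ⟩
      2 ^ (n * (suc a + suc a)) * ((d !) ^ n * (d !) ^ n * S)   ≡⟨ solve 3 (λ x y z → x :* (y :* z) := x :* z :* y) refl (2 ^ (n * (suc a + suc a))) ((d !) ^ n * (d !) ^ n) S ⟩
      2 ^ (n * (suc a + suc a)) * S * ((d !) ^ n * (d !) ^ n) ∎)
      where
      open ≤-Reasoning
      open +-*-Solver
      d : ℕ
      d = 2 ^ a
      instance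
        _ : NonZero ((d !) ^ n * (d !) ^ n)
        _ = >-nonZero (*-mono-≤ (m^n>0 (d !) {{>-nonZero (n!>0 d)}} n) (m^n>0 (d !) {{>-nonZero (n!>0 d)}} n))
          where
          n!>0 : ∀ k → 0 < k !
          n!>0 zero    = s≤s z≤n
          n!>0 (suc k) = *-mono-≤ {1} {suc k} (s≤s z≤n) (n!>0 k)
      twice : ∀ k → 2 ^ (n * (k + k)) ≡ (2 ^ k) ^ n * (2 ^ k) ^ n
      twice k = trans (cong (2 ^_) (*-distribˡ-+ n k k)) (trans (^-distribˡ-+-* 2 (n * k) (n * k))
        (cong (λ z → z * z) (trans (cong (2 ^_) (*-comm n k)) (sym (^-*-assoc 2 k n)))))
      regroup : ∀ x y → x * x * (y * y) ≡ x * y * (x * y)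
      regroup = solve 2 (λ x y → x :* x :* (y :* y) := x :* y :* (x :* y)) refl
      square : ∀ x y → x ^ n * y ^ n * (x ^ n * y ^ n) ≡ (x * y) ^ n * (x * y) ^ n
      square x y = sym (cong (λ z → z * z) (*-^ n x y))
      central : 2 ^ d * d ! ≤ 2 ^ suc a * double-! d
      central with d | m^n>0 2 a
      ... | suc d' | _ = subst (λ z → 2 ^ suc d' * (suc d') ! ≤ z * double-! (suc d'))
                           (cong (suc d' +_) (sym (+-identityʳ (suc d')))) (central-bound d')

  -- Factorising graphs whose degree is a power of two.

  excess : ℕ → ℕ
  excess zero    = 0
  excess (suc a) = (suc a + suc a) + (excess a + excess a)

  module PowerOfTwo {E : Set} (_≟_ : DecidableEquality E) {n : ℕ} (end : Bool → E → Fin n) {C : Set} where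
    open Regular _≟_ end

    private
      singleton : ∀ {A : Set} {xs : List A} → length xs ≡ 1 → Σ A λ x → xs ≡ x ∷ []
      singleton {xs = x ∷ []} refl = x , refl

      bound : ℕ → ℕ → Set
      bound a l = 2 ^ (n * (a * 2 ^ a)) ≤ l * 2 ^ (n * excess a)

      monochromatic : ∀ {es} {c : C} → IsRegular es 1 → IsFactorisation es (c ∷ []) (λ _ → c)
      monochromatic {es} {c} reg = record
        { colour = λ _ → here refl
        ; exists = λ { s v (here refl) → ex s v }
        ; unique = un
        }
        where
        ex : ∀ s v → Σ E λ e → e ∈ es × end s e ≡ v × c ≡ c
        ex s v with singleton (reg s v)
        ... | e , eq with ∈-filterᵇ (at s v) es (subst (e ∈_) (sym eq) (here refl))
        ... | i , h = e , i , at-true {s} h , refl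
        un : ∀ s {e e'} → e ∈ es → e' ∈ es → end s e ≡ end s e' → c ≡ c → e ≡ e'
        un s {e} {e'} i i' h _ with singleton (reg s (end s e))
        ... | x , eq with subst (e ∈_) eq (filterᵇ-∈ (at s (end s e)) i (true-at {s} refl))
                        | subst (e' ∈_) eq (filterᵇ-∈ (at s (end s e)) i' (true-at {s} (sym h)))
        ... | here refl | here refl = refl

      -- The main exponents add up since n (a+1) 2^(a+1) = 2n 2^a + 2 (n a 2^a). The losses add up
      -- by the recurrence of `excess`: 2(a+1) for the splitting itself and `excess a` for each
      -- half, all times n.
      combine-bounds : ∀ a S t → 2 ^ (n * (2 ^ a + 2 ^ a)) ≤ 2 ^ (n * (suc a + suc a)) * S →
        S * (2 ^ (n * (a * 2 ^ a)) * 2 ^ (n * (a * 2 ^ a))) ≤ t * (2 ^ (n * excess a) * 2 ^ (n * excess a)) →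
        bound (suc a) t
      combine-bounds a S t h k = begin
        2 ^ (n * (suc a * (2 * 2 ^ a)))   ≡⟨ cong (2 ^_) (solve 3 (λ n a d → n :* ((con 1 :+ a) :* (con 2 :* d)) := n :* (d :+ d) :+ (n :* (a :* d) :+ n :* (a :* d))) refl n a (2 ^ a)) ⟩
        2 ^ (n * (2 ^ a + 2 ^ a) + (n * (a * 2 ^ a) + n * (a * 2 ^ a)))   ≡⟨ split (n * (2 ^ a + 2 ^ a)) (n * (a * 2 ^ a)) ⟩
        2 ^ (n * (2 ^ a + 2 ^ a)) * (X * X)   ≤⟨ *-monoˡ-≤ (X * X) h ⟩
        P * S * (X * X)                       ≡⟨ *-assoc P S (X * X) ⟩
        P * (S * (X * X))                     ≤⟨ *-monoʳ-≤ P k ⟩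
        P * (t * (Y * Y))                     ≡⟨ solve 3 (λ p t y → p :* (t :* y) := t :* (p :* y)) refl P t (Y * Y) ⟩
        t * (P * (Y * Y))                     ≡⟨ cong (t *_) (sym (split (n * (suc a + suc a)) (n * excess a))) ⟩
        t * 2 ^ (n * (suc a + suc a) + (n * excess a + n * excess a))   ≡⟨ cong (λ z → t * 2 ^ z) (solve 3 (λ n p q → n :* p :+ (n :* q :+ n :* q) := n :* (p :+ (q :+ q))) refl n (suc a + suc a) (excess a)) ⟩
        t * 2 ^ (n * excess (suc a))          ∎
        where
        open ≤-Reasoning
        open +-*-Solver
        X Y P : ℕ
        X = 2 ^ (n * (a * 2 ^ a))
        Y = 2 ^ (n * excess a)
        P = 2 ^ (n * (suc a + suc a))
        split : ∀ x y → 2 ^ (x + (y + y)) ≡ 2 ^ x * (2 ^ y * 2 ^ y)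
        split x y = trans (^-distribˡ-+-* 2 x (y + y)) (cong (2 ^ x *_) (^-distribˡ-+-* 2 y y))

    -- Each half of a splitting is factorised with its own half of the colour list. All choices of
    -- splitting, left factorisation and right factorisation give different results, so the counts
    -- multiply down to degree 1, where the graph is a single perfect matching.
    factorise : ∀ a es cs → Unique es → Unique cs → IsRegular es (2 ^ a) → length cs ≡ 2 ^ a →
      Σ (Factorisations es cs) λ K → bound a (length (proj₁ K))
    factorise zero es (c ∷ []) u u' reg refl =
      ((λ _ → c) ∷ [] , monochromatic reg ∷ [] , [] ∷ []) ,
      ≤-reflexive (trans (cong (2 ^_) (*-zeroʳ n)) (sym (trans (*-identityˡ _) (cong (2 ^_) (*-zeroʳ n)))))
    factorise (suc a) es cs u u' reg len =
      subst (λ cs → Σ (Factorisations es cs) λ K → bound (suc a) (length (proj₁ K))) (take++drop≡id d cs)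
        (assemble (splittings d es u (λ s v → trans (reg s v) (cong (d +_) (+-identityʳ d)))))
      where
      d : ℕ
      d = 2 ^ a
      cs₀ cs₁ : List C
      cs₀ = take d cs
      cs₁ = drop d cs
      len' : length cs ≡ d + d
      len' = trans len (cong (d +_) (+-identityʳ d))
      len₀ : length cs₀ ≡ d
      len₀ = trans (length-take d cs) (trans (cong (λ l → d ⊓ l) len') (m≤n⇒m⊓n≡m (m≤m+n d d)))
      len₁ : length cs₁ ≡ d
      len₁ = trans (length-drop d cs) (trans (cong (_∸ d) len') (m+n∸m≡n d d))
      apart : ∀ {x y} → x ∈ cs₀ → y ∈ cs₁ → x ≢ y
      apart = Unique-++⁻ cs₀ (subst Unique (sym (take++drop≡id d cs)) u')
      part₀ : ((c , _) : Σ (E → Bool) (Halves d es)) → Σ (Factorisations (filterᵇ c es) cs₀) λ K → bound a (length (proj₁ K))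
      part₀ (c , h , _) = factorise a (filterᵇ c es) cs₀ (UniqueP.filter⁺ (T? ∘ c) u) (UniqueP.take⁺ d u') h len₀
      part₁ : ((c , _) : Σ (E → Bool) (Halves d es)) → Σ (Factorisations (filterᵇ (not ∘ c) es) cs₁) λ K → bound a (length (proj₁ K))
      part₁ (c , _ , h) = factorise a (filterᵇ (not ∘ c) es) cs₁ (UniqueP.filter⁺ (T? ∘ (not ∘ c)) u) (UniqueP.drop⁺ d u') h len₁
      glued : ∀ z → _
      glued z = glue-all (filterᵇ-Partition {C} (proj₁ z) es) apart (proj₁ (part₀ z)) (proj₁ (part₁ z))
      colourings : Σ (E → Bool) (Halves d es) → List (E → C)
      colourings z = proj₁ (proj₁ (glued z))
      block-bound : ∀ z → 2 ^ (n * (a * d)) * 2 ^ (n * (a * d)) ≤ length (colourings z) * (2 ^ (n * excess a) * 2 ^ (n * excess a))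
      block-bound z = begin
        X * X                               ≤⟨ *-mono-≤ (proj₂ (part₀ z)) (proj₂ (part₁ z)) ⟩
        l₀ * Y * (l₁ * Y)                   ≡⟨ solve 3 (λ p q y → p :* y :* (q :* y) := p :* q :* (y :* y)) refl l₀ l₁ Y ⟩
        l₀ * l₁ * (Y * Y)                   ≡⟨ cong (_* (Y * Y)) (sym (proj₂ (proj₂ (glued z)))) ⟩
        length (colourings z) * (Y * Y)     ∎
        where
        open ≤-Reasoning
        open +-*-Solver
        X Y l₀ l₁ : ℕ
        X  = 2 ^ (n * (a * d))
        Y  = 2 ^ (n * excess a)
        l₀ = length (proj₁ (proj₁ (part₀ z)))
        l₁ = length (proj₁ (proj₁ (part₁ z)))
      assemble : (Σ (List (Σ (E → Bool) (Halves d es))) λ zs → AllPairs (λ z z' → ¬ Agree es (proj₁ z) (proj₁ z')) zs ×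
          double-! d ^ n * double-! d ^ n ≤ (d !) ^ n * (d !) ^ n * length zs) →
        Σ (Factorisations es (cs₀ ++ cs₁)) λ K → bound (suc a) (length (proj₁ K))
      assemble (zs , distinct , many) =
        (concatMap colourings zs , AllP.concat⁺ (AllP.map⁺ (All.universal (λ z → proj₁ (proj₂ (proj₁ (glued z)))) zs)) ,
         AllPairs-concatMap colourings (λ n r r' agree → n (respects-agree apart r r' agree))
           (λ z → proj₂ (proj₂ (proj₁ (glued z)))) (λ z → proj₁ (proj₂ (glued z))) distinct) ,
        combine-bounds a (length zs) (length (concatMap colourings zs)) (splitting-bound a (length zs) many)
          (length-concatMap-≥ colourings (2 ^ (n * excess a) * 2 ^ (n * excess a)) _ block-bound zs)

  does-true : {P : Set} (d : Dec P) → does d ≡ true → P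
  does-true (yes p) _ = p

  count-unique : ∀ {A : Set} (p : A → Bool) {x xs} → Unique xs → x ∈ xs → p x ≡ true → (∀ y → p y ≡ true → y ≡ x) →
    count p xs ≡ 1
  count-unique p {x} {y ∷ xs} (n ∷ u) i px only with p y in eq
  ... | true  = cong suc (trans (cong length (zero-count xs n)) refl)
    where
    zero-count : ∀ zs → All (y ≢_) zs → filterᵇ p zs ≡ []
    zero-count []       []       = refl
    zero-count (z ∷ zs) (m ∷ ms) with p z in eq'
    ... | false = zero-count zs ms
    ... | true  = ⊥-elim (m (trans (only y eq) (sym (only z eq'))))
  ... | false with i
  ...   | here refl with () ← trans (sym eq) px
  ...   | there j = count-unique p u j px only

  -- Blocks of shifts in a circulant graph.

  module Blocks {n h : ℕ} (right : Fin h → Fin n → Fin n) (back : Fin h → Fin n → Fin n)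
    (back-right : ∀ m i → back m (right m i) ≡ i) (right-back : ∀ m v → right m (back m v) ≡ v) where

    Edge : Set
    Edge = Fin n × Fin h

    _≟ᴱ_ : DecidableEquality Edge
    _≟ᴱ_ = ≡-dec Fin._≟_ Fin._≟_

    end : Bool → Edge → Fin n
    end false (i , m) = i
    end true  (i , m) = right m i

    open Regular _≟ᴱ_ end public

    edges : List (Fin h) → List Edge
    edges ms = cartesianProductWith (λ m i → i , m) ms (allFin n)

    edges-unique : ∀ {ms} → Unique ms → Unique (edges ms)
    edges-unique u = UniqueP.cartesianProductWith⁺ _ (λ { refl → refl , refl }) u (UniqueP.allFin⁺ n)

    ∈-edges : ∀ {i m ms} → m ∈ ms → (i , m) ∈ edges ms
    ∈-edges {i} j = ∈-cartesianProductWith⁺ (λ m i → i , m) j (∈-allFin i)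

    edges-∈ : ∀ {i m} ms → (i , m) ∈ edges ms → m ∈ ms
    edges-∈ ms j with ∈-cartesianProductWith⁻ (λ m i → i , m) ms (allFin n) j
    ... | _ , _ , k , _ , refl = k

    -- Every shift `m` is a bijection and contributes one edge at `v`: `(v , m)` on the left and
    -- `(back m v , m)` on the right.
    edges-regular : ∀ ms → IsRegular (edges ms) (length ms)
    edges-regular []       s v = refl
    edges-regular (m ∷ ms) s v =
      trans (count-++ (at s v) (map (_, m) (allFin n)) (edges ms))
        (cong₂ _+_ (trans (count-map (at s v) (_, m) (allFin n)) (one s)) (edges-regular ms s v))
      where
      one : ∀ s → count (λ i → at s v (i , m)) (allFin n) ≡ 1
      one false = count-unique _ (UniqueP.allFin⁺ n) (∈-allFin v) (true-at {false} {e = v , m} refl) (λ i h → at-true {false} {e = i , m} h)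
      one true  = count-unique _ (UniqueP.allFin⁺ n) (∈-allFin (back m v)) (true-at {true} (right-back m v))
                    (λ i h → trans (sym (back-right m i)) (cong (back m) (at-true {true} {e = i , m} h)))

    module _ {C : Set} (c₀ : C) where
      open PowerOfTwo _≟ᴱ_ end {C}
      open DecMembership (Fin._≟_ {h}) using (_∈?_)

      private
        bound : ℕ → ℕ → ℕ → Set
        bound a b l = 2 ^ (n * (a * 2 ^ a) * b) ≤ l * 2 ^ (n * excess a * b)

        nothing : IsFactorisation [] [] (λ _ → c₀)
        nothing = record { colour = λ () ; exists = λ _ _ () ; unique = λ _ () }

        -- The first 2^a shifts form a regular graph of that degree and use up the first 2^a
        -- colours. Every factorisation of the other shifts combines with every one of this block.
        attach : ∀ a b ms cs → Unique ms → Unique cs → 2 ^ a ≤ length ms → length cs ≡ length ms →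
          (Σ (Factorisations (edges (drop (2 ^ a) ms)) (drop (2 ^ a) cs)) λ K → bound a b (length (proj₁ K))) →
          Σ (Factorisations (edges ms) cs) λ K → bound a (suc b) (length (proj₁ K))
        attach a b ms cs u u' w≤ same (K₁ , h₁) =
          subst (λ cs → Σ (Factorisations (edges ms) cs) λ K → bound a (suc b) (length (proj₁ K))) (take++drop≡id w cs)
            (proj₁ glued , total)
          where
          w : ℕ
          w = 2 ^ a
          take-length : ∀ {A : Set} (xs : List A) → w ≤ length xs → length (take w xs) ≡ w
          take-length xs l = trans (length-take w xs) (m≤n⇒m⊓n≡m l)
          head-part = factorise a (edges (take w ms)) (take w cs) (edges-unique (UniqueP.take⁺ w u)) (UniqueP.take⁺ w u')
            (λ s v → trans (edges-regular (take w ms) s v) (take-length ms w≤))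
            (take-length cs (≤-trans w≤ (≤-reflexive (sym same))))
          in-head : Edge → Bool
          in-head (_ , m) = does (m ∈? take w ms)
          apart : ∀ {x y} → x ∈ take w ms → y ∈ drop w ms → x ≢ y
          apart = Unique-++⁻ (take w ms) (subst Unique (sym (take++drop≡id w ms)) u)
          whole : ∀ {m} → m ∈ take w ms ++ drop w ms → m ∈ ms
          whole {m} = subst (m ∈_) (take++drop≡id w ms)
          part : Partition {C} in-head (edges ms) (edges (take w ms)) (edges (drop w ms))
          part = record
            { left  = λ {e} i → let j = edges-∈ (take w ms) i in
                        ∈-edges (whole (∈-++⁺ˡ j)) , dec-true (proj₂ e ∈? take w ms) j
            ; right = λ {e} i → let j = edges-∈ (drop w ms) i in
                        ∈-edges (whole (∈-++⁺ʳ (take w ms) j)) ,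
                        dec-false (proj₂ e ∈? take w ms) (λ k → apart k j refl)
            ; cover = λ {e} i → (λ t → ∈-edges (does-true (proj₂ e ∈? take w ms) t)) ,
                        (λ f → ∈-edges (in-drop (edges-∈ ms i) f))
            }
            where
            in-drop : ∀ {m} → m ∈ ms → does (m ∈? take w ms) ≡ false → m ∈ drop w ms
            in-drop {m} i f with ∈-++⁻ (take w ms) (subst (m ∈_) (sym (take++drop≡id w ms)) i)
            ... | inj₂ k = k
            ... | inj₁ k with () ← trans (sym f) (dec-true (m ∈? take w ms) k)
          glued = glue-all part (Unique-++⁻ (take w cs) (subst Unique (sym (take++drop≡id w cs)) u')) (proj₁ head-part) K₁
          total : bound a (suc b) (length (proj₁ (proj₁ glued)))
          total = begin
            2 ^ (x * suc b)                    ≡⟨ cong (2 ^_) (*-suc x b) ⟩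
            2 ^ (x + x * b)                    ≡⟨ ^-distribˡ-+-* 2 x (x * b) ⟩
            2 ^ x * 2 ^ (x * b)                ≤⟨ *-mono-≤ (proj₂ head-part) h₁ ⟩
            l₀ * 2 ^ y * (l₁ * 2 ^ (y * b))    ≡⟨ solve 4 (λ p q r s → p :* q :* (r :* s) := p :* r :* (q :* s)) refl l₀ (2 ^ y) l₁ (2 ^ (y * b)) ⟩
            l₀ * l₁ * (2 ^ y * 2 ^ (y * b))    ≡⟨ cong₂ _*_ (sym (proj₂ (proj₂ glued))) (sym (trans (cong (2 ^_) (*-suc y b)) (^-distribˡ-+-* 2 y (y * b)))) ⟩
            length (proj₁ (proj₁ glued)) * 2 ^ (y * suc b) ∎
            where
            open ≤-Reasoning
            open +-*-Solver
            x y l₀ l₁ : ℕ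
            x = n * (a * w)
            y = n * excess a
            l₀ = length (proj₁ (proj₁ head-part))
            l₁ = length (proj₁ K₁)

      -- Only the `b` full blocks contribute to the bound. Each of the `r` remaining shifts is a
      -- perfect matching and simply gets a colour of its own.
      blocks : ∀ a b r ms cs → Unique ms → Unique cs → length ms ≡ b * 2 ^ a + r → length cs ≡ length ms →
        Σ (Factorisations (edges ms) cs) λ K → bound a b (length (proj₁ K))
      blocks a (suc b) r ms cs u u' len same =
        attach a b ms cs u u' (≤-trans (≤-trans (m≤m+n _ _) (m≤m+n _ r)) (≤-reflexive (sym len))) same
          (blocks a b r _ _ (UniqueP.drop⁺ (2 ^ a) u) (UniqueP.drop⁺ (2 ^ a) u')
            (trans (length-drop (2 ^ a) ms) (trans (cong (_∸ 2 ^ a) (trans len (+-assoc (2 ^ a) _ r))) (m+n∸m≡n (2 ^ a) _)))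
            (trans (length-drop (2 ^ a) cs) (trans (cong (_∸ 2 ^ a) same) (sym (length-drop (2 ^ a) ms)))))
      blocks a zero zero [] [] u u' len same =
        -- A colouring is a total map even on the empty graph; `c₀` is its default value.
        ((λ _ → c₀) ∷ [] , nothing ∷ [] , [] ∷ []) ,
        ≤-reflexive (trans (cong (2 ^_) (*-zeroʳ (n * (a * 2 ^ a)))) (sym (trans (*-identityˡ _) (cong (2 ^_) (*-zeroʳ (n * excess a))))))
      blocks a zero (suc r) (m ∷ ms) (c ∷ cs) u u' len same =
        -- A single leftover shift is a block of size 2^0. Its bound has exponent 0 and only says
        -- that a factorisation exists.
        weaken (attach 0 0 (m ∷ ms) (c ∷ cs) u u' (s≤s z≤n) same
          (blocks 0 0 r ms cs (UniqueP.drop⁺ 1 u) (UniqueP.drop⁺ 1 u') (suc-injective len) (suc-injective same)))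
        where
        weaken : (Σ (Factorisations (edges (m ∷ ms)) (c ∷ cs)) λ K → bound 0 1 (length (proj₁ K))) →
          Σ (Factorisations (edges (m ∷ ms)) (c ∷ cs)) λ K → bound a 0 (length (proj₁ K))
        weaken (K , h) = K , (begin
          2 ^ (n * (a * 2 ^ a) * 0)          ≡⟨ cong (2 ^_) (*-zeroʳ (n * (a * 2 ^ a))) ⟩
          1                                  ≡⟨ cong (2 ^_) (sym (cong (_* 1) (*-zeroʳ n))) ⟩
          2 ^ (n * 0 * 1)                    ≤⟨ h ⟩
          length (proj₁ K) * 2 ^ (n * 0 * 1) ≡⟨ cong (λ z → length (proj₁ K) * 2 ^ z) (trans (cong (_* 1) (*-zeroʳ n)) (sym (*-zeroʳ (n * excess a)))) ⟩
          length (proj₁ K) * 2 ^ (n * excess a * 0) ∎)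
          where open ≤-Reasoning

-- Arithmetic modulo n and indices in pairs.

module Vertices where
  open Counting
  open import Data.Nat.DivMod using (_%_; _mod_; m%n<n; %-distribˡ-+; m%n%n≡m%n; m<n⇒m%n≡m; [m+n]%n≡m%n)
  open import Data.Fin using (_≟_)
  open import Data.Fin.Induction using (<-weakInduction)
  open import Data.Fin.Permutation.Components using (transpose; transpose-inverse)
  open import Data.Fin.Properties using (all?; toℕ-fromℕ<; toℕ-injective; toℕ<n; toℕ≤n; toℕ-inject₁; toℕ-↑ˡ; toℕ-combine; splitAt-↑ˡ; splitAt-↑ʳ; splitAt⁻¹-↑ˡ; splitAt⁻¹-↑ʳ; remQuot-combine; combine-remQuot)
  open import Data.Rational using (ℚ; 0ℚ; 1ℚ; ½; _+_; _*_; _-_; -_; _≤_; _<_; positive; nonNegative)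
  open import Data.Rational.Properties hiding (_≟_)
  open import Algebra.Properties.Group +-0-group using (∙-cancelˡ; ∙-cancelʳ)

  module Modular (n : ℕ) .{{_ : NonZero n}} where

    infixl 6 _⊕_ _⊖_

    _⊕_ _⊖_ : Fin n → Fin n → Fin n
    i ⊕ t = (toℕ i ℕ.+ toℕ t) mod n
    j ⊖ i = (toℕ j ℕ.+ (n ℕ.∸ toℕ i)) mod n

    one : Fin n
    one = 1 mod n

    toℕ-mod : ∀ k → toℕ (k mod n) ≡ k % n
    toℕ-mod k = toℕ-fromℕ< (m%n<n k n)

    %-absorb : ∀ a b → (a ℕ.+ b % n) % n ≡ (a ℕ.+ b) % n
    %-absorb a b = trans (%-distribˡ-+ a (b % n) n)
      (trans (cong (λ z → (a % n ℕ.+ z) % n) (m%n%n≡m%n b n)) (sym (%-distribˡ-+ a b n)))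

    ⊕-comm : ∀ i t → i ⊕ t ≡ t ⊕ i
    ⊕-comm i t = cong (_mod n) (ℕ.+-comm (toℕ i) (toℕ t))

    toℕ-% : ∀ (i : Fin n) → toℕ i % n ≡ toℕ i
    toℕ-% i = m<n⇒m%n≡m (toℕ<n i)

    toℕ-⊕-mod : ∀ i k → toℕ (i ⊕ (k mod n)) ≡ (toℕ i ℕ.+ k) % n
    toℕ-⊕-mod i k = trans (toℕ-mod _) (trans (cong (λ z → (toℕ i ℕ.+ z) % n) (toℕ-mod k)) (%-absorb (toℕ i) k))

    ⊕-⊖ : ∀ i j → i ⊕ (j ⊖ i) ≡ j
    ⊕-⊖ i j = toℕ-injective (trans (toℕ-⊕-mod i _) (trans (cong (_% n) lemma) (trans ([m+n]%n≡m%n (toℕ j) n) (toℕ-% j))))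
      where
      lemma : toℕ i ℕ.+ (toℕ j ℕ.+ (n ℕ.∸ toℕ i)) ≡ toℕ j ℕ.+ n
      lemma = trans (sym (ℕ.+-assoc (toℕ i) (toℕ j) _)) (trans (cong (ℕ._+ (n ℕ.∸ toℕ i)) (ℕ.+-comm (toℕ i) (toℕ j)))
        (trans (ℕ.+-assoc (toℕ j) (toℕ i) _) (cong (toℕ j ℕ.+_) (ℕ.m+[n∸m]≡n (toℕ≤n i)))))

    ⊕-assoc : ∀ i j k → (i ⊕ j) ⊕ k ≡ i ⊕ (j ⊕ k)
    ⊕-assoc i j k = toℕ-injective (trans (cong toℕ (⊕-comm (i ⊕ j) k))
      (trans (toℕ-⊕-mod k _) (trans (cong (_% n) lemma) (sym (toℕ-⊕-mod i _)))))
      where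
      lemma : toℕ k ℕ.+ (toℕ i ℕ.+ toℕ j) ≡ toℕ i ℕ.+ (toℕ j ℕ.+ toℕ k)
      lemma = trans (ℕ.+-comm (toℕ k) _) (ℕ.+-assoc (toℕ i) _ _)

    ⊕-cancelˡ : ∀ i {s t} → i ⊕ s ≡ i ⊕ t → s ≡ t
    ⊕-cancelˡ i {s} {t} e = trans (sym (inverse s)) (trans (cong (_⊖ i) e) (inverse t))
      where
      inverse : ∀ t → (i ⊕ t) ⊖ i ≡ t
      inverse t = toℕ-injective (trans (toℕ-mod _) (trans (cong (λ z → (z ℕ.+ (n ℕ.∸ toℕ i)) % n) (toℕ-mod _))
        (trans (cong (_% n) (ℕ.+-comm ((toℕ i ℕ.+ toℕ t) % n) _)) (trans (%-absorb (n ℕ.∸ toℕ i) _)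
          (trans (cong (_% n) lemma) (trans ([m+n]%n≡m%n (toℕ t) n) (toℕ-% t)))))))
        where
        lemma : (n ℕ.∸ toℕ i) ℕ.+ (toℕ i ℕ.+ toℕ t) ≡ toℕ t ℕ.+ n
        lemma = trans (sym (ℕ.+-assoc _ (toℕ i) (toℕ t))) (trans (cong (ℕ._+ toℕ t) (ℕ.m∸n+n≡m (toℕ≤n i))) (ℕ.+-comm n _))

    ⊖-unique : ∀ {i j t} → i ⊕ t ≡ j → j ⊖ i ≡ t
    ⊖-unique {i} {j} e = ⊕-cancelˡ i (trans (⊕-⊖ i j) (sym e))

    ⊖-⊕ : ∀ i j → (j ⊖ i) ⊕ i ≡ j
    ⊖-⊕ i j = trans (⊕-comm (j ⊖ i) i) (⊕-⊖ i j)

    toℕ-⊕-one : ∀ i → suc (toℕ i) ℕ.< n → toℕ (i ⊕ one) ≡ suc (toℕ i)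
    toℕ-⊕-one i l = trans (toℕ-⊕-mod i 1) (trans (cong (_% n) (ℕ.+-comm (toℕ i) 1)) (m<n⇒m%n≡m l))

  module Halving (h o : ℕ) where

    -- `inj₁ (m , b)` stands for 2m + b, and `Fin o` holds what is left over, the index 2h when n is
    -- odd. Differences `j ⊖ i`, symbols and layers are all read in this form.
    Half : Set
    Half = (Fin h × Fin 2) ⊎ Fin o

    halve : Fin (h ℕ.* 2 ℕ.+ o) → Half
    halve s with splitAt (h ℕ.* 2) s
    ... | inj₁ x = inj₁ (remQuot 2 x)
    ... | inj₂ z = inj₂ z

    unhalve : Half → Fin (h ℕ.* 2 ℕ.+ o)
    unhalve (inj₁ (m , b)) = combine m b ↑ˡ o
    unhalve (inj₂ z)       = (h ℕ.* 2) ↑ʳ z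

    halve-unhalve : ∀ x → halve (unhalve x) ≡ x
    halve-unhalve (inj₁ (m , b)) rewrite splitAt-↑ˡ (h ℕ.* 2) (combine m b) o = cong inj₁ (remQuot-combine m b)
    halve-unhalve (inj₂ z)       rewrite splitAt-↑ʳ (h ℕ.* 2) o z = refl

    unhalve-halve : ∀ s → unhalve (halve s) ≡ s
    unhalve-halve s with splitAt (h ℕ.* 2) s in eq
    ... | inj₁ x = trans (cong (_↑ˡ o) (combine-remQuot {h} 2 x)) (splitAt⁻¹-↑ˡ eq)
    ... | inj₂ z = splitAt⁻¹-↑ʳ eq

    unhalve-injective : ∀ {x y} → unhalve x ≡ unhalve y → x ≡ y
    unhalve-injective {x} {y} e = trans (sym (halve-unhalve x)) (trans (cong halve e) (halve-unhalve y))

    toℕ-unhalve : ∀ m b → toℕ (unhalve (inj₁ (m , b))) ≡ 2 ℕ.* toℕ m ℕ.+ toℕ b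
    toℕ-unhalve m b = trans (toℕ-↑ˡ (combine m b) o) (toℕ-combine m b)

  -- Half-integral tristochastic arrays.

  sumℚ-zero : ∀ {n} (f : Fin n → ℚ) → (∀ j → f j ≡ 0ℚ) → sumℚ f ≡ 0ℚ
  sumℚ-zero {zero}  f h = refl
  sumℚ-zero {suc n} f h = trans (cong₂ _+_ (h zero) (sumℚ-zero (f ∘ suc) (h ∘ suc))) (+-identityˡ 0ℚ)

  sumℚ-one : ∀ {n} (f : Fin n → ℚ) a → (∀ j → j ≢ a → f j ≡ 0ℚ) → sumℚ f ≡ f a
  sumℚ-one f zero    h = trans (cong (f zero +_) (sumℚ-zero (f ∘ suc) (λ j → h (suc j) λ ()))) (+-identityʳ (f zero))
  sumℚ-one f (suc a) h = trans (cong₂ _+_ (h zero λ ()) (sumℚ-one (f ∘ suc) a (λ j n → h (suc j) λ { refl → n refl })))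
    (+-identityˡ (f (suc a)))

  sumℚ-two : ∀ {n} (f : Fin n → ℚ) a b → a ≢ b → (∀ j → j ≢ a → j ≢ b → f j ≡ 0ℚ) → sumℚ f ≡ f a + f b
  sumℚ-two f zero    zero    n h = ⊥-elim (n refl)
  sumℚ-two f zero    (suc b) n h = cong (f zero +_) (sumℚ-one (f ∘ suc) b (λ j m → h (suc j) (λ ()) λ { refl → m refl }))
  sumℚ-two f (suc a) zero    n h = trans (cong (f zero +_) (sumℚ-one (f ∘ suc) a (λ j m → h (suc j) (λ { refl → m refl }) λ ())))
    (+-comm (f zero) (f (suc a)))
  sumℚ-two f (suc a) (suc b) n h = trans (cong₂ _+_ (h zero (λ ()) λ ())
    (sumℚ-two (f ∘ suc) a b (n ∘ cong suc) (λ j p q → h (suc j) (λ { refl → p refl }) λ { refl → q refl }))) (+-identityˡ _)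

  indicator : ∀ {n} → Fin n → Fin n → ℚ
  indicator l k = if ⌊ l ≟ k ⌋ then ½ else 0ℚ

  indicator-≡ : ∀ {n} {l k : Fin n} → l ≡ k → indicator l k ≡ ½
  indicator-≡ {l = l} {k} e with l ≟ k
  ... | yes _ = refl
  ... | no  n = ⊥-elim (n e)

  indicator-≢ : ∀ {n} {l k : Fin n} → l ≢ k → indicator l k ≡ 0ℚ
  indicator-≢ {l = l} {k} n with l ≟ k
  ... | yes e = ⊥-elim (n e)
  ... | no  _ = refl

  0≤indicator : ∀ {n} (l k : Fin n) → 0ℚ ≤ indicator l k
  0≤indicator l k with l ≟ k
  ... | yes _ = <⇒≤ (positive⁻¹ ½)
  ... | no  _ = ≤-refl

  record Two {A : Set} (P : A → Set) : Set where
    field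
      fst snd   : A
      fst-holds : P fst
      snd-holds : P snd
      apart     : fst ≢ snd
      only      : ∀ s → P s → s ≡ fst ⊎ s ≡ snd

  -- A slot is a position on the line together with one of the two structures, and `ℓ` gives its
  -- layer. The two slots of layer `k` may share a position, so sums along the line have two cases.
  module Line {n : ℕ} (ℓ : Fin n × Bool → Fin n) (k : Fin n) (two : Two (λ s → ℓ s ≡ k)) where
    open Two two

    entry : Fin n → ℚ
    entry j = indicator (ℓ (j , false)) k + indicator (ℓ (j , true)) k

    sum-supported : (f : Fin n → ℚ) → (∀ j → ℓ (j , false) ≢ k → ℓ (j , true) ≢ k → f j ≡ 0ℚ) →
      (proj₁ fst ≢ proj₁ snd → sumℚ f ≡ f (proj₁ fst) + f (proj₁ snd)) ×
      (proj₁ fst ≡ proj₁ snd → sumℚ f ≡ f (proj₁ fst))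
    sum-supported f supp =
      (λ n → sumℚ-two f _ _ n (λ j p q → supp j (off p q) (off p q))) ,
      (λ e → sumℚ-one f _ (λ j p → supp j (off p (λ q → p (trans q (sym e)))) (off p (λ q → p (trans q (sym e))))))
      where
      off : ∀ {j σ} → j ≢ proj₁ fst → j ≢ proj₁ snd → ℓ (j , σ) ≢ k
      off p q h with only _ h
      ... | inj₁ refl = p refl
      ... | inj₂ refl = q refl

    sum-pair : (f : Fin n → ℚ) → (∀ j → ℓ (j , false) ≢ k → ℓ (j , true) ≢ k → f j ≡ 0ℚ) →
      ∀ s s' → ℓ s ≡ k → ℓ s' ≡ k → proj₁ s ≢ proj₁ s' → sumℚ f ≡ f (proj₁ s) + f (proj₁ s')
    sum-pair f supp s s' p p' ne with only s p | only s' p'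
    ... | inj₁ refl | inj₁ refl = ⊥-elim (ne refl)
    ... | inj₂ refl | inj₂ refl = ⊥-elim (ne refl)
    ... | inj₁ refl | inj₂ refl = proj₁ (sum-supported f supp) ne
    ... | inj₂ refl | inj₁ refl = trans (proj₁ (sum-supported f supp) (ne ∘ sym)) (+-comm (f (proj₁ fst)) _)

    private
      two-values : ∀ {j} σ → ℓ (j , σ) ≡ k → ℓ (j , not σ) ≡ k → entry j ≡ 1ℚ
      two-values false p q rewrite indicator-≡ p | indicator-≡ q = refl
      two-values true  p q rewrite indicator-≡ p | indicator-≡ q = refl
      one-value : ∀ {j} σ → ℓ (j , σ) ≡ k → ℓ (j , not σ) ≢ k → entry j ≡ ½
      one-value false p q rewrite indicator-≡ p | indicator-≢ q = refl
      one-value true  p q rewrite indicator-≡ p | indicator-≢ q = refl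
      other : ∀ {j : Fin n} σ τ → (j , σ) ≢ (j , τ) → τ ≡ not σ
      other false false n = ⊥-elim (n refl)
      other false true  n = refl
      other true  false n = refl
      other true  true  n = ⊥-elim (n refl)
      not-≢ : ∀ (σ : Bool) → not σ ≢ σ
      not-≢ false ()
      not-≢ true  ()

    -- Either the two slots share a position, where the entry is ½ + ½, or they lie in two positions
    -- with ½ each.
    sum-entry : sumℚ entry ≡ 1ℚ
    sum-entry with proj₁ fst ≟ proj₁ snd
    ... | yes e = trans (proj₂ sums e) (two-values (proj₂ fst) fst-holds
            (subst (λ τ → ℓ (proj₁ fst , τ) ≡ k) (other _ _ (λ q → apart (trans q (cong (_, proj₂ snd) e))))
              (trans (cong (λ j → ℓ (j , proj₂ snd)) e) snd-holds)))
      where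
      sums = sum-supported entry (λ j p q → cong₂ _+_ (indicator-≢ p) (indicator-≢ q))
    ... | no ne = trans (proj₁ sums ne) (cong₂ _+_
            (one-value (proj₂ fst) fst-holds (λ q → clash fst (λ s → not-≢ _ (cong proj₂ s)) (λ s → ne (cong proj₁ s)) q))
            (one-value (proj₂ snd) snd-holds (λ q → clash snd (λ s → ne (cong proj₁ (sym s))) (λ s → not-≢ _ (cong proj₂ s)) q)))
      where
      sums = sum-supported entry (λ j p q → cong₂ _+_ (indicator-≢ p) (indicator-≢ q))
      clash : ∀ s → (proj₁ s , not (proj₂ s)) ≢ fst → (proj₁ s , not (proj₂ s)) ≢ snd → ℓ (proj₁ s , not (proj₂ s)) ≢ k
      clash s p q h with only _ h
      ... | inj₁ e = p e
      ... | inj₂ e = q e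

  +-zeroˡ-≥0 : ∀ {x y} → 0ℚ ≤ x → 0ℚ ≤ y → x + y ≡ 0ℚ → x ≡ 0ℚ
  +-zeroˡ-≥0 {x} {y} p q e = ≤-antisym (≤-trans (≤-reflexive (sym (+-identityʳ x))) (≤-trans (+-monoʳ-≤ x q) (≤-reflexive e))) p

  *-zero-pos : ∀ {t x} → 0ℚ < t → t * x ≡ 0ℚ → x ≡ 0ℚ
  *-zero-pos {t} {x} p e = ≤-antisym (*-cancelˡ-≤-pos t (≤-reflexive e'))  (*-cancelˡ-≤-pos t (≤-reflexive (sym e')))
    where
    instance _ = positive p
    e' : t * x ≡ t * 0ℚ
    e' = trans e (sym (*-zeroʳ t))

  0≤* : ∀ {t x} → 0ℚ < t → 0ℚ ≤ x → 0ℚ ≤ t * x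
  0≤* {t} p q = ≤-trans (≤-reflexive (sym (*-zeroʳ t))) (*-monoˡ-≤-nonNeg t {{nonNegative (<⇒≤ p)}} q)

  module HalfIntegral {n : ℕ} (lay : Bool → Fin n → Fin n → Fin n)
    (rows : ∀ i k → Two {Fin n × Bool} (λ (j , σ) → lay σ i j ≡ k))
    (cols : ∀ j k → Two {Fin n × Bool} (λ (i , σ) → lay σ i j ≡ k)) where

    X : Array n
    X i j k = indicator (lay false i j) k + indicator (lay true i j) k

    Supported : Array n → Set
    Supported Y = ∀ i j k → lay false i j ≢ k → lay true i j ≢ k → Y i j k ≡ 0ℚ

    X-supported : Supported X
    X-supported i j k p q = cong₂ _+_ (indicator-≢ p) (indicator-≢ q)

    0≤X : ∀ i j k → 0ℚ ≤ X i j k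
    0≤X i j k = +-mono-≤ (0≤indicator (lay false i j) k) (0≤indicator (lay true i j) k)

    cell-sum : ∀ {Y} → Supported Y → ∀ i j → lay false i j ≢ lay true i j →
      sumℚ (λ k → Y i j k) ≡ Y i j (lay false i j) + Y i j (lay true i j)
    cell-sum supp i j n = sumℚ-two _ _ _ n (λ k p q → supp i j k (p ∘ sym) (q ∘ sym))

    cell-sum-≡ : ∀ {Y} → Supported Y → ∀ i j → lay false i j ≡ lay true i j →
      sumℚ (λ k → Y i j k) ≡ Y i j (lay true i j)
    cell-sum-≡ supp i j e = sumℚ-one _ _ (λ k p → supp i j k (λ q → p (trans (sym q) e)) (p ∘ sym))

    X-tristochastic : Tristochastic X
    X-tristochastic = 0≤X , (λ j k → Line.sum-entry (λ (i , σ) → lay σ i j) k (cols j k)) ,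
      (λ i k → Line.sum-entry (λ (j , σ) → lay σ i j) k (rows i k)) , vertical
      where
      vertical : ∀ i j → sumℚ (λ k → X i j k) ≡ 1ℚ
      vertical i j with lay false i j ≟ lay true i j
      ... | yes e = trans (cell-sum-≡ X-supported i j e) (cong₂ _+_ (indicator-≡ e) (indicator-≡ {l = lay true i j} refl))
      ... | no  n = trans (cell-sum X-supported i j n) (cong₂ _+_
              (cong₂ _+_ (indicator-≡ {l = lay false i j} refl) (indicator-≢ (n ∘ sym)))
              (cong₂ _+_ (indicator-≢ n) (indicator-≡ {l = lay true i j} refl)))

    -- Both arrays of a proper convex combination are nonnegative with positive weights, so they
    -- vanish wherever `X` does. By rigidity each of them equals `X`.
    rigid⇒vertex : (∀ Y → Tristochastic Y → Supported Y → Y ≋ X) → IsVertex X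
    rigid⇒vertex rigid = X-tristochastic , λ B C t tB tC 0<t t<1 e i j k →
      trans (rigid B tB (left B C t tB tC 0<t t<1 e) i j k) (sym (rigid C tC (right B C t tB tC 0<t t<1 e) i j k))
      where
      0<1-t : ∀ {t} → t < 1ℚ → 0ℚ < 1ℚ - t
      0<1-t {t} t<1 = subst (_< 1ℚ - t) (+-inverseʳ t) (+-monoˡ-< (- t) t<1)
      left : ∀ B C t → Tristochastic B → Tristochastic C → 0ℚ < t → t < 1ℚ → X ≋ convex t B C → Supported B
      left B C t (0≤B , _) (0≤C , _) p q e i j k a b =
        *-zero-pos p (+-zeroˡ-≥0 (0≤* p (0≤B i j k)) (0≤* (0<1-t q) (0≤C i j k)) (trans (sym (e i j k)) (X-supported i j k a b)))
      right : ∀ B C t → Tristochastic B → Tristochastic C → 0ℚ < t → t < 1ℚ → X ≋ convex t B C → Supported C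
      right B C t (0≤B , _) (0≤C , _) p q e i j k a b =
        *-zero-pos (0<1-t q) (+-zeroˡ-≥0 (0≤* (0<1-t q) (0≤C i j k)) (0≤* p (0≤B i j k))
          (trans (+-comm ((1ℚ - t) * C i j k) (t * B i j k)) (trans (sym (e i j k)) (X-supported i j k a b))))

  double⇒½ : ∀ {x} → x + x ≡ 1ℚ → x ≡ ½
  double⇒½ {x} e = trans (sym (*-identityˡ x)) (trans (*-distribʳ-+ x ½ ½)
    (trans (sym (*-distribˡ-+ ½ x x)) (cong (½ *_) e)))

  constant : ∀ {h} {A : Set} (f : Fin h → A) → (∀ m m' → toℕ m' ≡ suc (toℕ m) → f m ≡ f m') → ∀ m m' → f m ≡ f m'
  constant {suc h} f step m m' = trans (sym (from-zero m)) (from-zero m')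
    where
    from-zero : ∀ m → f zero ≡ f m
    from-zero = <-weakInduction (λ m → f zero ≡ f m) refl
      (λ i e → trans e (step (inject₁ i) (suc i) (cong suc (sym (toℕ-inject₁ i)))))

  -- Colour layers, symbol layers and the support of the array.

  module Construction (h o : ℕ) .{{_ : NonZero (h ℕ.* 2 ℕ.+ o)}} where

    n : ℕ
    n = h ℕ.* 2 ℕ.+ o

    open Modular n public
    open Halving h o public

    pattern 0₂ = zero
    pattern 1₂ = suc zero

    t₀ t₁ : Fin h → Fin n
    t₀ m = unhalve (inj₁ (m , 0₂))
    t₁ m = unhalve (inj₁ (m , 1₂))

    t₁≢t₀ : ∀ {m m'} → t₁ m ≢ t₀ m'
    t₁≢t₀ e with () ← unhalve-injective {inj₁ (_ , 1₂)} {inj₁ (_ , 0₂)} e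

    t₀⊕one : ∀ m → t₀ m ⊕ one ≡ t₁ m
    t₀⊕one m = toℕ-injective (trans (toℕ-⊕-one (t₀ m) (subst (ℕ._< n) value (toℕ<n (t₁ m)))) (sym value))
      where
      value : toℕ (t₁ m) ≡ suc (toℕ (t₀ m))
      value = trans (toℕ-unhalve m 1₂) (trans (ℕ.+-suc _ 0) (cong suc (sym (toℕ-unhalve m 0₂))))

    t₁⊕one : ∀ m m' → toℕ m' ≡ suc (toℕ m) → t₁ m ⊕ one ≡ t₀ m'
    t₁⊕one m m' e = toℕ-injective (trans (toℕ-⊕-one (t₁ m) (subst (ℕ._< n) value (toℕ<n (t₀ m')))) (sym value))
      where
      value : toℕ (t₀ m') ≡ suc (toℕ (t₁ m))
      value = trans (toℕ-unhalve m' 0₂) (trans (cong (λ z → 2 ℕ.* z ℕ.+ 0) e) (trans (ℕ.+-identityʳ _)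
        (trans (ℕ.*-suc 2 (toℕ m)) (cong suc (trans (ℕ.+-comm 1 _) (sym (toℕ-unhalve m 1₂)))))))

    right back : Fin h → Fin n → Fin n
    right m i = i ⊕ t₁ m
    back  m v = v ⊖ t₁ m

    back-right : ∀ m i → back m (right m i) ≡ i
    back-right m i = ⊖-unique (⊕-comm (t₁ m) i)

    right-back : ∀ m v → right m (back m v) ≡ v
    right-back m v = ⊖-⊕ (t₁ m) v

    open Blocks right back back-right right-back public

    record Proper (α : Edge → Fin h) : Set where
      field
        exists : ∀ s v d → Σ Edge λ e → end s e ≡ v × α e ≡ d
        unique : ∀ s {e e'} → end s e ≡ end s e' → α e ≡ α e' → e ≡ e'

    record LatinSquare (B : Fin n → Fin n → Fin n) : Set where
      field
        row        : Fin n → Fin n → Fin n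
        row-spec   : ∀ i s → B i (row i s) ≡ s
        row-unique : ∀ {i j s} → B i j ≡ s → j ≡ row i s
        col        : Fin n → Fin n → Fin n
        col-spec   : ∀ j s → B (col j s) j ≡ s
        col-unique : ∀ {i j s} → B i j ≡ s → i ≡ col j s

    ⊕-⊖-one : ∀ i → (i ⊕ one) ⊖ one ≡ i
    ⊕-⊖-one i = ⊖-unique (⊕-comm one i)

    -- Seen from its own row, the cell P of an edge has the odd difference 2m + 1 and the cell Q the
    -- even difference 2m. So `j ⊖ i` tells which kind of cell (i , j) is, and each cell is used
    -- once.
    right-Q : ∀ i m → i ⊕ t₁ m ≡ (i ⊕ one) ⊕ t₀ m
    right-Q i m = trans (cong (i ⊕_) (trans (sym (t₀⊕one m)) (⊕-comm (t₀ m) one))) (sym (⊕-assoc i one (t₀ m)))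

    -- Layers (_ , 0₂) carry the cells P e, Q e of the edges of one colour, layers (_ , 1₂) carry two
    -- symbols of the Latin square, and a layer inj₂ z carries one diagonal and one symbol.
    symbol-layer : Half → Half
    symbol-layer (inj₁ (e , _)) = inj₁ (e , 1₂)
    symbol-layer (inj₂ z)       = inj₂ z

    data View (i j : Fin n) : Set where
      P : ∀ m → j ≡ i ⊕ t₁ m → View i j
      Q : ∀ i' m → i ≡ i' ⊕ one → j ≡ i' ⊕ t₁ m → View i j
      D : ∀ z → j ≡ i ⊕ unhalve (inj₂ z) → View i j

    view : ∀ i j → View i j
    view i j with halve (j ⊖ i) in eq
    ... | inj₁ (m , 1₂) = P m (sym (trans (cong (i ⊕_) (trans (cong unhalve (sym eq)) (unhalve-halve _))) (⊕-⊖ i j)))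
    ... | inj₁ (m , 0₂) = Q (i ⊖ one) m (sym (⊖-⊕ one i)) (sym (trans (right-Q (i ⊖ one) m)
        (trans (cong (_⊕ t₀ m) (⊖-⊕ one i)) (trans (cong (i ⊕_) (trans (cong unhalve (sym eq)) (unhalve-halve _))) (⊕-⊖ i j)))))
    ... | inj₂ z = D z (sym (trans (cong (i ⊕_) (trans (cong unhalve (sym eq)) (unhalve-halve _))) (⊕-⊖ i j)))

    module Layers (α : Edge → Fin h) (proper : Proper α) (B : Fin n → Fin n → Fin n) (latin : LatinSquare B) where
      open Proper proper
      open LatinSquare latin

      half-layer : Fin n → Half → Half
      half-layer i (inj₁ (m , 1₂)) = inj₁ (α (i , m) , 0₂)
      half-layer i (inj₁ (m , 0₂)) = inj₁ (α (i ⊖ one , m) , 0₂)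
      half-layer i (inj₂ z)        = inj₂ z

      layerA layerB : Fin n → Fin n → Half
      layerA i j = half-layer i (halve (j ⊖ i))
      layerB i j = symbol-layer (halve (B i j))

      lay : Bool → Fin n → Fin n → Fin n
      lay false i j = unhalve (layerB i j)
      lay true  i j = unhalve (layerA i j)

      halve-⊖ : ∀ i x → halve ((i ⊕ unhalve x) ⊖ i) ≡ x
      halve-⊖ i x = trans (cong halve (⊖-unique refl)) (halve-unhalve x)

      layerA-P : ∀ i m → layerA i (i ⊕ t₁ m) ≡ inj₁ (α (i , m) , 0₂)
      layerA-P i m = cong (half-layer i) (halve-⊖ i (inj₁ (m , 1₂)))

      layerA-Q : ∀ i m → layerA (i ⊕ one) (i ⊕ t₁ m) ≡ inj₁ (α (i , m) , 0₂)
      layerA-Q i m = trans (cong (half-layer (i ⊕ one)) (trans (cong (λ j → halve (j ⊖ (i ⊕ one))) (right-Q i m))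
        (halve-⊖ (i ⊕ one) (inj₁ (m , 0₂))))) (cong (λ i → inj₁ (α (i , m) , 0₂)) (⊕-⊖-one i))

      layerA-D : ∀ i z → layerA i (i ⊕ unhalve (inj₂ z)) ≡ inj₂ z
      layerA-D i z = cong (half-layer i) (halve-⊖ i (inj₂ z))

      layerA≢1 : ∀ {i j e} → layerA i j ≢ inj₁ (e , 1₂)
      layerA≢1 {i} {j} q with view i j
      ... | P m refl        with () ← trans (sym (layerA-P i m)) q
      ... | Q i' m refl refl with () ← trans (sym (layerA-Q i' m)) q
      ... | D z refl        with () ← trans (sym (layerA-D i z)) q

      layerB≢0 : ∀ {i j e} → layerB i j ≢ inj₁ (e , 0₂)
      layerB≢0 {i} {j} q with halve (B i j)
      layerB≢0 () | inj₁ _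
      layerB≢0 () | inj₂ _

      private
        layerB-at : ∀ {i j} x → B i j ≡ unhalve x → layerB i j ≡ symbol-layer x
        layerB-at x e = cong symbol-layer (trans (cong halve e) (halve-unhalve x))

        symbol-of : ∀ {i j x} → halve (B i j) ≡ x → B i j ≡ unhalve x
        symbol-of e = trans (sym (unhalve-halve _)) (cong unhalve e)

        inj₁-fst : ∀ {d d' : Fin h} {b b' : Fin 2} → inj₁ {B = Fin o} (d , b) ≡ inj₁ (d' , b') → d ≡ d'
        inj₁-fst refl = refl

        -- The index `m` guarantees n ≥ 2: if the shift by one had a fixed point, `t₀ m` and `t₁ m`
        -- would coincide.
        i⊕one≢i : Fin h → ∀ i → i ⊕ one ≢ i
        i⊕one≢i m i e = t₁≢t₀ (trans (sym (t₀⊕one m)) (⊕-cancelˡ i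
          (trans (sym (⊕-assoc i (t₀ m) one)) (trans (cong (_⊕ one) (⊕-comm i (t₀ m)))
            (trans (⊕-assoc (t₀ m) i one) (trans (cong (t₀ m ⊕_) e) (⊕-comm (t₀ m) i)))))))

        b-slots : ∀ {i j e} → layerB i j ≡ inj₁ (e , 1₂) → B i j ≡ t₀ e ⊎ B i j ≡ t₁ e
        b-slots {i} {j} q with halve (B i j) in eq
        b-slots refl | inj₁ (e , 0₂) = inj₁ (symbol-of eq)
        b-slots refl | inj₁ (e , 1₂) = inj₂ (symbol-of eq)

        b-shared : ∀ {i j z} → layerB i j ≡ inj₂ z → B i j ≡ unhalve (inj₂ z)
        b-shared {i} {j} q with halve (B i j) in eq
        b-shared refl | inj₂ z = symbol-of eq

      -- Row `i` meets colour layer `d` in P of the edge of colour `d` at `i` and in Q of the edge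
      -- of colour `d` at the preceding row. A symbol layer is met in its two symbols, a mixed layer
      -- in one symbol and one diagonal cell.
      rows-half : ∀ i K → Two {Fin n × Bool} (λ (j , σ) → lay σ i j ≡ unhalve K)
      rows-half i (inj₁ (e , 1₂)) = record
        { fst = row i (t₀ e) , false ; snd = row i (t₁ e) , false
        ; fst-holds = cong unhalve (layerB-at (inj₁ (e , 0₂)) (row-spec i (t₀ e)))
        ; snd-holds = cong unhalve (layerB-at (inj₁ (e , 1₂)) (row-spec i (t₁ e)))
        ; apart = λ q → t₁≢t₀ (trans (sym (row-spec i (t₁ e))) (trans (cong (B i) (sym (cong proj₁ q))) (row-spec i (t₀ e))))
        ; only = λ where
            (j , true)  q → ⊥-elim (layerA≢1 (unhalve-injective q))
            (j , false) q → case-symbols (b-slots (unhalve-injective q))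
        }
        where
        case-symbols : ∀ {j} → B i j ≡ t₀ e ⊎ B i j ≡ t₁ e → (j , false) ≡ (row i (t₀ e) , false) ⊎ (j , false) ≡ (row i (t₁ e) , false)
        case-symbols (inj₁ q) = inj₁ (cong (_, false) (row-unique q))
        case-symbols (inj₂ q) = inj₂ (cong (_, false) (row-unique q))
      rows-half i (inj₂ z) = record
        { fst = row i (unhalve (inj₂ z)) , false ; snd = i ⊕ unhalve (inj₂ z) , true
        ; fst-holds = cong unhalve (layerB-at (inj₂ z) (row-spec i (unhalve (inj₂ z))))
        ; snd-holds = cong unhalve (layerA-D i z)
        ; apart = λ ()
        ; only = λ where
            (j , false) q → inj₁ (cong (_, false) (row-unique (b-shared (unhalve-injective q))))
            (j , true)  q → inj₂ (cong (_, true) (diagonal j (unhalve-injective q)))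
        }
        where
        diagonal : ∀ j → layerA i j ≡ inj₂ z → j ≡ i ⊕ unhalve (inj₂ z)
        diagonal j q with view i j
        ... | P m refl         with () ← trans (sym (layerA-P i m)) q
        ... | Q i' m refl refl with () ← trans (sym (layerA-Q i' m)) q
        ... | D z' refl        with refl ← trans (sym (layerA-D i z')) q = refl
      rows-half i (inj₁ (d , 0₂)) with exists false i d | exists false (i ⊖ one) d
      ... | (_ , m₀) , refl , c₀ | (_ , m₁) , refl , c₁ = record
        { fst = i ⊕ t₁ m₀ , true ; snd = (i ⊖ one) ⊕ t₁ m₁ , true
        ; fst-holds = cong unhalve (trans (layerA-P i m₀) (cong (λ d → inj₁ (d , 0₂)) c₀))
        ; snd-holds = cong unhalve (trans (cong (λ r → layerA r ((i ⊖ one) ⊕ t₁ m₁)) (sym (⊖-⊕ one i)))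
                        (trans (layerA-Q (i ⊖ one) m₁) (cong (λ d → inj₁ (d , 0₂)) c₁)))
        ; apart = λ q → t₁≢t₀ (⊕-cancelˡ i (trans (cong proj₁ q) (trans (right-Q (i ⊖ one) m₁) (cong (_⊕ t₀ m₁) (⊖-⊕ one i)))))
        ; only = λ where
            (j , false) q → ⊥-elim (layerB≢0 (unhalve-injective q))
            (j , true)  q → coloured j (unhalve-injective q)
        }
        where
        coloured : ∀ j → layerA i j ≡ inj₁ (d , 0₂) → (j , true) ≡ (i ⊕ t₁ m₀ , true) ⊎ (j , true) ≡ ((i ⊖ one) ⊕ t₁ m₁ , true)
        coloured j q with view i j
        ... | P m refl with refl ← trans (sym (layerA-P i m)) q =
                inj₁ (cong (λ e → i ⊕ t₁ (proj₂ e) , true) (unique false refl (sym c₀)))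
        ... | Q i' m e refl with refl ← trans (sym (layerA-Q i' m)) (trans (cong (λ r → layerA r (i' ⊕ t₁ m)) (sym e)) q)
                               | refl ← trans (cong (_⊖ one) e) (⊕-⊖-one i') =
                inj₂ (cong (λ e → i' ⊕ t₁ (proj₂ e) , true) (unique false refl (sym c₁)))
        ... | D z refl with () ← trans (sym (layerA-D i z)) q

      -- In a colour layer both slots of a column belong to one edge, the one of that colour with
      -- right end `j`.
      cols-half : ∀ j K → Two {Fin n × Bool} (λ (i , σ) → lay σ i j ≡ unhalve K)
      cols-half j (inj₁ (e , 1₂)) = record
        { fst = col j (t₀ e) , false ; snd = col j (t₁ e) , false
        ; fst-holds = cong unhalve (layerB-at (inj₁ (e , 0₂)) (col-spec j (t₀ e)))
        ; snd-holds = cong unhalve (layerB-at (inj₁ (e , 1₂)) (col-spec j (t₁ e)))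
        ; apart = λ q → t₁≢t₀ (trans (sym (col-spec j (t₁ e))) (trans (cong (λ i → B i j) (sym (cong proj₁ q))) (col-spec j (t₀ e))))
        ; only = λ where
            (i , true)  q → ⊥-elim (layerA≢1 (unhalve-injective q))
            (i , false) q → case-symbols (b-slots (unhalve-injective q))
        }
        where
        case-symbols : ∀ {i} → B i j ≡ t₀ e ⊎ B i j ≡ t₁ e → (i , false) ≡ (col j (t₀ e) , false) ⊎ (i , false) ≡ (col j (t₁ e) , false)
        case-symbols (inj₁ q) = inj₁ (cong (_, false) (col-unique q))
        case-symbols (inj₂ q) = inj₂ (cong (_, false) (col-unique q))
      cols-half j (inj₂ z) = record
        { fst = col j (unhalve (inj₂ z)) , false ; snd = j ⊖ unhalve (inj₂ z) , true
        ; fst-holds = cong unhalve (layerB-at (inj₂ z) (col-spec j (unhalve (inj₂ z))))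
        ; snd-holds = cong unhalve (trans (cong (layerA (j ⊖ unhalve (inj₂ z))) (sym (⊖-⊕ (unhalve (inj₂ z)) j)))
                        (layerA-D (j ⊖ unhalve (inj₂ z)) z))
        ; apart = λ ()
        ; only = λ where
            (i , false) q → inj₁ (cong (_, false) (col-unique (b-shared (unhalve-injective q))))
            (i , true)  q → inj₂ (cong (_, true) (diagonal i (unhalve-injective q)))
        }
        where
        diagonal : ∀ i → layerA i j ≡ inj₂ z → i ≡ j ⊖ unhalve (inj₂ z)
        diagonal i q with view i j
        ... | P m refl         with () ← trans (sym (layerA-P i m)) q
        ... | Q i' m refl refl with () ← trans (sym (layerA-Q i' m)) q
        ... | D z' refl        with refl ← trans (sym (layerA-D i z')) q = sym (⊖-unique (⊕-comm (unhalve (inj₂ z)) i))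
      cols-half j (inj₁ (d , 0₂)) with exists true j d
      ... | (i₀ , m₀) , refl , refl = record
        { fst = i₀ , true ; snd = i₀ ⊕ one , true
        ; fst-holds = cong unhalve (layerA-P i₀ m₀)
        ; snd-holds = cong unhalve (layerA-Q i₀ m₀)
        ; apart = λ q → i⊕one≢i m₀ i₀ (sym (cong proj₁ q))
        ; only = λ where
            (i , false) q → ⊥-elim (layerB≢0 (unhalve-injective q))
            (i , true)  q → coloured i (unhalve-injective q)
        }
        where
        coloured : ∀ i → layerA i (i₀ ⊕ t₁ m₀) ≡ inj₁ (α (i₀ , m₀) , 0₂) → (i , true) ≡ (i₀ , true) ⊎ (i , true) ≡ (i₀ ⊕ one , true)
        coloured i q with view i (i₀ ⊕ t₁ m₀)
        ... | P m e with unique true {i₀ , m₀} {i , m} e (sym (inj₁-fst (trans (sym (trans (cong (layerA i) e) (layerA-P i m))) q)))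
        ...   | refl = inj₁ refl
        coloured i q | Q i' m refl e with unique true {i₀ , m₀} {i' , m} e
            (sym (inj₁-fst (trans (sym (trans (cong (layerA (i' ⊕ one)) e) (layerA-Q i' m))) q)))
        ...   | refl = inj₂ refl
        coloured i q | D z e with () ← trans (sym (trans (cong (layerA i) e) (layerA-D i z))) q

      rows : ∀ i k → Two {Fin n × Bool} (λ (j , σ) → lay σ i j ≡ k)
      rows i k = subst (λ k → Two {Fin n × Bool} (λ (j , σ) → lay σ i j ≡ k)) (unhalve-halve k) (rows-half i (halve k))

      cols : ∀ j k → Two {Fin n × Bool} (λ (i , σ) → lay σ i j ≡ k)
      cols j k = subst (λ k → Two {Fin n × Bool} (λ (i , σ) → lay σ i j ≡ k)) (unhalve-halve k) (cols-half j (halve k))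

      open HalfIntegral lay rows cols public

      -- The value -r-1 in column 0 is made for `column-tie`: it is 2m in row -(2m+1), and 2m + 1 in
      -- row -(2m+3) + 1. These links leave one common parameter x free; `same` adds a relation that
      -- only x = ½ satisfies.
      record Tied : Set where
        field
          column-0 : ∀ r → B r (0 mod n) ≡ (0 mod n) ⊖ (r ⊕ one)
          m₀ m₁    : Fin h
          m₀≢m₁    : m₀ ≢ m₁
          same     : layerB (0 mod n) ((0 mod n) ⊕ t₁ m₀) ≡ layerB (0 mod n) ((0 mod n) ⊕ t₁ m₁)

      -- Uniqueness of the array with the given support.

      module Rigid (o≤1 : (z z' : Fin o) → z ≡ z') (tied : Tied) (Y : Array n) (tri : Tristochastic Y) (supp : Supported Y) where
        open Tied tied

        private
          𝟎 : Fin n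
          𝟎 = 0 mod n

          w : Bool → Fin n → Fin n → ℚ
          w σ i j = Y i j (lay σ i j)

          row-pair : ∀ {i} σ σ' {j j'} → lay σ i j ≡ lay σ' i j' → j ≢ j' → w σ i j + w σ' i j' ≡ 1ℚ
          row-pair {i} σ σ' {j} {j'} e ne =
            trans (cong (w σ i j +_) (cong (Y i j') (sym e)))
            (trans (sym (Line.sum-pair (λ (j , σ) → lay σ i j) (lay σ i j) (rows i (lay σ i j)) (λ j' → Y i j' (lay σ i j))
              (λ j' → supp i j' (lay σ i j)) (j , σ) (j' , σ') refl (sym e) ne)) (proj₁ (proj₂ (proj₂ tri)) i _))

          col-pair : ∀ {j} σ σ' {i i'} → lay σ i j ≡ lay σ' i' j → i ≢ i' → w σ i j + w σ' i' j ≡ 1ℚ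
          col-pair {j} σ σ' {i} {i'} e ne =
            trans (cong (w σ i j +_) (cong (Y i' j) (sym e)))
            (trans (sym (Line.sum-pair (λ (i , σ) → lay σ i j) (lay σ i j) (cols j (lay σ i j)) (λ i' → Y i' j (lay σ i j))
              (λ i' → supp i' j (lay σ i j)) (i , σ) (i' , σ') refl (sym e) ne)) (proj₁ (proj₂ tri) j _))

          cell-pair : ∀ i j → lay false i j ≢ lay true i j → w false i j + w true i j ≡ 1ℚ
          cell-pair i j ne = trans (sym (cell-sum supp i j ne)) (proj₂ (proj₂ (proj₂ tri)) i j)

          -- Colour layers contain no symbol slots, so the two slots of such a cell lie in different
          -- layers.
          proper-cell : ∀ {i j d} → layerA i j ≡ inj₁ (d , 0₂) → lay false i j ≢ lay true i j
          proper-cell {i} {j} e q = layerB≢0 (trans (unhalve-injective q) e)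

          pP pQ : Edge → ℚ
          pP (i , m) = w true i (i ⊕ t₁ m)
          pQ (i , m) = w true (i ⊕ one) (i ⊕ t₁ m)

          edge-pair : ∀ e → pP e + pQ e ≡ 1ℚ
          edge-pair (i , m) = col-pair true true (cong unhalve (trans (layerA-P i m) (sym (layerA-Q i m)))) (i⊕one≢i m i ∘ sym)

          -- Q of the first edge is the complement of its P in the column, and also of P of the
          -- second edge in row `i ⊕ one`. Iterating over the rows follows the Hamiltonian cycle of
          -- the colour.
          next : ∀ i m m' → α (i , m) ≡ α (i ⊕ one , m') → pP (i , m) ≡ pP (i ⊕ one , m')
          next i m m' e = ∙-cancelʳ (pQ (i , m)) _ _ (trans (edge-pair (i , m)) (sym (row-pair true true
            (cong unhalve (trans (layerA-P (i ⊕ one) m') (trans (cong (λ d → inj₁ (d , 0₂)) (sym e)) (sym (layerA-Q i m)))))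
            (λ q → t₁≢t₀ (⊕-cancelˡ (i ⊕ one) (trans q (right-Q i m)))))))

          mod-suc : ∀ t → (t mod n) ⊕ one ≡ suc t mod n
          mod-suc t = toℕ-injective (trans (cong toℕ (⊕-comm (t mod n) one)) (trans (toℕ-⊕-mod one t)
            (trans (cong (λ z → (z ℕ.+ t) % n) (toℕ-mod 1)) (trans (cong (_% n) (ℕ.+-comm (1 % n) t))
              (trans (%-absorb t 1) (trans (cong (_% n) (ℕ.+-comm t 1)) (sym (toℕ-mod (suc t)))))))))

          along : ∀ t m m' → α (𝟎 , m) ≡ α (t mod n , m') → pP (𝟎 , m) ≡ pP (t mod n , m')
          along zero    m m' e = cong pP (unique false refl e)
          along (suc t) m m' e with exists false (t mod n) (α (𝟎 , m))
          ... | (_ , m'') , refl , c = trans (along t m m'' (sym c))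
                (trans (next (t mod n) m'' m' (trans c (trans e (cong (λ i → α (i , m')) (sym (mod-suc t))))))
                  (cong (λ i → pP (i , m')) (mod-suc t)))

          same-colour : ∀ e e' → α e ≡ α e' → pP e ≡ pP e'
          same-colour e e' q with exists false 𝟎 (α e)
          ... | (_ , m) , refl , c = trans (sym (from-0 e c)) (from-0 e' (trans c q))
            where
            back-to : ∀ i → toℕ i mod n ≡ i
            back-to i = toℕ-injective (trans (toℕ-mod (toℕ i)) (toℕ-% i))
            from-0 : ∀ e → α (𝟎 , m) ≡ α e → pP (𝟎 , m) ≡ pP e
            from-0 (i , m') q = subst (λ i → α (𝟎 , m) ≡ α (i , m') → pP (𝟎 , m) ≡ pP (i , m')) (back-to i) (along (toℕ i) m m') q

          edge₀ : Fin h → Edge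
          edge₀ m = 𝟎 ⊖ t₁ m , m

          -- By column-0 the cells P (edge₀ m) and Q (edge₀ (m + 1)) carry symbols of one layer.
          column-tie : ∀ m m' → toℕ m' ≡ suc (toℕ m) → pP (edge₀ m) ≡ pP (edge₀ m')
          column-tie m m' e = trans (∙-cancelˡ (w false r 𝟎) _ _ (trans P-cell (sym B-pair)))
            (sym (∙-cancelʳ (w true r' 𝟎) _ _ (trans (trans (cong (pP (edge₀ m') +_) (sym (cong (w true r') (⊖-⊕ (t₁ m') 𝟎)))) (edge-pair (edge₀ m'))) (sym Q-cell))))
            where
            r r' : Fin n
            r  = 𝟎 ⊖ t₁ m
            r' = (𝟎 ⊖ t₁ m') ⊕ one
            B-r : B r 𝟎 ≡ t₀ m
            B-r = trans (column-0 r) (⊖-unique (trans (⊕-assoc r one (t₀ m)) (trans (cong (r ⊕_) (trans (⊕-comm one (t₀ m)) (t₀⊕one m))) (⊖-⊕ (t₁ m) 𝟎))))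
            B-r' : B r' 𝟎 ≡ t₁ m
            B-r' = trans (column-0 r') (⊖-unique (trans (⊕-assoc r' one (t₁ m)) (trans (cong (r' ⊕_) (trans (⊕-comm one (t₁ m)) (t₁⊕one m m' e)))
              (trans (⊕-assoc _ one (t₀ m')) (trans (cong ((𝟎 ⊖ t₁ m') ⊕_) (trans (⊕-comm one (t₀ m')) (t₀⊕one m'))) (⊖-⊕ (t₁ m') 𝟎))))))
            B-pair : w false r 𝟎 + w false r' 𝟎 ≡ 1ℚ
            B-pair = col-pair false false (cong unhalve (trans (layerB-at (inj₁ (m , 0₂)) B-r) (sym (layerB-at (inj₁ (m , 1₂)) B-r'))))
              (λ q → t₁≢t₀ (trans (sym B-r') (trans (cong (λ i → B i 𝟎) (sym q)) B-r)))
            P-cell : w false r 𝟎 + pP (edge₀ m) ≡ 1ℚ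
            P-cell = subst (λ j → w false r 𝟎 + w true r j ≡ 1ℚ) (sym (⊖-⊕ (t₁ m) 𝟎))
              (cell-pair r 𝟎 (proper-cell (trans (cong (layerA r) (sym (⊖-⊕ (t₁ m) 𝟎))) (layerA-P r m))))
            Q-cell : w false r' 𝟎 + w true r' 𝟎 ≡ 1ℚ
            Q-cell = cell-pair r' 𝟎 (proper-cell (trans (cong (layerA r') (sym (⊖-⊕ (t₁ m') 𝟎))) (layerA-Q (𝟎 ⊖ t₁ m') m')))

          -- Every colour has an edge ending in column 0, and `column-tie` connects these edges for
          -- consecutive shifts. This joins the cycles of all colours.
          all-equal : ∀ e e' → pP e ≡ pP e'
          all-equal e e' with exists true 𝟎 (α e) | exists true 𝟎 (α e')
          ... | (i , m) , q , c | (i' , m') , q' , c' =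
                trans (sym (same-colour _ e c)) (trans (cong pP (cong₂ _,_ (sym (left-end q)) refl))
                  (trans (constant (pP ∘ edge₀) column-tie m m')
                    (trans (cong pP (cong₂ _,_ (left-end q') refl)) (same-colour _ e' c'))))
            where
            left-end : ∀ {i m} → i ⊕ t₁ m ≡ 𝟎 → 𝟎 ⊖ t₁ m ≡ i
            left-end {i} {m} q = ⊖-unique (trans (⊕-comm (t₁ m) i) q)

          P-cell : ∀ e → w false (proj₁ e) (proj₁ e ⊕ t₁ (proj₂ e)) + pP e ≡ 1ℚ
          P-cell (i , m) = cell-pair i _ (proper-cell (layerA-P i m))

          -- With x the common value, the symbol slots of P for the shifts `m₀` and `m₁` in row 0
          -- both carry 1 - x. They lie in one layer, so 2(1 - x) = 1.
          pP-½ : ∀ e → pP e ≡ ½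
          pP-½ e = trans (all-equal e (𝟎 , m₁)) (double⇒½ (trans (cong (_+ pP (𝟎 , m₁)) (sym w≡)) (P-cell (𝟎 , m₁))))
            where
            w≡ : w false 𝟎 (𝟎 ⊕ t₁ m₁) ≡ pP (𝟎 , m₁)
            w≡ = trans (∙-cancelˡ (w false 𝟎 (𝟎 ⊕ t₁ m₀)) _ _ (trans (row-pair false false (cong unhalve same)
                   (λ q → m₀≢m₁ (t₁-injective (⊕-cancelˡ 𝟎 q)))) (sym (P-cell (𝟎 , m₀))))) (all-equal _ _)
              where
              t₁-injective : ∀ {m m'} → t₁ m ≡ t₁ m' → m ≡ m'
              t₁-injective {m} {m'} q = inj₁-fst (unhalve-injective {inj₁ (m , 1₂)} {inj₁ (m' , 1₂)} q)

          other-half : ∀ {x y} → x + y ≡ 1ℚ → x ≡ ½ → y ≡ ½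
          other-half e refl = ∙-cancelˡ ½ _ _ e

          other-half' : ∀ {x y} → x + y ≡ 1ℚ → y ≡ ½ → x ≡ ½
          other-half' e refl = ∙-cancelʳ ½ _ _ e

          pQ-½ : ∀ e → pQ e ≡ ½
          pQ-½ e = other-half (edge-pair e) (pP-½ e)

          BothHalf : Fin n → Fin n → Set
          BothHalf i j = w false i j ≡ ½ × w true i j ≡ ½

          proper-halves : ∀ i j {d} → layerA i j ≡ inj₁ (d , 0₂) → w true i j ≡ ½ → BothHalf i j
          proper-halves i j e q = other-half' (cell-pair i j (proper-cell e)) q , q

          P-halves : ∀ i m → BothHalf i (i ⊕ t₁ m)
          P-halves i m = proper-halves i _ (layerA-P i m) (pP-½ (i , m))

          Q-halves : ∀ i m → BothHalf (i ⊕ one) (i ⊕ t₁ m)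
          Q-halves i m = proper-halves (i ⊕ one) _ (layerA-Q i m) (pQ-½ (i , m))

          halves : ∀ i j → lay false i j ≢ lay true i j → BothHalf i j
          halves i j ne with view i j
          ... | P m refl         = P-halves i m
          ... | Q i' m refl refl = Q-halves i' m
          -- Since o ≤ 1 there is a single leftover diagonal. The symbol slot of layer `z` in this
          -- row is in another cell, hence in a P or Q cell, where ½ is known; the row sum transfers
          -- it.
          ... | D z refl         = other-half' (cell-pair i j ne) true-½ , true-½
            where
            j' : Fin n
            j' = row i (unhalve (inj₂ z))
            shared : lay false i j' ≡ lay true i j
            shared = cong unhalve (trans (layerB-at (inj₂ z) (row-spec i (unhalve (inj₂ z)))) (sym (layerA-D i z)))
            j≢j' : j ≢ j'
            j≢j' e = ne (trans (cong (lay false i) e) shared)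
            false-½ : w false i j' ≡ ½
            false-½ with view i j'
            ... | P m e        = subst (λ j → w false i j ≡ ½) (sym e) (proj₁ (P-halves i m))
            ... | Q i' m e' e  = trans (cong₂ (w false) e' e) (proj₁ (Q-halves i' m))
            ... | D z' e       = ⊥-elim (j≢j' (trans (cong (λ z → i ⊕ unhalve (inj₂ z)) (o≤1 z z')) (sym e)))
            true-½ : w true i j ≡ ½
            true-½ = other-half' (row-pair true false (sym shared) j≢j') false-½

        determined : Y ≋ X
        determined i j k with lay false i j ≟ lay true i j
        determined i j k | no ne with lay false i j ≟ k | lay true i j ≟ k
        ... | yes refl | yes e    = ⊥-elim (ne (sym e))
        ... | yes refl | no _     = proj₁ (halves i j ne)
        ... | no _     | yes refl = proj₂ (halves i j ne)
        ... | no p     | no q     = supp i j k p q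
        determined i j k | yes e with lay false i j ≟ k | lay true i j ≟ k
        ... | yes _    | yes refl = trans (sym (cell-sum-≡ supp i j e)) (proj₂ (proj₂ (proj₂ tri)) i j)
        ... | no p     | no q     = supp i j k p q
        ... | yes p    | no q     = ⊥-elim (q (trans (sym e) p))
        ... | no p     | yes q    = ⊥-elim (p (trans e q))

      vertex : ((z z' : Fin o) → z ≡ z') → Tied → IsVertex X
      vertex o≤1 tied = rigid⇒vertex (λ Y tri supp → Rigid.determined o≤1 tied Y tri supp)

  -- Enumerating squares and normal forms of Latin squares.

  pigeonhole : {A K : Set} {_~_ : A → K → Set} {_≈_ : A → A → Set} →
    (∀ {x y k} → x ~ k → y ~ k → x ≈ y) →
    ∀ {xs} ks → AllPairs (λ x y → ¬ x ≈ y) xs → All (λ x → Any (x ~_) ks) xs → length xs ℕ.≤ length ks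
  pigeonhole                                  f ks []        []       = ℕ.z≤n
  pigeonhole {K = K} {_~_} {_≈_} f {x ∷ xs} ks (ns ∷ nss) (a ∷ as) =
    ℕ.≤-trans (ℕ.s≤s (pigeonhole f (ks ─ a) nss (All.zipWith (λ { {y} (n , b) → avoid (λ p q → n (f p q)) a b }) (ns , as))))
              (ℕ.≤-reflexive (sym (length-removeAt′ ks (Any.index a))))
    where
    avoid : ∀ {y ks} → (∀ {k} → x ~ k → y ~ k → ⊥) → (a : Any (x ~_) ks) → Any (y ~_) ks → Any (y ~_) (ks ─ a)
    avoid n (here p)  (here q)  = ⊥-elim (n p q)
    avoid n (here p)  (there b) = b
    avoid n (there a) (here q)  = here q
    avoid n (there a) (there b) = there (avoid n a b)

  Pointwise : {A : Set} (_≈_ : A → A → Set) → ∀ {n} → (Fin n → A) → (Fin n → A) → Set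
  Pointwise _≈_ f g = ∀ i → f i ≈ g i

  module _ {A : Set} {_≈_ : A → A → Set} where

    -- Functions with different heads differ at `zero`; functions with the same head differ on the
    -- tail.
    allFunctions-distinct : (∀ {x} → x ≈ x) → (∀ {x y} → x ≈ y → y ≈ x) → (∀ {x y z} → x ≈ y → y ≈ z → x ≈ z) →
      ∀ {xs} → AllPairs (λ x y → ¬ x ≈ y) xs → ∀ n → AllPairs (λ f g → ¬ Pointwise _≈_ f g) (allFunctions xs n)
    allFunctions-distinct ≈-refl ≈-sym ≈-trans ns zero    = [] ∷ []
    allFunctions-distinct ≈-refl ≈-sym ≈-trans ns (suc n) =
      AllPairs-concatMap {P = λ x f → f zero ≈ x} _ (λ n p q e → n (≈-trans (≈-sym p) (≈-trans (e zero) q)))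
        (λ x → AllPairsP.map⁺ (AllPairs.map (λ n e → n (e ∘ suc)) (allFunctions-distinct ≈-refl ≈-sym ≈-trans ns n)))
        (λ x → AllP.map⁺ (All.universal (λ _ → ≈-refl) _)) ns

    allFunctions-complete : ∀ {xs} n (f : Fin n → A) → (∀ i → Any (f i ≈_) xs) →
      Any (Pointwise _≈_ f) (allFunctions xs n)
    allFunctions-complete zero    f h = here λ ()
    allFunctions-complete (suc n) f h =
      AnyP.concatMap⁺ _ (Any.map (λ e → AnyP.map⁺ (Any.map (λ es → λ { zero → e ; (suc i) → es i })
        (allFunctions-complete n (f ∘ suc) (h ∘ suc)))) (h zero))

  length-allFunctions : {A : Set} (xs : List A) → ∀ n → length (allFunctions xs n) ≡ length xs ℕ.^ n
  length-allFunctions xs zero    = refl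
  length-allFunctions xs (suc n) =
    length-concatMap _ (length xs ℕ.^ n) (All.universal (λ x → trans (length-map _ (allFunctions xs n)) (length-allFunctions xs n)) xs)

  length-allFin : ∀ n → length (allFin n) ≡ n
  length-allFin n = length-tabulate id

  allSquares-distinct : ∀ n → AllPairs (λ M M' → ¬ Pointwise (Pointwise _≡_) M M') (allSquares n)
  allSquares-distinct n = allFunctions-distinct (λ _ → refl) (λ e i → sym (e i)) (λ e e' i → trans (e i) (e' i))
    (allFunctions-distinct refl sym trans (UniqueP.allFin⁺ n) n) n

  L-bound : ∀ n → L n ℕ.≤ (n ℕ.^ n) ℕ.^ n
  L-bound n = ℕ.≤-trans (length-filter isLatin? (allSquares n)) (ℕ.≤-reflexive
    (trans (length-allFunctions (allFunctions (allFin n) n) n)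
      (cong (ℕ._^ n) (trans (length-allFunctions (allFin n) n) (cong (ℕ._^ n) (length-allFin n))))))

  countFin-zero : ∀ {n} (f : Fin n → Bool) → countFin f ≡ 0 → ∀ i → f i ≢ true
  countFin-zero f e zero    t with f zero
  countFin-zero f () zero   t | true
  countFin-zero f e (suc i) t with f zero
  ... | false = countFin-zero (f ∘ suc) e i t

  countFin-one : ∀ {n} (f : Fin n → Bool) → countFin f ≡ 1 → Σ (Fin n) λ i → f i ≡ true × (∀ j → f j ≡ true → j ≡ i)
  countFin-one {suc n} f e with f zero in eq
  ... | true  = zero , eq , λ { zero _ → refl ; (suc j) t → ⊥-elim (countFin-zero (f ∘ suc) (ℕ.suc-injective e) j t) }
  ... | false with countFin-one (f ∘ suc) e
  ...   | i , t , u = suc i , t , λ { zero t' → ⊥-elim (clash (trans (sym eq) t')) ; (suc j) t' → cong suc (u j t') }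
    where
    clash : false ≢ true
    clash ()

  countFin-≟ : ∀ {m n} (g : Fin m → Fin n) s → countFin (λ j → ⌊ g j ≟ s ⌋) ≡ 1 →
    Σ (Fin m) λ j → g j ≡ s × (∀ {j'} → g j' ≡ s → j' ≡ j)
  countFin-≟ g s e with countFin-one (λ j → ⌊ g j ≟ s ⌋) e
  ... | j , t , u = j , toWitness {a? = g j ≟ s} (Equivalence.from T-≡ t) ,
                    λ {j'} q → u j' (Equivalence.to T-≡ (fromWitness {a? = g j' ≟ s} q))

  transpose-left : ∀ {n} (i j : Fin n) → transpose i j i ≡ j
  transpose-left i j with i ≟ i
  ... | yes _ = refl
  ... | no  n = ⊥-elim (n refl)

  transpose-fixes : ∀ {n} {i j k : Fin n} → k ≢ i → k ≢ j → transpose i j k ≡ k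
  transpose-fixes {i = i} {j} {k} p q with k ≟ i
  ... | yes e = ⊥-elim (p e)
  ... | no  _ with k ≟ j
  ...   | yes e = ⊥-elim (q e)
  ...   | no  _ = refl

  module Normalisation (h o : ℕ) .{{_ : NonZero (h ℕ.* 2 ℕ.+ o)}} (m₀ m₁ : Fin h) (at-0 : toℕ m₀ ≡ 0) (at-1 : toℕ m₁ ≡ 1) where
    open Construction h o

    fromIsLatin : ∀ {B} → IsLatin B → LatinSquare B
    fromIsLatin {B} (r , c) = record
      { row        = λ i s → proj₁ (countFin-≟ (B i) s (r i s))
      ; row-spec   = λ i s → proj₁ (proj₂ (countFin-≟ (B i) s (r i s)))
      ; row-unique = λ {i} {j} {s} → proj₂ (proj₂ (countFin-≟ (B i) s (r i s)))
      ; col        = λ j s → proj₁ (countFin-≟ (λ i → B i j) s (c j s))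
      ; col-spec   = λ j s → proj₁ (proj₂ (countFin-≟ (λ i → B i j) s (c j s)))
      ; col-unique = λ {i} {j} {s} → proj₂ (proj₂ (countFin-≟ (λ i → B i j) s (c j s)))
      }

    private
      𝟎 : Fin n
      𝟎 = 0 mod n

      0⊕ : ∀ x → 𝟎 ⊕ x ≡ x
      0⊕ x = toℕ-injective (trans (cong toℕ (⊕-comm 𝟎 x)) (trans (toℕ-⊕-mod x 0) (trans (cong (_% n) (ℕ.+-identityʳ _)) (toℕ-% x))))

      t₀-m₀ : t₀ m₀ ≡ 𝟎
      t₀-m₀ = toℕ-injective (trans (toℕ-unhalve m₀ 0₂) (trans (cong (λ z → 2 ℕ.* z ℕ.+ 0) at-0)
        (sym (trans (toℕ-mod 0) (m<n⇒m%n≡m {n = n} (ℕ.>-nonZero⁻¹ n))))))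

      t₁-injective : ∀ {m m'} → t₁ m ≡ t₁ m' → m ≡ m'
      t₁-injective {m} {m'} e with refl ← unhalve-injective {inj₁ (m , 1₂)} {inj₁ (m' , 1₂)} e = refl

      t₀-injective : ∀ {m m'} → t₀ m ≡ t₀ m' → m ≡ m'
      t₀-injective {m} {m'} e with refl ← unhalve-injective {inj₁ (m , 0₂)} {inj₁ (m' , 0₂)} e = refl

      m₀≢m₁ : m₀ ≢ m₁
      m₀≢m₁ e with () ← trans (sym at-0) (trans (cong toℕ e) at-1)

      corner : Fin n → Fin n
      corner r = 𝟎 ⊖ (r ⊕ one)

      corner⁻¹ : Fin n → Fin n
      corner⁻¹ u = (𝟎 ⊖ u) ⊖ one

      corner-inverse : ∀ u → corner (corner⁻¹ u) ≡ u
      corner-inverse u = ⊖-unique (trans (cong (_⊕ u) (⊖-⊕ one (𝟎 ⊖ u))) (⊖-⊕ u 𝟎))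

      corner-inverse' : ∀ r → corner⁻¹ (corner r) ≡ r
      corner-inverse' r = ⊖-unique (trans (⊕-comm one r) (sym (⊖-unique (⊖-⊕ (r ⊕ one) 𝟎))))

      c₀ c₁ : Fin n
      c₀ = 𝟎 ⊕ t₁ m₀
      c₁ = 𝟎 ⊕ t₁ m₁

      c≢𝟎 : ∀ m → 𝟎 ≢ 𝟎 ⊕ t₁ m
      c≢𝟎 m e = t₁≢t₀ (trans (sym (0⊕ (t₁ m))) (trans (sym e) (sym t₀-m₀)))

      c₀≢c₁ : c₁ ≢ c₀
      c₀≢c₁ e = m₀≢m₁ (sym (t₁-injective (⊕-cancelˡ 𝟎 e)))

    record Normal : Set where
      field
        square   : Fin n → Fin n → Fin n
        latin    : LatinSquare square
        column-0 : ∀ r → square r 𝟎 ≡ 𝟎 ⊖ (r ⊕ one)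
        same     : symbol-layer (halve (square 𝟎 (𝟎 ⊕ t₁ m₀))) ≡ symbol-layer (halve (square 𝟎 (𝟎 ⊕ t₁ m₁)))

    module _ (B : Square n) (isLatin : IsLatin B) where
      open LatinSquare (fromIsLatin isLatin)

      -- Each symbol is renamed after the row `r` in which it stands in column 0, to the name
      -- `corner r` that `column-0` prescribes.
      relabel relabel⁻¹ : Fin n → Fin n
      relabel   s = corner (col 𝟎 s)
      relabel⁻¹ u = B (corner⁻¹ u) 𝟎

      relabel-inverse : ∀ u → relabel (relabel⁻¹ u) ≡ u
      relabel-inverse u = trans (cong corner (sym (col-unique refl))) (corner-inverse u)

      relabel-inverse' : ∀ s → relabel⁻¹ (relabel s) ≡ s
      relabel-inverse' s = trans (cong (λ r → B r 𝟎) (corner-inverse' (col 𝟎 s))) (col-spec 𝟎 s)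

      private
        z₀ z₁ z₁' : Fin n
        z₀ = row 𝟎 (relabel⁻¹ (t₀ m₀))
        z₁ = row 𝟎 (relabel⁻¹ (t₁ m₀))
        z₁' = transpose z₀ c₀ z₁

        relabel-at : ∀ u → relabel (B 𝟎 (row 𝟎 (relabel⁻¹ u))) ≡ u
        relabel-at u = trans (cong relabel (row-spec 𝟎 _)) (relabel-inverse u)

        at-𝟎 : relabel (B 𝟎 𝟎) ≡ corner 𝟎
        at-𝟎 = cong corner (sym (col-unique refl))

        -- In row 0 the relabelled symbol of column 0 is -1, so any other `u` stands in another
        -- column. This is applied to u = 0 and u = 1; for the latter, 2 = `t₀ m₁` must differ from
        -- 0.
        𝟎≢z : ∀ u → u ⊕ one ≢ 𝟎 → 𝟎 ≢ row 𝟎 (relabel⁻¹ u)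
        𝟎≢z u ne e = ne (trans (cong (_⊕ one) (trans (sym (relabel-at u)) (trans (cong (relabel ∘ B 𝟎) (sym e)) at-𝟎)))
          (trans (cong (λ x → (𝟎 ⊖ x) ⊕ one) (0⊕ one)) (⊖-⊕ one 𝟎)))

        𝟎≢z₀ : 𝟎 ≢ z₀
        𝟎≢z₀ = 𝟎≢z (t₀ m₀) (λ e → t₁≢t₀ (trans (sym (t₀⊕one m₀)) (trans e (sym t₀-m₀))))

        𝟎≢z₁ : 𝟎 ≢ z₁
        𝟎≢z₁ = 𝟎≢z (t₁ m₀) (λ e → m₀≢m₁ (sym (t₀-injective
          (trans (sym (t₁⊕one m₀ m₁ (trans at-1 (cong suc (sym at-0))))) (trans e (sym t₀-m₀))))))

        z₁≢z₀ : z₁ ≢ z₀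
        z₁≢z₀ e = t₁≢t₀ (trans (sym (relabel-at (t₁ m₀))) (trans (cong (relabel ∘ B 𝟎) e) (relabel-at (t₀ m₀))))

      -- Two transpositions bring columns `z₀` and `z₁` to places `c₀` and `c₁`. As
      -- `transpose c₀ z₀` acts last, `c₁` first goes to `z₁'`, the point that it sends to `z₁`.
      -- Column 0 stays fixed, which preserves `column-0`.
      shuffle shuffle⁻¹ : Fin n → Fin n
      shuffle   j = transpose c₀ z₀ (transpose c₁ z₁' j)
      shuffle⁻¹ j = transpose z₁' c₁ (transpose z₀ c₀ j)

      shuffle-inverse : ∀ j → shuffle (shuffle⁻¹ j) ≡ j
      shuffle-inverse j = trans (cong (transpose c₀ z₀) (transpose-inverse c₁ z₁' {transpose z₀ c₀ j})) (transpose-inverse c₀ z₀)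

      shuffle-inverse' : ∀ j → shuffle⁻¹ (shuffle j) ≡ j
      shuffle-inverse' j = trans (cong (transpose z₁' c₁) (transpose-inverse z₀ c₀ {transpose c₁ z₁' j})) (transpose-inverse z₁' c₁)

      private
        back-z₁ : transpose c₀ z₀ z₁' ≡ z₁
        back-z₁ = transpose-inverse c₀ z₀

        shuffle-c₁ : shuffle c₁ ≡ z₁
        shuffle-c₁ = trans (cong (transpose c₀ z₀) (transpose-left c₁ z₁')) back-z₁

        shuffle-c₀ : shuffle c₀ ≡ z₀
        shuffle-c₀ = trans (cong (transpose c₀ z₀) (transpose-fixes (c₀≢c₁ ∘ sym)
          (λ e → z₁≢z₀ (trans (sym back-z₁) (trans (cong (transpose c₀ z₀) (sym e)) (transpose-left c₀ z₀))))))
          (transpose-left c₀ z₀)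

        shuffle-𝟎 : shuffle 𝟎 ≡ 𝟎
        shuffle-𝟎 = trans (cong (transpose c₀ z₀) (transpose-fixes (c≢𝟎 m₁)
          (λ e → 𝟎≢z₁ (trans (sym fix) (trans (cong (transpose c₀ z₀) e) back-z₁))))) fix
          where
          fix : transpose c₀ z₀ 𝟎 ≡ 𝟎
          fix = transpose-fixes (c≢𝟎 m₀) 𝟎≢z₀

        halve-at : ∀ {s x} → s ≡ unhalve x → halve s ≡ x
        halve-at refl = halve-unhalve _

      normalise : Normal
      normalise = record
        { square   = λ i j → relabel (B i (shuffle j))
        ; latin    = record
          { row        = λ i s → shuffle⁻¹ (row i (relabel⁻¹ s))
          ; row-spec   = λ i s → trans (cong (relabel ∘ B i) (shuffle-inverse _))
                           (trans (cong relabel (row-spec i _)) (relabel-inverse s))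
          ; row-unique = λ {i} {j} {s} e → trans (sym (shuffle-inverse' j)) (cong shuffle⁻¹ (row-unique (unlabel e)))
          ; col        = λ j s → col (shuffle j) (relabel⁻¹ s)
          ; col-spec   = λ j s → trans (cong relabel (col-spec (shuffle j) _)) (relabel-inverse s)
          ; col-unique = λ e → col-unique (unlabel e)
          }
        ; column-0 = λ r → trans (cong (relabel ∘ B r) shuffle-𝟎) (cong corner (sym (col-unique refl)))
        ; same     = trans (cong symbol-layer (halve-at {x = inj₁ (m₀ , 0₂)} (trans (cong (relabel ∘ B 𝟎) shuffle-c₀) (relabel-at (t₀ m₀)))))
                       (sym (cong symbol-layer (halve-at {x = inj₁ (m₀ , 1₂)} (trans (cong (relabel ∘ B 𝟎) shuffle-c₁) (relabel-at (t₁ m₀))))))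
        }
        where
        unlabel : ∀ {x s} → relabel x ≡ s → x ≡ relabel⁻¹ s
        unlabel {x} e = trans (sym (relabel-inverse' x)) (cong relabel⁻¹ e)

    layer : Normal → Fin n → Fin n → Fin n
    layer N i j = unhalve (symbol-layer (halve (Normal.square N i j)))

    SameLayers : Normal → Normal → Set
    SameLayers N N' = ∀ i j → layer N i j ≡ layer N' i j

    sameLayers? : ∀ N N' → Dec (SameLayers N N')
    sameLayers? N N' = all? λ i → all? λ j → layer N i j ≟ layer N' i j

    bit : Half → Fin 2
    bit (inj₁ (_ , b)) = b
    bit (inj₂ _)       = 0₂

    symbol-determined : ∀ x y → symbol-layer x ≡ symbol-layer y → bit x ≡ bit y → x ≡ y
    symbol-determined (inj₁ _) (inj₁ _) refl refl = refl
    symbol-determined (inj₂ _) (inj₂ _) refl _    = refl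

    -- The relabelling, the column permutation and the bits lost in symbol-layer: together with the
    -- layers of the normal form they determine a Latin square.
    Key : Set
    Key = (Fin n → Fin n) × (Fin n → Fin n) × (Fin n → Fin n → Fin 2)

    keys : List Key
    keys = cartesianProduct (allFunctions (allFin n) n)
      (cartesianProduct (allFunctions (allFin n) n) (allFunctions (allFunctions (allFin 2) n) n))

    length-keys : length keys ≡ (n ℕ.^ n) ℕ.* ((n ℕ.^ n) ℕ.* ((2 ℕ.^ n) ℕ.^ n))
    length-keys = trans (length-cart _,_ (allFunctions (allFin n) n) _) (cong₂ ℕ._*_ maps
      (trans (length-cart _,_ (allFunctions (allFin n) n) _) (cong₂ ℕ._*_ maps
        (trans (length-allFunctions (allFunctions (allFin 2) n) n) (cong (ℕ._^ n) (length-allFunctions (allFin 2) n))))))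
      where
      maps : length (allFunctions (allFin n) n) ≡ n ℕ.^ n
      maps = trans (length-allFunctions (allFin n) n) (cong (ℕ._^ n) (length-allFin n))

    Latin : Set
    Latin = Σ (Square n) IsLatin

    private
      bits : Latin → Fin n → Fin n → Fin 2
      bits (B , l) i j = bit (halve (Normal.square (normalise B l) i j))

      _~_ : Latin → Key → Set
      (B , l) ~ (π , ρ , β) = Pointwise _≡_ (relabel B l) π × Pointwise _≡_ (shuffle B l) ρ × Pointwise (Pointwise _≡_) (bits (B , l)) β

      has-key : ∀ B → Any (B ~_) keys
      has-key x@(B , l) = AnyP.cartesianProduct⁺ (among (relabel B l)) (AnyP.cartesianProduct⁺ (among (shuffle B l))
        (allFunctions-complete {_≈_ = Pointwise _≡_} n (bits x) (λ i → allFunctions-complete {_≈_ = _≡_} n (bits x i) (λ j → ∈-allFin (bits x i j)))))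
        where
        among : (f : Fin n → Fin n) → Any (Pointwise _≡_ f) (allFunctions (allFin n) n)
        among f = allFunctions-complete {_≈_ = _≡_} n f (λ i → ∈-allFin (f i))

      decode : ∀ x y k → SameLayers (normalise (proj₁ x) (proj₂ x)) (normalise (proj₁ y) (proj₂ y)) → x ~ k → y ~ k →
        Pointwise (Pointwise _≡_) (proj₁ x) (proj₁ y)
      decode (B , l) (B' , l') (π , ρ , β) s (pπ , pρ , pβ) (qπ , qρ , qβ) i j =
        trans (sym (relabel-inverse' B l (B i j))) (trans (cong (relabel⁻¹ B l) (trans same-label (trans (qπ (B' i j)) (sym (pπ (B' i j)))))) (relabel-inverse' B l (B' i j)))
        where
        j' : Fin n
        j' = shuffle⁻¹ B l j
        normal-≡ : relabel B l (B i (shuffle B l j')) ≡ relabel B' l' (B' i (shuffle B' l' j'))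
        normal-≡ = trans (sym (unhalve-halve _)) (trans (cong unhalve (symbol-determined (halve (relabel B l (B i (shuffle B l j')))) (halve (relabel B' l' (B' i (shuffle B' l' j'))))
          (unhalve-injective (s i j')) (trans (pβ i j') (sym (qβ i j'))))) (unhalve-halve _))
        same-label : relabel B l (B i j) ≡ relabel B' l' (B' i j)
        same-label = trans (cong (relabel B l ∘ B i) (sym (shuffle-inverse B l j))) (trans normal-≡
          (cong (relabel B' l' ∘ B' i) (trans (qρ j') (trans (sym (pρ j')) (shuffle-inverse B l j)))))

      latins : List Latin
      latins = All.toList (AllP.all-filter isLatin? (allSquares n))

      latins-distinct : AllPairs (λ x y → ¬ Pointwise (Pointwise _≡_) (proj₁ x) (proj₁ y)) latins
      latins-distinct = AllPairs-toList (AllP.all-filter isLatin? (allSquares n))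
        (AllPairsP.filter⁺ isLatin? (allSquares-distinct n))

      nf : Latin → Normal
      nf (B , l) = normalise B l

      R : Latin → Latin → Bool
      R x y = ⌊ sameLayers? (nf x) (nf y) ⌋

      R-same : ∀ x y → R x y ≡ true → SameLayers (nf x) (nf y)
      R-same x y e = toWitness (Equivalence.from T-≡ e)

      fibre : ∀ x → count (R x) latins ℕ.≤ length keys
      fibre x = pigeonhole {_~_ = λ y k → R x y ≡ true × y ~ k}
        (λ {y} {y'} {k} (s , p) (s' , p') → decode y y' k (λ i j → trans (sym (R-same x y s i j)) (R-same x y' s' i j)) p p')
        keys (AllPairsP.filter⁺ (T? ∘ R x) latins-distinct)
        (All.map (λ {y} s → Any.map (Equivalence.to T-≡ s ,_) (has-key y)) (AllP.all-filter (T? ∘ R x) latins))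

      all-latins : length latins ≡ L n
      all-latins = length-toList (AllP.all-filter isLatin? (allSquares n))

      R-refl : ∀ x → R x x ≡ true
      R-refl x = Equivalence.to T-≡ (fromWitness (λ i j → refl))

      conclude : (Σ (List Latin) λ ys → AllPairs (λ x y → R x y ≡ false) ys × length latins ℕ.≤ length keys ℕ.* length ys) →
        Σ (List Normal) λ Ns → AllPairs (λ N N' → ¬ SameLayers N N') Ns × L n ℕ.≤ length keys ℕ.* length Ns
      conclude (ys , apart , bound) = map nf ys ,
        AllPairsP.map⁺ (AllPairs.map (λ {x} {y} e s → clash (trans (sym e) (Equivalence.to T-≡ (fromWitness s)))) apart) ,
        subst₂ (λ l k → l ℕ.≤ length keys ℕ.* k) all-latins (sym (length-map nf ys)) bound
        where
        clash : false ≢ true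
        clash ()

    -- Latin squares are grouped by the layers of their normal forms. Squares in one group have
    -- different keys, so a group is no larger than `keys`.
    normal-forms : Σ (List Normal) λ Ns → AllPairs (λ N N' → ¬ SameLayers N N') Ns × L n ℕ.≤ length keys ℕ.* length Ns
    normal-forms = conclude (greedy R (length keys) R-refl latins (All.universal fibre latins))

  lookup-injective : {A : Set} {_≈_ : A → A → Set} → (∀ {x y} → x ≈ y → y ≈ x) →
    ∀ {xs} → AllPairs (λ x y → ¬ x ≈ y) xs → ∀ i j → lookup xs i ≈ lookup xs j → i ≡ j
  lookup-injective s (n ∷ ns) zero    zero    e = refl
  lookup-injective s (n ∷ ns) zero    (suc j) e = ⊥-elim (All.lookup n (∈-lookup j) e)
  lookup-injective s (n ∷ ns) (suc i) zero    e = ⊥-elim (All.lookup n (∈-lookup i) (s e))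
  lookup-injective s (n ∷ ns) (suc i) (suc j) e = cong suc (lookup-injective s ns i j e)

  ½-indicator : ∀ {n} {l k : Fin n} → indicator l k ≡ ½ → l ≡ k
  ½-indicator {l = l} {k} e with l ≟ k
  ... | yes q = q
  ... | no  _ with () ← e

  -- Distinct vertices from colourings and normal forms.

  module Family (h o : ℕ) .{{_ : NonZero (h ℕ.* 2 ℕ.+ o)}} (m₀ m₁ : Fin h) (at-0 : toℕ m₀ ≡ 0) (at-1 : toℕ m₁ ≡ 1)
    (o≤1 : (z z' : Fin o) → z ≡ z') where
    open Construction h o
    open Normalisation h o m₀ m₁ at-0 at-1

    Colouring : Set
    Colouring = Σ (Edge → Fin h) Proper

    fromFactorisation : ∀ {κ} → IsFactorisation (edges (allFin h)) (allFin h) κ → Proper κ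
    fromFactorisation f = record
      { exists = λ s v d → let (e , _ , p) = exists s v (∈-allFin d) in e , p
      ; unique = λ s → unique s (∈-edges (∈-allFin _)) (∈-edges (∈-allFin _))
      }
      where open IsFactorisation f

    array : Colouring → Normal → Array n
    array (α , p) N = Layers.X α p (Normal.square N) (Normal.latin N)

    array-vertex : ∀ c N → IsVertex (array c N)
    array-vertex (α , p) N = Layers.vertex α p square latin o≤1 record
      { column-0 = column-0 ; m₀ = m₀ ; m₁ = m₁ ; m₀≢m₁ = m₀≢m₁ ; same = same }
      where
      open Normal N
      m₀≢m₁ : m₀ ≢ m₁
      m₀≢m₁ e with () ← trans (sym at-0) (trans (cong toℕ e) at-1)

    module _ (α β : Edge → Fin h) (p : Proper α) (q : Proper β) (N M : Normal) where
      private
        module LN = Layers α p (Normal.square N) (Normal.latin N)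
        module LM = Layers β q (Normal.square M) (Normal.latin M)

      -- In a P cell the colour slot lies in a layer that no symbol slot of either array can enter.
      -- The entry ½ found there names the colour.
      array-colouring : array (α , p) N ≋ array (β , q) M → ∀ e → α e ≡ β e
      array-colouring eq (i , m) = inj₁-fst (trans (sym (LN.layerA-P i m)) (trans (sym layers) (LM.layerA-P i m)))
        where
        j : Fin n
        j = i ⊕ t₁ m
        inj₁-fst : ∀ {d d' : Fin h} {b b' : Fin 2} → inj₁ {B = Fin o} (d , b) ≡ inj₁ (d' , b') → d ≡ d'
        inj₁-fst refl = refl
        apart : LN.lay false i j ≢ LN.lay true i j
        apart e = LN.layerB≢0 (trans (unhalve-injective e) (LN.layerA-P i m))
        apart' : LM.lay false i j ≢ LN.lay true i j
        apart' e = LM.layerB≢0 (trans (unhalve-injective e) (LN.layerA-P i m))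
        half : ½ ≡ indicator (LM.lay true i j) (LN.lay true i j)
        half = trans (sym (trans (cong₂ _+_ (indicator-≢ apart) (indicator-≡ refl)) (+-identityˡ ½)))
          (trans (eq i j (LN.lay true i j)) (trans (cong (_+ indicator (LM.lay true i j) (LN.lay true i j)) (indicator-≢ apart')) (+-identityˡ _)))
        layers : LM.layerA i j ≡ LN.layerA i j
        layers = unhalve-injective (½-indicator (sym half))

      -- Once the colours agree, so do the slots of the first structure. Cancelling their
      -- contribution leaves the indicator of the symbol slot.
      array-layers : array (α , p) N ≋ array (β , q) M → SameLayers N M
      array-layers eq i j = sym (½-indicator (trans (sym cancelled) (indicator-≡ {l = LN.lay false i j} refl)))
        where
        k : Fin n
        k = LN.lay false i j
        same-half : ∀ i x → LN.half-layer i x ≡ LM.half-layer i x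
        same-half i (inj₁ (m , 0₂)) = cong (λ d → inj₁ (d , 0₂)) (array-colouring eq _)
        same-half i (inj₁ (m , 1₂)) = cong (λ d → inj₁ (d , 0₂)) (array-colouring eq _)
        same-half i (inj₂ z)        = refl
        same-A : LN.lay true i j ≡ LM.lay true i j
        same-A = cong unhalve (same-half i (halve (j ⊖ i)))
        cancelled : indicator (LN.lay false i j) k ≡ indicator (LM.lay false i j) k
        cancelled = ∙-cancelʳ (indicator (LM.lay true i j) k) _ _
          (trans (cong (λ l → indicator (LN.lay false i j) k + indicator l k) (sym same-A)) (eq i j k))

    vertices : (cs : List Colouring) → AllPairs (λ c c' → ¬ Agree (edges (allFin h)) (proj₁ c) (proj₁ c')) cs →
      (Ns : List Normal) → AllPairs (λ N N' → ¬ SameLayers N N') Ns → HasDistinctVertices n (length cs ℕ.* length Ns)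
    vertices cs distinct Ns distinct' = V , (λ x → array-vertex (lookup cs (proj₁ (index x))) (lookup Ns (proj₂ (index x)))) , V-injective
      where
      index : Fin (length cs ℕ.* length Ns) → Fin (length cs) × Fin (length Ns)
      index = remQuot (length Ns)
      V : Fin (length cs ℕ.* length Ns) → Array n
      V x = array (lookup cs (proj₁ (index x))) (lookup Ns (proj₂ (index x)))
      V-injective : ∀ x y → V x ≋ V y → x ≡ y
      V-injective x y e = trans (sym (combine-remQuot {length cs} (length Ns) x))
        (trans (cong₂ combine
          (lookup-injective {_≈_ = λ c c' → Agree (edges (allFin h)) (proj₁ c) (proj₁ c')} (λ a i → sym (a i)) distinct _ _
            (λ {e'} _ → array-colouring (proj₁ c) (proj₁ c') (proj₂ c) (proj₂ c') N N' e e'))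
          (lookup-injective {_≈_ = SameLayers} (λ s i j → sym (s i j)) distinct' _ _
            (array-layers (proj₁ c) (proj₁ c') (proj₂ c) (proj₂ c') N N' e)))
        (combine-remQuot {length cs} (length Ns) y))
        where
        c c' : Colouring
        c  = lookup cs (proj₁ (index x))
        c' = lookup cs (proj₁ (index y))
        N N' : Normal
        N  = lookup Ns (proj₂ (index x))
        N' = lookup Ns (proj₂ (index y))

    -- `A` counts colourings and `B` counts normal forms. They are kept apart because each is
    -- compared with a different power of `L n`.
    many-vertices : ∀ a b r → h ≡ b ℕ.* 2 ℕ.^ a ℕ.+ r →
      Σ ℕ λ A → Σ ℕ λ B → HasDistinctVertices n (A ℕ.* B) ×
        2 ℕ.^ (n ℕ.* (a ℕ.* 2 ℕ.^ a) ℕ.* b) ℕ.≤ A ℕ.* 2 ℕ.^ (n ℕ.* excess a ℕ.* b) ×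
        L n ℕ.≤ (n ℕ.^ n) ℕ.* ((n ℕ.^ n) ℕ.* ((2 ℕ.^ n) ℕ.^ n)) ℕ.* B
    many-vertices a b r e = assemble
      (blocks m₀ a b r (allFin h) (allFin h) (UniqueP.allFin⁺ h) (UniqueP.allFin⁺ h) (trans (length-allFin h) e) refl) normal-forms
      where
      assemble : (Σ (Factorisations (edges (allFin h)) (allFin h)) λ K →
          2 ℕ.^ (n ℕ.* (a ℕ.* 2 ℕ.^ a) ℕ.* b) ℕ.≤ length (proj₁ K) ℕ.* 2 ℕ.^ (n ℕ.* excess a ℕ.* b)) →
        (Σ (List Normal) λ Ns → AllPairs (λ N N' → ¬ SameLayers N N') Ns × L n ℕ.≤ length keys ℕ.* length Ns) → _
      assemble ((κs , fs , distinct) , large) (Ns , distinct' , large') =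
        length cs , length Ns , vertices cs (AllPairs-toList ps distinct) Ns distinct' ,
        subst (λ l → 2 ℕ.^ (n ℕ.* (a ℕ.* 2 ℕ.^ a) ℕ.* b) ℕ.≤ l ℕ.* 2 ℕ.^ (n ℕ.* excess a ℕ.* b)) (sym (length-toList ps)) large ,
        subst (λ l → L n ℕ.≤ l ℕ.* length Ns) length-keys large'
        where
        ps : All Proper κs
        ps = All.map fromFactorisation fs
        cs : List Colouring
        cs = All.toList ps

open Counting using (excess; *-^)
open Vertices using (L-bound; module Family)
open import Data.Nat using (_+_; _*_; _∸_; _^_; _≤_; _<_; z≤n; s≤s; _≤?_; >-nonZero)
open import Data.Fin using (fromℕ<)
open import Data.Fin.Properties using (toℕ-fromℕ<)
open import Data.Nat.Properties
open import Data.Nat.DivMod using (_/_; _%_; m≡m%n+[m/n]*n; m%n<n)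
open import Data.Nat.Solver using (module +-*-Solver)

-- Numerical comparison with the number of Latin squares.

log-bounds : ∀ n → 0 < n → Σ ℕ λ l → n ≤ 2 ^ l × 2 ^ l ≤ 2 * n
log-bounds (suc zero)      _ = 0 , ≤-refl , s≤s z≤n
log-bounds (suc n@(suc _)) _ with log-bounds n (s≤s z≤n)
... | l , p , q with suc n ≤? 2 ^ l
...   | yes r = l , r , ≤-trans q (*-monoʳ-≤ 2 (n≤1+n n))
...   | no  r = suc l , subst (λ x → suc n ≤ 2 * x) eq (+-mono-≤ (s≤s z≤n) (m≤m+n n 0))
                , *-monoʳ-≤ 2 (≤-trans (≤-reflexive (sym eq)) (n≤1+n n))
  where
  eq : n ≡ 2 ^ l
  eq = ≤-antisym p (≤-pred (≰⇒> r))

-- The solution 4 * 2^a - 2a - 4 of the recurrence, written without subtraction. It is smaller than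
-- the main term a * 2^a by a factor of order `a`.
excess-value : ∀ a → excess a + (2 * a + 4) ≡ 4 * 2 ^ a
excess-value zero    = refl
excess-value (suc a) = trans
  (solve 2 (λ a e → (con 1 :+ a :+ (con 1 :+ a)) :+ (e :+ e) :+ (con 2 :* (con 1 :+ a) :+ con 4)
     := con 2 :* (e :+ (con 2 :* a :+ con 4))) refl a (excess a))
  (trans (cong (2 *_) (excess-value a)) (solve 1 (λ w → con 2 :* (con 4 :* w) := con 4 :* (con 2 :* w)) refl (2 ^ a)))
  where open +-*-Solver

excess-≤ : ∀ a → excess a ≤ 4 * 2 ^ a
excess-≤ a = ≤-trans (m≤m+n (excess a) _) (≤-reflexive (excess-value a))

n≤2^n : ∀ n → n ≤ 2 ^ n
n≤2^n zero    = z≤n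
n≤2^n (suc n) = ≤-trans (+-mono-≤ (m^n>0 2 n) (n≤2^n n)) (+-monoʳ-≤ (2 ^ n) (m≤m+n (2 ^ n) 0))

-- l is log₂ n up to rounding, w = 2 ^ a the block size and q the number of columns covered by blocks in a row.
exponents : ∀ m n l a c w q → let M = suc m in
  l ≡ a + c → c ≡ M + 4 → n ≤ q + 2 * w → q ≤ n → 8 * (M * w) ≤ n → 16 * M ≤ n → 4 * ((M + 10) * M) ≤ l →
  m * (l * n) + (4 * (M * l) + 2 * (M * n) + 4 * (M * q)) ≤ M * (q * a)
exponents m n l a c w q refl refl n≤ q≤n w-small n-large l-large =
  +-cancelʳ-≤ (M * (q * c) + 2 * (M * (l' * w))) _ _ (begin
    m * (l' * n) + (4 * (M * l') + 2 * (M * n) + 4 * (M * q)) + (M * (q * c) + 2 * (M * (l' * w)))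
      ≡⟨ solve 4 (λ x y z u → x :+ y :+ (z :+ u) := x :+ (y :+ z :+ u)) refl (m * (l' * n)) (4 * (M * l') + 2 * (M * n) + 4 * (M * q)) (M * (q * c)) (2 * (M * (l' * w))) ⟩
    m * (l' * n) + (4 * (M * l') + 2 * (M * n) + 4 * (M * q) + M * (q * c) + 2 * (M * (l' * w)))
      ≤⟨ +-monoʳ-≤ (m * (l' * n)) small ⟩
    m * (l' * n) + l' * n        ≡⟨ solve 2 (λ m x → m :* x :+ x := (con 1 :+ m) :* x) refl m (l' * n) ⟩
    M * (l' * n)                 ≤⟨ *-monoʳ-≤ M (*-monoʳ-≤ l' n≤) ⟩
    M * (l' * (q + 2 * w))       ≡⟨ solve 5 (λ M a c q w → M :* ((a :+ c) :* (q :+ con 2 :* w))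
                                      := M :* (q :* a) :+ (M :* (q :* c) :+ con 2 :* (M :* ((a :+ c) :* w)))) refl M a c q w ⟩
    M * (q * a) + (M * (q * c) + 2 * (M * (l' * w))) ∎)
  where
  open ≤-Reasoning
  open +-*-Solver
  M l' : ℕ
  M  = suc m
  l' = a + c
  -- Multiplied by 4, the left side splits into three groups, each at most `l' * n`: 16 M l' by
  -- `n-large`, the block term by `w-small`, and the terms of order n, with coefficient 4 (M + 10)
  -- M, by `l-large`.
  small : 4 * (M * l') + 2 * (M * n) + 4 * (M * q) + M * (q * c) + 2 * (M * (l' * w)) ≤ l' * n
  small = *-cancelˡ-≤ 4 (begin
    4 * (4 * (M * l') + 2 * (M * n) + 4 * (M * q) + M * (q * c) + 2 * (M * (l' * w)))
      ≡⟨ solve 5 (λ M l n q w → con 4 :* (con 4 :* (M :* l) :+ con 2 :* (M :* n) :+ con 4 :* (M :* q) :+ M :* (q :* (M :+ con 4)) :+ con 2 :* (M :* (l :* w)))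
           := con 16 :* M :* l :+ con 4 :* (con 2 :* (M :* n) :+ (M :+ con 8) :* (M :* q)) :+ con 8 :* (M :* w) :* l) refl M l' n q w ⟩
    16 * M * l' + 4 * (2 * (M * n) + (M + 8) * (M * q)) + 8 * (M * w) * l'
      ≤⟨ +-mono-≤ (+-mono-≤ (*-monoˡ-≤ l' n-large) (*-monoʳ-≤ 4 (+-monoʳ-≤ (2 * (M * n)) (*-monoʳ-≤ (M + 8) (*-monoʳ-≤ M q≤n))))) (*-monoˡ-≤ l' w-small) ⟩
    n * l' + 4 * (2 * (M * n) + (M + 8) * (M * n)) + n * l'
      ≡⟨ solve 3 (λ M n l → n :* l :+ con 4 :* (con 2 :* (M :* n) :+ (M :+ con 8) :* (M :* n)) :+ n :* l
           := con 4 :* ((M :+ con 10) :* M) :* n :+ con 2 :* (l :* n)) refl M n l' ⟩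
    4 * ((M + 10) * M) * n + 2 * (l' * n)   ≤⟨ +-monoˡ-≤ (2 * (l' * n)) (*-monoˡ-≤ n l-large) ⟩
    l' * n + 2 * (l' * n)                   ≤⟨ m≤n+m _ (l' * n) ⟩
    l' * n + (l' * n + 2 * (l' * n))        ≡⟨ solve 1 (λ x → x :+ (x :+ con 2 :* x) := con 4 :* x) refl (l' * n) ⟩
    4 * (l' * n)                            ∎)

-- The base may be 0, where 0 ^ 0 = 1 would break monotonicity; hence `1 ≤ p`.
^-weaken : ∀ x {p q} → 1 ≤ p → p ≤ q → x ^ p ≤ x ^ q
^-weaken zero    {suc p} _ _ = z≤n
^-weaken (suc x) _ h         = ^-monoʳ-≤ (suc x) h

-- The exponent is at most K + m with K = 2(m+1). The factor `ℓ ^ K` is compared with `B ^ K` up to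
-- the key factor 2^E. The factor `ℓ ^ m`, estimated by the number of all squares, is paid for by
-- `A ^ K`, together with all losses.
powers : ∀ m n l S a A B ℓ → n ≤ 2 ^ l →
  2 ^ (S * a) ≤ A * 2 ^ (4 * S) →
  ℓ ≤ (n ^ n) * ((n ^ n) * ((2 ^ n) ^ n)) * B →
  ℓ ≤ (n ^ n) ^ n →
  m * (l * (n * n)) + (4 * (suc m * (l * n)) + 2 * (suc m * (n * n)) + 8 * (suc m * S)) ≤ 2 * suc m * (S * a) →
  ℓ ^ (3 * suc m ∸ 2) ≤ (A * B) ^ (2 * suc m)
powers m n l S a A B ℓ n≤ large-A large-B total h = *-cancelʳ-≤ _ _ (2 ^ (4 * S * K)) {{m^n≢0 2 (4 * S * K)}} (begin
  ℓ ^ (3 * suc m ∸ 2) * 2 ^ (4 * S * K)          ≤⟨ *-monoˡ-≤ _ (^-weaken ℓ one-≤ below) ⟩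
  ℓ ^ (K + m) * 2 ^ (4 * S * K)                  ≡⟨ cong (_* 2 ^ (4 * S * K)) (^-distribˡ-+-* ℓ K m) ⟩
  ℓ ^ K * ℓ ^ m * 2 ^ (4 * S * K)               ≤⟨ *-monoˡ-≤ _ (*-mono-≤ (^-monoˡ-≤ K L₁) (^-monoˡ-≤ m L₂)) ⟩
  (2 ^ E * B) ^ K * (2 ^ (l * n * n)) ^ m * 2 ^ (4 * S * K)
     ≡⟨ cong₂ (λ x y → x * y * 2 ^ (4 * S * K)) (*-^ K (2 ^ E) B) (^-*-assoc 2 (l * n * n) m) ⟩
  (2 ^ E) ^ K * B ^ K * 2 ^ (l * n * n * m) * 2 ^ (4 * S * K)
     ≡⟨ cong (λ x → x * B ^ K * 2 ^ (l * n * n * m) * 2 ^ (4 * S * K)) (^-*-assoc 2 E K) ⟩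
  2 ^ (E * K) * B ^ K * 2 ^ (l * n * n * m) * 2 ^ (4 * S * K)
     ≡⟨ solve 4 (λ x y z u → x :* y :* z :* u := z :* x :* u :* y) refl (2 ^ (E * K)) (B ^ K) (2 ^ (l * n * n * m)) (2 ^ (4 * S * K)) ⟩
  2 ^ (l * n * n * m) * 2 ^ (E * K) * 2 ^ (4 * S * K) * B ^ K
     ≡⟨ cong (_* B ^ K) (sym (trans (^-distribˡ-+-* 2 (l * n * n * m + E * K) (4 * S * K)) (cong (_* 2 ^ (4 * S * K)) (^-distribˡ-+-* 2 (l * n * n * m) (E * K))))) ⟩
  2 ^ (l * n * n * m + E * K + 4 * S * K) * B ^ K      ≤⟨ *-monoˡ-≤ (B ^ K) (^-monoʳ-≤ 2 exponent) ⟩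
  2 ^ (S * a * K) * B ^ K                              ≡⟨ cong (_* B ^ K) (sym (^-*-assoc 2 (S * a) K)) ⟩
  (2 ^ (S * a)) ^ K * B ^ K                            ≤⟨ *-monoˡ-≤ (B ^ K) (^-monoˡ-≤ K large-A) ⟩
  (A * 2 ^ (4 * S)) ^ K * B ^ K                        ≡⟨ cong (_* B ^ K) (trans (*-^ K A (2 ^ (4 * S))) (cong (A ^ K *_) (^-*-assoc 2 (4 * S) K))) ⟩
  A ^ K * 2 ^ (4 * S * K) * B ^ K                      ≡⟨ solve 3 (λ x y z → x :* y :* z := x :* z :* y) refl (A ^ K) (2 ^ (4 * S * K)) (B ^ K) ⟩
  A ^ K * B ^ K * 2 ^ (4 * S * K)                      ≡⟨ cong (_* 2 ^ (4 * S * K)) (sym (*-^ K A B)) ⟩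
  (A * B) ^ K * 2 ^ (4 * S * K)                        ∎)
  where
  open ≤-Reasoning
  open +-*-Solver
  K E : ℕ
  K = 2 * suc m
  E = 2 * (l * n) + n * n
  three : 3 * suc m ∸ 2 ≡ 1 + 3 * m
  three = cong (_∸ 2) (*-suc 3 m)
  one-≤ : 1 ≤ 3 * suc m ∸ 2
  one-≤ = ≤-trans (s≤s z≤n) (≤-reflexive (sym three))
  below : 3 * suc m ∸ 2 ≤ K + m
  below = ≤-trans (≤-reflexive three) (≤-trans (n≤1+n _) (≤-reflexive
    (solve 1 (λ m → con 2 :+ con 3 :* m := con 2 :* (con 1 :+ m) :+ m) refl m)))
  n^n : n ^ n ≤ 2 ^ (l * n)
  n^n = ≤-trans (^-monoˡ-≤ n n≤) (≤-reflexive (^-*-assoc 2 l n))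
  L₂ : ℓ ≤ 2 ^ (l * n * n)
  L₂ = ≤-trans total (≤-trans (^-monoˡ-≤ n n^n) (≤-reflexive (^-*-assoc 2 (l * n) n)))
  L₁ : ℓ ≤ 2 ^ E * B
  L₁ = ≤-trans large-B (*-monoˡ-≤ B (≤-trans (*-mono-≤ n^n (*-mono-≤ n^n (≤-reflexive (^-*-assoc 2 n n))))
    (≤-reflexive (trans (cong (2 ^ (l * n) *_) (sym (^-distribˡ-+-* 2 (l * n) (n * n))))
      (trans (sym (^-distribˡ-+-* 2 (l * n) (l * n + n * n)))
        (cong (2 ^_) (solve 2 (λ x y → x :+ (x :+ y) := con 2 :* x :+ y) refl (l * n) (n * n))))))))
  exponent : l * n * n * m + E * K + 4 * S * K ≤ S * a * K
  exponent = ≤-trans (≤-reflexive (solve 4 (λ l n m S → l :* n :* n :* m :+ (con 2 :* (l :* n) :+ n :* n) :* (con 2 :* (con 1 :+ m)) :+ con 4 :* S :* (con 2 :* (con 1 :+ m))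
      := m :* (l :* (n :* n)) :+ (con 4 :* ((con 1 :+ m) :* (l :* n)) :+ con 2 :* ((con 1 :+ m) :* (n :* n)) :+ con 8 :* ((con 1 :+ m) :* S))) refl l n m S))
    (≤-trans h (≤-reflexive (*-comm K (S * a))))

bound-for : ∀ m t h o → o < 2 → 4 * ((suc m + 10) * suc m) ≤ t → 2 ^ t ≤ h * 2 + o → 16 * suc m ≤ h * 2 + o →
  Σ ℕ λ k → HasDistinctVertices (h * 2 + o) k × L (h * 2 + o) ^ (3 * suc m ∸ 2) ≤ k ^ (2 * suc m)
bound-for m t h o o<2 large-t large-l large-n = go (log-bounds (h * 2 + o) positive-n)
  where
  n M c : ℕ
  n = h * 2 + o
  M = suc m
  -- 2^(M+4) ≥ 16 M and 2^l ≤ 2n make a block of size w = 2^(l - c) satisfy 8 M w ≤ n.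
  c = M + 4
  positive-n : 0 < n
  positive-n = ≤-trans (m^n>0 2 t) large-l
  instance
    n≢0 : NonZero (h * 2 + o)
    n≢0 = >-nonZero positive-n
  h≥2 : 2 ≤ h
  -- The indices `m₀` and `m₁` require two shifts. For h ≤ 1 one would have n ≤ 3, against n ≥ 16 M.
  h≥2 with 2 ≤? h
  ... | yes p = p
  ... | no  p = ⊥-elim (<⇒≱ (≤-trans (s≤s (+-mono-≤ (*-monoˡ-≤ 2 (≤-pred (≰⇒> p))) (≤-pred o<2)))
                  (≤-trans (m≤m+n 4 12) (m≤m*n 16 M))) large-n)
  unique-index : (z z' : Fin o) → z ≡ z'
  unique-index = at-most-one o o<2
    where
    at-most-one : ∀ o → o < 2 → (z z' : Fin o) → z ≡ z'
    at-most-one (suc zero)    _               zero zero = refl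
    at-most-one (suc (suc o)) (s≤s (s≤s ()))
  open Family h o (fromℕ< (≤-trans (n≤1+n 1) h≥2)) (fromℕ< h≥2) (toℕ-fromℕ< _) (toℕ-fromℕ< _) unique-index
  go : (Σ ℕ λ l → n ≤ 2 ^ l × 2 ^ l ≤ 2 * n) → Σ ℕ λ k → HasDistinctVertices n k × L n ^ (3 * M ∸ 2) ≤ k ^ (2 * M)
  go (l , n≤ , ≤2n) = conclude (many-vertices a b r h-split)
    where
    l-large : 4 * ((M + 10) * M) ≤ l
    l-large = ≤-trans large-t (^-cancelʳ-≤ (≤-trans large-l n≤))
      where
      ^-cancelʳ-≤ : ∀ {x y} → 2 ^ x ≤ 2 ^ y → x ≤ y
      ^-cancelʳ-≤ {x} {y} e with x ≤? y
      ... | yes p = p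
      ... | no  p with () ← <⇒≱ (^-monoʳ-< 2 (s≤s (s≤s z≤n)) (≰⇒> p)) e
    c≤l : c ≤ l
    c≤l = ≤-trans (begin
      M + 4                        ≤⟨ +-monoʳ-≤ M (s≤s (s≤s (s≤s (s≤s z≤n)))) ⟩
      M + 10                       ≤⟨ m≤m*n (M + 10) M ⟩
      (M + 10) * M                 ≤⟨ m≤m+n _ _ ⟩
      4 * ((M + 10) * M)           ∎) l-large
      where open ≤-Reasoning
    a w b r q S : ℕ
    a = l ∸ c
    w = 2 ^ a
    instance
      w≢0 : NonZero (2 ^ a)
      w≢0 = m^n≢0 2 a
    b = h / w
    r = h % w
    q = 2 * (b * w)
    S = n * (b * w)
    l-split : l ≡ a + c
    l-split = sym (m∸n+n≡m c≤l)
    h-split : h ≡ b * w + r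
    h-split = trans (m≡m%n+[m/n]*n h w) (+-comm r (b * w))
    q≤n : q ≤ n
    q≤n = begin
      2 * (b * w)          ≤⟨ *-monoʳ-≤ 2 (m≤m+n (b * w) r) ⟩
      2 * (b * w + r)      ≡⟨ cong (2 *_) (sym h-split) ⟩
      2 * h                ≡⟨ *-comm 2 h ⟩
      h * 2                ≤⟨ m≤m+n (h * 2) o ⟩
      n                    ∎
      where open ≤-Reasoning
    n≤q+2w : n ≤ q + 2 * w
    -- The `r` uncovered shifts account for 2r indices and `o` for at most one more; r + 1 ≤ w
    -- absorbs both.
    n≤q+2w = begin
      h * 2 + o                  ≡⟨ cong (λ h → h * 2 + o) h-split ⟩
      (b * w + r) * 2 + o        ≤⟨ +-monoʳ-≤ ((b * w + r) * 2) (≤-trans (≤-pred o<2) (n≤1+n 1)) ⟩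
      (b * w + r) * 2 + 2        ≡⟨ solve 2 (λ x r → (x :+ r) :* con 2 :+ con 2 := con 2 :* x :+ con 2 :* (con 1 :+ r)) refl (b * w) r ⟩
      q + 2 * suc r              ≤⟨ +-monoʳ-≤ q (*-monoʳ-≤ 2 (m%n<n h w)) ⟩
      q + 2 * w                  ∎
      where
      open ≤-Reasoning
      open +-*-Solver
    w-small : 8 * (M * w) ≤ n
    w-small = *-cancelˡ-≤ 2 (begin
      2 * (8 * (M * w))          ≡⟨ solve 2 (λ M w → con 2 :* (con 8 :* (M :* w)) := w :* (M :* con 16)) refl M w ⟩
      w * (M * 16)               ≤⟨ *-monoʳ-≤ w (*-monoˡ-≤ 16 (n≤2^n M)) ⟩
      w * (2 ^ M * 2 ^ 4)        ≡⟨ cong (w *_) (sym (^-distribˡ-+-* 2 M 4)) ⟩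
      2 ^ a * 2 ^ c              ≡⟨ sym (^-distribˡ-+-* 2 a c) ⟩
      2 ^ (a + c)                ≡⟨ cong (2 ^_) (sym l-split) ⟩
      2 ^ l                      ≤⟨ ≤2n ⟩
      2 * n                      ∎)
      where
      open ≤-Reasoning
      open +-*-Solver
    exponent : m * (l * (n * n)) + (4 * (M * (l * n)) + 2 * (M * (n * n)) + 8 * (M * S)) ≤ 2 * M * (S * a)
    exponent = begin
      m * (l * (n * n)) + (4 * (M * (l * n)) + 2 * (M * (n * n)) + 8 * (M * S))
        ≡⟨ solve 5 (λ m M n l x → m :* (l :* (n :* n)) :+ (con 4 :* (M :* (l :* n)) :+ con 2 :* (M :* (n :* n)) :+ con 8 :* (M :* (n :* x)))
             := n :* (m :* (l :* n) :+ (con 4 :* (M :* l) :+ con 2 :* (M :* n) :+ con 4 :* (M :* (con 2 :* x))))) refl m M n l (b * w) ⟩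
      n * (m * (l * n) + (4 * (M * l) + 2 * (M * n) + 4 * (M * q)))
        ≤⟨ *-monoʳ-≤ n (exponents m n l a c w q l-split refl n≤q+2w q≤n w-small large-n l-large) ⟩
      n * (M * (q * a))
        ≡⟨ solve 4 (λ n M x a → n :* (M :* (con 2 :* x :* a)) := con 2 :* M :* (n :* x :* a)) refl n M (b * w) a ⟩
      2 * M * (S * a) ∎
      where
      open ≤-Reasoning
      open +-*-Solver
    conclude : (Σ ℕ λ A → Σ ℕ λ B → HasDistinctVertices n (A * B) ×
        2 ^ (n * (a * 2 ^ a) * b) ≤ A * 2 ^ (n * excess a * b) ×
        L n ≤ (n ^ n) * ((n ^ n) * ((2 ^ n) ^ n)) * B) →
      Σ ℕ λ k → HasDistinctVertices n k × L n ^ (3 * M ∸ 2) ≤ k ^ (2 * M)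
    conclude (A , B , V , large-A , large-B) = A * B , V , powers m n l S a A B (L n) n≤ large-A' large-B (L-bound n) exponent
      where
      large-A' : 2 ^ (S * a) ≤ A * 2 ^ (4 * S)
      large-A' = begin
        2 ^ (S * a)                      ≡⟨ cong (2 ^_) (solve 4 (λ n b w a → n :* (b :* w) :* a := n :* (a :* w) :* b) refl n b w a) ⟩
        2 ^ (n * (a * 2 ^ a) * b)        ≤⟨ large-A ⟩
        A * 2 ^ (n * excess a * b)       ≤⟨ *-monoʳ-≤ A (^-monoʳ-≤ 2 (*-monoˡ-≤ b (*-monoʳ-≤ n (excess-≤ a)))) ⟩
        A * 2 ^ (n * (4 * w) * b)        ≡⟨ cong (λ x → A * 2 ^ x) (solve 3 (λ n b w → n :* (con 4 :* w) :* b := con 4 :* (n :* (b :* w))) refl n b w) ⟩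
        A * 2 ^ (4 * S)                  ∎
        where
        open ≤-Reasoning
        open +-*-Solver

-- The quotient of the exponents is 3/2 - 1/(m+1). A threshold for every `m` is the o(1) of the
-- theorem, and integer powers avoid real exponents.
theorem5 : (m : ℕ) → Σ ℕ λ N → (n : ℕ) → N ≤ n →
    Σ ℕ λ k → HasDistinctVertices n k ×
    L n ^ (3 * suc m ∸ 2) ≤ k ^ (2 * suc m)
theorem5 m = 2 ^ t + 16 * suc m , λ n large →
  subst (λ n → 2 ^ t ≤ n → 16 * suc m ≤ n → Σ ℕ λ k → HasDistinctVertices n k × L n ^ (3 * suc m ∸ 2) ≤ k ^ (2 * suc m))
    -- n is rewritten as h * 2 + o with h = n / 2 and o = n % 2, so both parities are treated at
    -- once.
    (sym (trans (m≡m%n+[m/n]*n n 2) (+-comm (n % 2) _)))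
    (bound-for m t (n / 2) (n % 2) (m%n<n n 2) ≤-refl)
    (≤-trans (m≤m+n (2 ^ t) _) large) (≤-trans (m≤n+m (16 * suc m) (2 ^ t)) large)
  where
  t : ℕ
  -- From 2^t ≤ n ≤ 2^l follows t ≤ l, which is the lower bound on the logarithm demanded by
  -- `exponents`.
  t = 4 * ((suc m + 10) * suc m)
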